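{- Let $r\ge 2$ and $d\ge 3$ be fixed integers, and let $G\in\mathcal{G}_{n,d}$ be a random $d$-regular graph. Then with high probability $\mathcal{D}_r(G,\mathcal{T}_n)=\Theta(n)$; that is, there are constants $c_1,c_2>0$ depending only on $r$ and $d$ such that with probability tending to $1$ as $n\to\infty$ one has $c_1 n\le \mathcal{D}_r(G,\mathcal{T}_n)\le c_2 n$.
   Context: $\mathcal{G}_{n,d}$ denotes the uniform distribution over the set of all (simple, labelled) $d$-regular graphs on $n$ vertices, with $dn$ even. "With high probability" means with probability tending to $1$ as $n\to\infty$ (over $n$ with $dn$ even). (Such $G$ is connected with high probability, so the quantity below is defined with high probability.) Spanning-tree discrepancy: for a connected $n$-vertex graph $G$, an $r$-colouring $f:E(G)\to[r]$ of its edges, and a spanning tree $T$ of $G$ (which has $n-1$ edges), put $D_f(T) := r\cdot\left(\max_{1\le i\le r}|f^{ -1}(i)\cap E(T)| - \frac{n-1}{r}\right)$. The $r$-colour spanning-tree discrepancy of $G$ is $\mathcal{D}_r(G,\mathcal{T}_n) := \min_{f:E(G)\to[r]}\ \max_{T} D_f(T)$, where the maximum is over all spanning trees $T$ of $G$. -}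

module Defs where

open import Data.Nat.Base as ℕ using (ℕ; zero; suc; NonZero; z≤n; s≤s)
import Data.Nat.Properties as ℕ
open import Data.Nat.Divisibility using () renaming (_∣_ to _divides_)
open import Data.Integer.Base as ℤ using (+_)
open import Data.Rational.Base
  using (ℚ; 0ℚ; 1ℚ; _/_; _-_; _*_; _≤_; _<_; ∣_∣)
open import Data.Rational.Properties using (≤-decTotalOrder; _≤?_)
open import Data.Fin.Base as Fin using (Fin; zero; suc)
import Data.Fin.Properties as Fin
open import Data.Fin.Subset
  using (Subset; inside; outside; _∈_; _∉_; _∩_) renaming (∣_∣ to card)
open import Data.Fin.Subset.Properties using (_∈?_)
open import Data.Vec.Base as Vec using (Vec; []; _∷_)
open import Data.List.Base as List
  using (List; []; _∷_; _++_; length; map; filter; mapMaybe; take; head; last;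
         allFin; cartesianProduct; cartesianProductWith)
import Data.List.Extrema
import Data.List.Extrema.Nat as ℕ-Extrema
open import Data.List.Membership.Propositional.Properties using (∈-lookup)
open import Data.List.Relation.Unary.All as All using (All; []; _∷_)
open import Data.List.Relation.Unary.AllPairs using ([]; _∷_)
open import Data.List.Relation.Unary.Linked using (Linked; linked?)
open import Data.List.Relation.Unary.Unique.Propositional using (Unique)
import Data.List.Relation.Unary.Unique.DecPropositional as DecUnique
open import Data.Maybe.Base using (Maybe; just; nothing)
import Data.Maybe.Properties as Maybe
open import Data.Maybe.Relation.Unary.Any as MaybeAny using () renaming (Any to AnyMaybe)
open import Data.Product.Base using (_×_; _,_; ∃; ∃-syntax)
import Data.Product.Properties as Product
open import Data.Sum.Base using (_⊎_; inj₁; inj₂)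
open import Function.Base using (_∘_)
open import Relation.Binary.Bundles using (DecTotalOrder)
import Relation.Binary.Definitions as Binary
open import Relation.Binary.PropositionalEquality
  using (_≡_; refl; cong; sym)
open import Relation.Nullary using (Dec; ¬_; does; contradiction)
open import Relation.Nullary.Decidable using (map′; ¬?; _×-dec_; _⊎-dec_; _→-dec_)
open import Relation.Unary using (Decidable)

private
  variable
    A : Set
    n : ℕ

  module ℚ-Extrema = Data.List.Extrema (DecTotalOrder.totalOrder ≤-decTotalOrder)

vectors : List A → ∀ n → List (Vec A n)
vectors xs zero    = [] ∷ []
vectors xs (suc n) = cartesianProductWith _∷_ xs (vectors xs n)

subsets : ∀ n → List (Subset n)
subsets = vectors (inside ∷ outside ∷ [])

maximum minimum : List ℚ → Maybe ℚ
maximum []       = nothing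
maximum (x ∷ xs) = just (ℚ-Extrema.max x xs)
minimum []       = nothing
minimum (x ∷ xs) = just (ℚ-Extrema.min x xs)

-- A labelled graph on the vertex set Fin n, given by its adjacency matrix:
-- row u is the neighbourhood of u.  Being simple is part of IsRegular.
Adjacency : ℕ → Set
Adjacency n = Vec (Subset n) n

neighbours : Adjacency n → Fin n → Subset n
neighbours = Vec.lookup

IsSimple : Adjacency n → Set
IsSimple G = (∀ u → u ∉ neighbours G u)
           × (∀ u v → u ∈ neighbours G v → v ∈ neighbours G u)

IsRegular : ℕ → Adjacency n → Set
IsRegular d G = IsSimple G × (∀ v → card (neighbours G v) ≡ d)

isRegular? : ∀ d → Decidable (IsRegular {n} d)
isRegular? d G =
  (Fin.all? (λ u → ¬? (u ∈? neighbours G u))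
    ×-dec Fin.all? (λ u → Fin.all? (λ v →
            (u ∈? neighbours G v) →-dec (v ∈? neighbours G u))))
  ×-dec Fin.all? (λ v → card (neighbours G v) ℕ.≟ d)

regularGraphs : ∀ n d → List (Adjacency n)
regularGraphs n d = filter (isRegular? d) (vectors (subsets n) n)

-- E(G): each edge is listed once, with its smaller endpoint first.
edges : Adjacency n → List (Fin n × Fin n)
edges {n} G = filter (λ (u , v) → (u Fin.<? v) ×-dec (v ∈? neighbours G u))
                     (cartesianProduct (allFin n) (allFin n))

∣E_∣ : Adjacency n → ℕ
∣E G ∣ = length (edges G)

-- A set of edges of G, equivalently a spanning subgraph of G.
EdgeSet : Adjacency n → Set
EdgeSet G = Subset ∣E G ∣

module _ (G : Adjacency n) where

  Joins : Fin ∣E G ∣ → Fin n → Fin n → Set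
  Joins e u v = List.lookup (edges G) e ≡ (u , v)
              ⊎ List.lookup (edges G) e ≡ (v , u)

  Adjacent : EdgeSet G → Fin n → Fin n → Set
  Adjacent T u v = ∃[ e ] (e ∈ T × Joins e u v)

  adjacent? : ∀ T → Binary.Decidable (Adjacent T)
  adjacent? T u v = Fin.any? (λ e → (e ∈? T) ×-dec
    ((List.lookup (edges G) e ≟ (u , v)) ⊎-dec (List.lookup (edges G) e ≟ (v , u))))
    where _≟_ = Product.≡-dec Fin._≟_ Fin._≟_

module _ (_~_ : Fin n → Fin n → Set) where

  IsPath : Fin n → Fin n → List (Fin n) → Set
  IsPath u v p = Unique p × Linked _~_ p × head p ≡ just u × last p ≡ just v

  -- take 1 repeats the first vertex at the end, closing up the cycle.
  IsCycle : List (Fin n) → Set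
  IsCycle c = Unique c × Linked _~_ (c ++ take 1 c) × 3 ℕ.≤ length c

  Connected : Set
  Connected = ∀ u v → ∃ (IsPath u v)

  Acyclic : Set
  Acyclic = ¬ ∃ IsCycle

  IsTree : Set
  IsTree = Connected × Acyclic

IsSpanningTree : (G : Adjacency n) → EdgeSet G → Set
IsSpanningTree G T = IsTree (Adjacent G T)

private
  lookup-injective : {xs : List A} → Unique xs →
                     ∀ {i j} → List.lookup xs i ≡ List.lookup xs j → i ≡ j
  lookup-injective (_ ∷ _)   {zero}  {zero}  _  = refl
  lookup-injective (x∉ ∷ _)  {zero}  {suc j} eq =
    contradiction eq (All.lookup x∉ (∈-lookup j))
  lookup-injective (x∉ ∷ _)  {suc i} {zero}  eq =
    contradiction (sym eq) (All.lookup x∉ (∈-lookup i))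
  lookup-injective (_ ∷ uxs) {suc i} {suc j} eq = cong suc (lookup-injective uxs eq)

  unique⇒length≤n : {xs : List (Fin n)} → Unique xs → length xs ℕ.≤ n
  unique⇒length≤n uxs = Fin.injective⇒≤ (lookup-injective uxs)

  short? : ∀ k {P : List (Fin n) → Set} → Decidable P →
           Dec (∃[ xs ] (length xs ℕ.≤ k × P xs))
  short? zero P? = map′ (λ p → [] , z≤n , p) (λ { ([] , _ , p) → p }) (P? [])
  short? (suc k) P? =
    map′ (λ { (inj₁ p)                → [] , z≤n , p
            ; (inj₂ (x , xs , l , p)) → x ∷ xs , s≤s l , p })
         (λ { ([] , _ , p)            → inj₁ p
            ; (x ∷ xs , s≤s l , p)    → inj₂ (x , xs , l , p) })
         (P? [] ⊎-dec Fin.any? (λ x → short? k (P? ∘ (x ∷_))))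

  unique? : Decidable (Unique {A = Fin n})
  unique? = DecUnique.unique? Fin._≟_

  anyUnique? : {P : List (Fin n) → Set} → Decidable P → Dec (∃[ xs ] (Unique xs × P xs))
  anyUnique? {n} P? =
    map′ (λ (xs , _ , p) → xs , p)
         (λ (xs , u , p) → xs , unique⇒length≤n u , u , p)
         (short? n (λ xs → unique? xs ×-dec P? xs))

isTree? : {_~_ : Fin n → Fin n → Set} → Binary.Decidable _~_ → Dec (IsTree _~_)
isTree? ~? =
  Fin.all? (λ u → Fin.all? (λ v → anyUnique? (λ p →
      linked? ~? p ×-dec
      (Maybe.≡-dec Fin._≟_ (head p) (just u) ×-dec
       Maybe.≡-dec Fin._≟_ (last p) (just v)))))
  ×-dec ¬? (anyUnique? (λ c → linked? ~? (c ++ take 1 c) ×-dec (3 ℕ.≤? length c)))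

spanningTrees : (G : Adjacency n) → List (EdgeSet G)
spanningTrees G = filter (λ T → isTree? (adjacent? G T)) (subsets ∣E G ∣)

Colouring : ℕ → Adjacency n → Set
Colouring r G = Vec (Fin r) ∣E G ∣

colourings : ∀ r (G : Adjacency n) → List (Colouring r G)
colourings r G = vectors (allFin r) ∣E G ∣

module _ {r : ℕ} (G : Adjacency n) (f : Colouring r G) where

  colourClass : Fin r → EdgeSet G
  colourClass i = Vec.map (λ c → does (c Fin.≟ i)) f

  largestClass : EdgeSet G → ℕ
  largestClass T = ℕ-Extrema.max 0 (map (λ i → card (colourClass i ∩ T)) (allFin r))

  treeDiscrepancy : .{{NonZero r}} → EdgeSet G → ℚ
  treeDiscrepancy T =
    (+ r / 1) * ((+ largestClass T / 1) - ((+ n ℤ.- + 1) / r))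

-- nothing exactly when G has no spanning tree, i.e. is not connected: whether
-- the inner maximum is nothing does not depend on the colouring f.
discrepancy : ∀ r .{{_ : NonZero r}} → Adjacency n → Maybe ℚ
discrepancy r G =
  minimum (mapMaybe (λ f → maximum (map (treeDiscrepancy G f) (spanningTrees G)))
                    (colourings r G))

DiscrepancyBetween : ∀ r .{{_ : NonZero r}} → ℚ → ℚ → Adjacency n → Set
DiscrepancyBetween {n} r c₁ c₂ G =
  AnyMaybe (λ D → c₁ * (+ n / 1) ≤ D × D ≤ c₂ * (+ n / 1)) (discrepancy r G)

discrepancyBetween? : ∀ r .{{_ : NonZero r}} c₁ c₂ →
                      Decidable (DiscrepancyBetween {n} r c₁ c₂)
discrepancyBetween? {n} r c₁ c₂ G =
  MaybeAny.dec (λ D → (c₁ * (+ n / 1) ≤? D) ×-dec (D ≤? c₂ * (+ n / 1)))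
               (discrepancy r G)

-- Probability of P under the uniform distribution on a (duplicate-free) list;
-- the value on the empty list is a convention.
probability : {P : A → Set} → Decidable P → List A → ℚ
probability P? []          = 0ℚ
probability P? xs@(_ ∷ _) = + length (filter P? xs) / length xs

-- The probability of P under 𝒢_{n,d} tends to 1 along the n with d n even.
-- For d < n with d n even there are d-regular graphs, so the convention for
-- empty lists plays no role in the limit.
WithHighProbability : ℕ → {P : ∀ {n} → Adjacency n → Set} →
                      (∀ {n} → Decidable (P {n})) → Set
WithHighProbability d P? =
  ∀ (ε : ℚ) → 0ℚ < ε → ∃[ N ] ∀ n → N ℕ.≤ n → 2 divides (d ℕ.* n) →
    ∣ probability P? (regularGraphs n d) - 1ℚ ∣ < ε

{-# OPTIONS --safe #-}

-- Idea.  For each colour, Kruskal's algorithm run on the edges of that colour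
-- first gives a spanning tree with n − p edges of it, where p is the number of
-- classes of a partition inside whose classes all these edges lie.  So one
-- needs: if every edge of G lies inside a class of one of r partitions, then
-- some partition has few classes.  Let Z be the set of vertices whose class is
-- nontrivial in at least two partitions.  If Z is small, the remaining vertices
-- split according to their only nontrivial partition into sets with small edge
-- boundary, and expansion forces one of these to be almost everything.  If Z
-- is large, then, because sets of 2 ≤ |S| ≤ n − 4 vertices have more than
-- 2⌊d/2⌋ boundary edges, a nontrivial class consists of two vertices of Z or
-- contains three of them, and counting gives fewer than (r − 1)n classes in all.
--
-- Expansion of the random graph: replacing edges xy ⊆ S and uv ⊆ V ∖ S by xu
-- and yv raises the boundary of S by 2.  Comparing the numbers W k of d-regular
-- graphs in which S has k boundary edges along chains of such switchings and
-- summing with Vandermonde's identity bounds W k by roughly a 1 / C(dn/2, d|S|/2)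
-- fraction of all graphs, which for d ≥ 3 beats the C(n, |S|) choices of S.
module Submission where

open import Defs
open import Data.Nat.Base
open import Data.Nat.Properties
open import Data.Nat.Combinatorics using (_C_; nCk+nC[k+1]≡[n+1]C[k+1]; nCk≡nC[n∸k]; nCn≡1; k>n⇒nCk≡0)
open import Data.Nat.Tactic.RingSolver using (solve-∀)
open import Data.Nat.DivMod using (m/n*n≤m; m/n≤m; /-mono-≤; m*n/n≡m; m≡m%n+[m/n]*n; m%n<n; m<n*o⇒m/o<n)
open import Data.Nat.Divisibility using (∣m+n∣m⇒∣n) renaming (_∣_ to _divides_)
import Data.Nat.Divisibility as ∣
import Data.Integer.Base as ℤ
import Data.Integer.Properties as ℤ
import Data.Rational.Base as ℚ
open import Data.Rational.Base using (ℚ; 0ℚ; 1ℚ)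
import Data.Rational.Properties as ℚ
import Data.Rational.Unnormalised.Base as ℚᵘ
import Data.Rational.Unnormalised.Properties as ℚᵘ
open import Data.Rational.Unnormalised.Base using (mkℚᵘ; *≡*; *≤*; *<*)
import Data.Integer.Tactic.RingSolver as ℤ-Solver
open import Data.Bool.Base using (Bool; true; false; not; _∧_; _∨_; _xor_; if_then_else_)
import Data.Bool.Properties as Bool
open import Data.Fin.Base as Fin using (Fin; zero; suc; toℕ)
import Data.Fin.Properties as Fin
import Data.Fin.Subset.Properties as Subset
open import Data.Fin.Subset using (Subset; _∩_) renaming (∣_∣ to card)
open import Data.Vec.Base as Vec using (Vec; []; _∷_; lookup; tabulate)
import Data.Vec.Properties as Vec
open import Data.List.Base as List using (List; []; _∷_; _++_; length; filter)
open import Data.List.Membership.Propositional using () renaming (_∈_ to _∈ₗ_)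
open import Data.List.Membership.Propositional.Properties
  using (∈-filter⁺; ∈-filter⁻; ∈-lookup; ∈-cartesianProduct⁺; ∈-cartesianProductWith⁺; ∈-allFin; ∈-map⁺)
open import Data.List.Relation.Unary.All as All using (All; []; _∷_)
open import Data.List.Relation.Unary.Any as Any using (Any; here; there)
import Data.List.Relation.Unary.Any.Properties as Any
open import Data.List.Relation.Unary.AllPairs using ([]; _∷_)
open import Data.List.Relation.Unary.Unique.Propositional using (Unique)
import Data.List.Relation.Unary.Unique.Propositional.Properties as Unique
import Data.List.Extrema
import Data.List.Extrema.Nat as ℕ-Extrema
open import Data.Maybe.Relation.Unary.Any using (just) renaming (Any to AnyMaybe)
open import Relation.Binary.Bundles using (DecTotalOrder)
open import Data.Product.Base using (_×_; _,_; ∃; ∃-syntax; Σ-syntax; proj₁; proj₂)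
open import Relation.Unary using () renaming (Decidable to Decidable₁)
open import Data.Maybe.Base using (Maybe; just)
open import Data.Maybe.Properties using (just-injective)
open import Data.List.Relation.Unary.Linked as Linked using (Linked; []; [-]; _∷_)
import Data.List.Relation.Unary.All.Properties as All
open import Relation.Binary.Construct.Closure.ReflexiveTransitive as Star using (Star; _◅_; _◅◅_)
import Data.List.Membership.DecPropositional as DecMembership
open import Data.Sum.Base using (_⊎_; inj₁; inj₂; [_,_]′)
open import Data.Empty using (⊥; ⊥-elim)
open import Function.Bundles using (mk⇔)
open import Function.Base using (_∘_; id; case_of_; _$_)
open import Relation.Binary.Definitions using (tri<; tri≈; tri>)
open import Relation.Binary.PropositionalEquality hiding (J)
open import Relation.Nullary using (Dec; yes; no; ¬_; does; contradiction)
open import Relation.Nullary.Decidable using (dec-true; dec-false; does-⇔; _×-dec_)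
open import Algebra.Properties.Semiring.Sum +-*-semiring
  using (sum; sum-cong-≗; ∑-distrib-+; ∑-comm; *-distribˡ-sum; *-distribʳ-sum)

-- With (r - 1)n classes in all, every tree might have only n / r edges of each colour, so averaging
-- alone yields no discrepancy and the saving has to be linear in n. If |Z| ≥ n / q with q = 4(1 +
-- 384rd), every vertex of Z saves a sixth of a class; otherwise a single partition has at most
-- about n / 4 classes. This is the source of `gapConstant`, which is 6q.
--
-- Two strengths of expansion are needed: more than 2⌊d/2⌋ boundary edges even for bounded sets,
-- which the charging uses, and a linear boundary for large sets, which bounds the parts when Z is
-- small. `threshold` combines them. Probability enters only for |S| ≥ 4: for d = 3 the comparison
-- with C(n, |S|) wants one spare edge in S besides two boundary edges, that is, 2(s + 1) + 2 ≤ 3s.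
-- Sets of two or three vertices have few inner edges, so they are treated directly. A class with
-- fewer than four vertices outside it occurs only in a partition with at most four classes, which
-- is already coarse enough.
--
-- Switchings act on simple graphs themselves, so all estimates are exact inequalities between
-- natural numbers.

private
  variable
    m n : ℕ

-- Finite sums

infixr 6 _⊕_
infixr 7 _⊗_

_⊕_ : ∀ {a b c e} → a ≤ b → c ≤ e → a + c ≤ b + e
_⊕_ = +-mono-≤

_⊗_ : ∀ c {a b} → a ≤ b → c * a ≤ c * b
c ⊗ p = *-monoʳ-≤ c p

-- Linear arithmetic by certificate: X ≤ Y follows from P ≤ Q, a nonnegative
-- combination of hypotheses, once Y - X = (Q - P) + s is a ring identity.
linarith : ∀ {P Q} X Y s → P ≤ Q → X + Q + s ≡ Y + P → X ≤ Y
linarith {P} {Q} X Y s P≤Q eq = +-cancelʳ-≤ P X Y (begin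
  X + P     ≤⟨ +-monoʳ-≤ X P≤Q ⟩
  X + Q     ≤⟨ m≤m+n _ s ⟩
  X + Q + s ≡⟨ eq ⟩
  Y + P     ∎)
  where open ≤-Reasoning

⟦_⟧ : Bool → ℕ
⟦ true ⟧  = 1
⟦ false ⟧ = 0

does-true : ∀ {P : Set} (P? : Dec P) → does P? ≡ true → P
does-true (yes p) _ = p

⟦⟧≤1 : ∀ b → ⟦ b ⟧ ≤ 1
⟦⟧≤1 true  = ≤-refl
⟦⟧≤1 false = z≤n

⟦∧⟧ : ∀ a b → ⟦ a ∧ b ⟧ ≡ ⟦ a ⟧ * ⟦ b ⟧
⟦∧⟧ true  b = sym (+-identityʳ _)
⟦∧⟧ false b = refl

⟦⟧+⟦not⟧ : ∀ b → ⟦ b ⟧ + ⟦ not b ⟧ ≡ 1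
⟦⟧+⟦not⟧ true  = refl
⟦⟧+⟦not⟧ false = refl

⟦∨⟧ : ∀ b c → ¬ (b ≡ true × c ≡ true) → ⟦ b ∨ c ⟧ ≡ ⟦ b ⟧ + ⟦ c ⟧
⟦∨⟧ true  true  ¬both = contradiction (refl , refl) ¬both
⟦∨⟧ true  false _ = refl
⟦∨⟧ false c     _ = refl

∧-true : ∀ b c → b ∧ c ≡ true → b ≡ true × c ≡ true
∧-true true true _ = refl , refl

⟦⟧-mono : ∀ {a b} → (a ≡ true → b ≡ true) → ⟦ a ⟧ ≤ ⟦ b ⟧
⟦⟧-mono {true}  f rewrite f refl = ≤-refl
⟦⟧-mono {false} f = z≤n

⟦⟧-pos : ∀ {b} → 1 ≤ ⟦ b ⟧ → b ≡ true
⟦⟧-pos {true} _ = refl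

opaque
  ∑ : (Fin n → ℕ) → ℕ
  ∑ = sum

  ∑-empty : (f : Fin 0 → ℕ) → ∑ f ≡ 0
  ∑-empty f = refl

  ∑-suc : (f : Fin (suc n) → ℕ) → ∑ f ≡ f zero + ∑ (f ∘ suc)
  ∑-suc f = refl

  ∑-cong : {f g : Fin n → ℕ} → (∀ i → f i ≡ g i) → ∑ f ≡ ∑ g
  ∑-cong = sum-cong-≗

  ∑-mono : {f g : Fin n → ℕ} → (∀ i → f i ≤ g i) → ∑ f ≤ ∑ g
  ∑-mono {zero}  f≤g = z≤n
  ∑-mono {suc n} f≤g = f≤g zero ⊕ ∑-mono (f≤g ∘ suc)

  ∑-+ : (f g : Fin n → ℕ) → ∑ (λ i → f i + g i) ≡ ∑ f + ∑ g
  ∑-+ = ∑-distrib-+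

  ∑-swap : (f : Fin m → Fin n → ℕ) → ∑ (λ i → ∑ (f i)) ≡ ∑ (λ j → ∑ (λ i → f i j))
  ∑-swap = ∑-comm

  ∑-*ˡ : ∀ c (f : Fin n → ℕ) → ∑ (λ i → c * f i) ≡ c * ∑ f
  ∑-*ˡ c f = sym (*-distribˡ-sum c f)

  ∑-*ʳ : ∀ c (f : Fin n → ℕ) → ∑ (λ i → f i * c) ≡ ∑ f * c
  ∑-*ʳ c f = sym (*-distribʳ-sum c f)

∑-const : ∀ n c → ∑ {n} (λ _ → c) ≡ n * c
∑-const zero    c = ∑-empty _
∑-const (suc n) c = trans (∑-suc _) (cong (c +_) (∑-const n c))

∑-≤const : ∀ {c} {f : Fin n → ℕ} → (∀ i → f i ≤ c) → ∑ f ≤ n * c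
∑-≤const {n} {c} f≤c = ≤-trans (∑-mono f≤c) (≤-reflexive (∑-const n c))

∑-≥const : ∀ {c} {f : Fin n → ℕ} → (∀ i → c ≤ f i) → n * c ≤ ∑ f
∑-≥const {n} {c} c≤f = ≤-trans (≤-reflexive (sym (∑-const n c))) (∑-mono c≤f)

∑-zero : {f : Fin n → ℕ} → (∀ i → f i ≡ 0) → ∑ f ≡ 0
∑-zero {n} f≡0 = trans (∑-cong f≡0) (trans (∑-const n 0) (*-zeroʳ n))

≤∑ : ∀ (f : Fin n → ℕ) i → f i ≤ ∑ f
≤∑ f zero    = ≤-trans (m≤m+n _ _) (≤-reflexive (sym (∑-suc f)))
≤∑ f (suc i) = ≤-trans (≤∑ (f ∘ suc) i) (≤-trans (m≤n+m _ _) (≤-reflexive (sym (∑-suc f))))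

∑≡0 : ∀ {f : Fin n → ℕ} → ∑ f ≡ 0 → ∀ i → f i ≡ 0
∑≡0 {f = f} eq i = n≤0⇒n≡0 (subst (f i ≤_) eq (≤∑ f i))

∑-pos : ∀ (f : Fin n → ℕ) → 1 ≤ ∑ f → ∃[ i ] 1 ≤ f i
∑-pos {zero}  f p with () ← subst (1 ≤_) (∑-empty f) p
∑-pos {suc n} f p with f zero in eq
... | suc _ = zero , subst (1 ≤_) (sym eq) (s≤s z≤n)
... | zero  with i , q ← ∑-pos (f ∘ suc) (subst (1 ≤_) (trans (∑-suc f) (cong (_+ ∑ (f ∘ suc)) eq)) p) = suc i , q

opaque
  same : Fin n → Fin n → Bool
  same i j = does (i Fin.≟ j)

  same-refl : ∀ (i : Fin n) → same i i ≡ true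
  same-refl i = dec-true (i Fin.≟ i) refl

  same⇒≡ : ∀ {i j : Fin n} → same i j ≡ true → i ≡ j
  same⇒≡ {i = i} {j} p with i Fin.≟ j
  ... | yes i≡j = i≡j

  same-≢ : ∀ {i j : Fin n} → i ≢ j → same i j ≡ false
  same-≢ {i = i} {j} = dec-false (i Fin.≟ j)

  ∑-δ : ∀ (x : Fin n) (f : Fin n → ℕ) → ∑ (λ i → ⟦ same i x ⟧ * f i) ≡ f x
  ∑-δ {suc n} zero f = trans (∑-suc _)
    (trans (cong₂ _+_ (+-identityʳ (f zero)) (∑-zero {n} (λ _ → refl))) (+-identityʳ _))
  ∑-δ {suc n} (suc x) f = trans (∑-suc _) $
    trans (∑-cong (λ i → cong (λ b → ⟦ b ⟧ * f (suc i)) (same-suc i x))) (∑-δ x (f ∘ suc))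
    where
    same-suc : ∀ (i j : Fin n) → same (suc i) (suc j) ≡ same i j
    same-suc i j with i Fin.≟ j
    ... | yes _ = refl
    ... | no  _ = refl

∑-same : ∀ (x : Fin n) → ∑ (λ i → ⟦ same i x ⟧) ≡ 1
∑-same x = trans (∑-cong (λ i → sym (*-identityʳ _))) (∑-δ x (λ _ → 1))

∑-atMostOne : (b : Fin n → Bool) → (∀ i j → b i ≡ true → b j ≡ true → i ≡ j) → ∑ (λ i → ⟦ b i ⟧) ≤ 1
∑-atMostOne {zero}  b u = ≤-trans (≤-reflexive (∑-empty _)) z≤n
∑-atMostOne {suc n} b u = ≤-trans (≤-reflexive (∑-suc _)) (split (b zero) refl)
  where
  none : b zero ≡ true → ∀ i → ⟦ b (suc i) ⟧ ≡ 0
  none eq i with b (suc i) in eq′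
  ... | false = refl
  ... | true with () ← u zero (suc i) eq eq′
  split : ∀ c → b zero ≡ c → ⟦ c ⟧ + ∑ (λ i → ⟦ b (suc i) ⟧) ≤ 1
  split false _  = ∑-atMostOne (b ∘ suc) (λ i j p q → Fin.suc-injective (u _ _ p q))
  split true  eq = ≤-reflexive (cong suc (∑-zero (none eq)))

-- Writing each i as a sum of indicators over its image and exchanging the sums leaves, for each j,
-- a fibre with at most one element, and none when `q j` fails.
∑-injection : (p : Fin m → Bool) (q : Fin n → Bool) (f : Fin m → Fin n) →
  (∀ i → p i ≡ true → q (f i) ≡ true) →
  (∀ i j → p i ≡ true → p j ≡ true → f i ≡ f j → i ≡ j) →
  ∑ (λ i → ⟦ p i ⟧) ≤ ∑ (λ j → ⟦ q j ⟧)
∑-injection p q f pq inj = begin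
  ∑ (λ i → ⟦ p i ⟧)                                  ≡⟨ ∑-cong (λ i → sym (∑-δ (f i) (λ _ → ⟦ p i ⟧))) ⟩
  ∑ (λ i → ∑ (λ j → ⟦ same j (f i) ⟧ * ⟦ p i ⟧))      ≡⟨ ∑-swap _ ⟩
  ∑ (λ j → ∑ (λ i → ⟦ same j (f i) ⟧ * ⟦ p i ⟧))      ≤⟨ ∑-mono fibre ⟩
  ∑ (λ j → ⟦ q j ⟧)                                  ∎
  where
  open ≤-Reasoning
  hit : ∀ j i → same j (f i) ∧ p i ≡ true → j ≡ f i × p i ≡ true
  hit j i e with same j (f i) in e₁ | p i in e₂
  ... | true | true = same⇒≡ e₁ , refl
  fibre : ∀ j → ∑ (λ i → ⟦ same j (f i) ⟧ * ⟦ p i ⟧) ≤ ⟦ q j ⟧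
  fibre j with q j in eq
  ... | true  = ≤-trans (≤-reflexive (∑-cong (λ i → sym (⟦∧⟧ (same j (f i)) (p i)))))
      (∑-atMostOne _ λ i i′ e e′ → let (j≡ , pi) = hit j i e ; (j≡′ , pi′) = hit j i′ e′ in
        inj i i′ pi pi′ (trans (sym j≡) j≡′))
  ... | false = ≤-reflexive (∑-zero λ i → trans (sym (⟦∧⟧ (same j (f i)) (p i))) (none i))
    where
    none : ∀ i → ⟦ same j (f i) ∧ p i ⟧ ≡ 0
    none i with same j (f i) ∧ p i in e
    ... | false = refl
    ... | true with j≡ , pi ← hit j i e with () ← trans (sym eq) (trans (cong q j≡) (pq i pi))

∑ₛ : (Subset n → ℕ) → ℕ
∑ₛ {zero}  F = F []
∑ₛ {suc n} F = ∑ₛ (λ S → F (true ∷ S)) + ∑ₛ (λ S → F (false ∷ S))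

∑ₛ-mono : {F G : Subset n → ℕ} → (∀ S → F S ≤ G S) → ∑ₛ F ≤ ∑ₛ G
∑ₛ-mono {zero}  F≤G = F≤G []
∑ₛ-mono {suc n} F≤G = ∑ₛ-mono (F≤G ∘ (true ∷_)) ⊕ ∑ₛ-mono (F≤G ∘ (false ∷_))

∑ₛ-cong : {F G : Subset n → ℕ} → (∀ S → F S ≡ G S) → ∑ₛ F ≡ ∑ₛ G
∑ₛ-cong {zero}  F≡G = F≡G []
∑ₛ-cong {suc n} F≡G = cong₂ _+_ (∑ₛ-cong (F≡G ∘ (true ∷_))) (∑ₛ-cong (F≡G ∘ (false ∷_)))

≤∑ₛ : (F : Subset n → ℕ) → ∀ S → F S ≤ ∑ₛ F
≤∑ₛ F []          = ≤-refl
≤∑ₛ F (true ∷ S)  = ≤-trans (≤∑ₛ (F ∘ (true ∷_)) S) (m≤m+n _ _)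
≤∑ₛ F (false ∷ S) = ≤-trans (≤∑ₛ (F ∘ (false ∷_)) S) (m≤n+m _ _)

∑ₛ-*ʳ : ∀ c (F : Subset n → ℕ) → ∑ₛ (λ S → F S * c) ≡ ∑ₛ F * c
∑ₛ-*ʳ {zero}  c F = refl
∑ₛ-*ʳ {suc n} c F = trans (cong₂ _+_ (∑ₛ-*ʳ c (F ∘ (true ∷_))) (∑ₛ-*ʳ c (F ∘ (false ∷_))))
  (sym (*-distribʳ-+ c (∑ₛ (F ∘ (true ∷_))) (∑ₛ (F ∘ (false ∷_)))))

∑-∑ₛ-swap : (F : Fin m → Subset n → ℕ) → ∑ (λ i → ∑ₛ (F i)) ≡ ∑ₛ (λ S → ∑ (λ i → F i S))
∑-∑ₛ-swap {n = zero}  F = refl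
∑-∑ₛ-swap {n = suc n} F = trans (∑-+ _ _)
  (cong₂ _+_ (∑-∑ₛ-swap (λ i → F i ∘ (true ∷_))) (∑-∑ₛ-swap (λ i → F i ∘ (false ∷_))))

card-∑ : (S : Subset n) → card S ≡ ∑ (λ i → ⟦ lookup S i ⟧)
card-∑ []          = sym (∑-empty _)
card-∑ (true ∷ S)  = trans (cong suc (card-∑ S)) (sym (∑-suc _))
card-∑ (false ∷ S) = trans (card-∑ S) (sym (∑-suc _))

-- Regular graphs and switchings

Rel : ℕ → Set
Rel n = Fin n → Fin n → Bool

record Regular (d : ℕ) (a : Rel n) : Set where
  field
    symm   : ∀ u v → a u v ≡ a v u
    irrefl : ∀ u → a u u ≡ false
    degree : ∀ u → ∑ (λ v → ⟦ a u v ⟧) ≡ d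

size : (Fin n → Bool) → ℕ
size S = ∑ (λ u → ⟦ S u ⟧)

cross : (Fin n → Bool) → Fin n → Fin n → ℕ
cross S u v = ⟦ S u ⟧ * ⟦ not (S v) ⟧

boundary : Rel n → (Fin n → Bool) → ℕ
boundary a S = ∑ (λ u → ∑ (λ v → cross S u v * ⟦ a u v ⟧))

size+size-not : (S : Fin n → Bool) → size S + size (not ∘ S) ≡ n
size+size-not {n} S = trans (sym (∑-+ _ _)) (trans (∑-cong (λ u → ⟦⟧+⟦not⟧ (S u)))
  (trans (∑-const n 1) (*-identityʳ n)))

boundary-not : ∀ {d} {a : Rel n} → Regular d a → ∀ S → boundary a (not ∘ S) ≡ boundary a S
boundary-not {a = a} reg S = trans (∑-swap _) (∑-cong λ v → ∑-cong λ u →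
  cong₂ _*_ (trans (*-comm ⟦ not (S u) ⟧ _) (cong (λ b → ⟦ b ⟧ * ⟦ not (S u) ⟧) (Bool.not-involutive (S v))))
            (cong ⟦_⟧ (Regular.symm reg u v)))

module _ {n : ℕ} where

  edge : Fin n → Fin n → Rel n
  edge x y p q = (same p x ∧ same q y) ∨ (same p y ∧ same q x)

  edge-cases : ∀ x y p q → edge x y p q ≡ true → (p ≡ x × q ≡ y) ⊎ (p ≡ y × q ≡ x)
  edge-cases x y p q e with same p x in px | same q y in qy | same p y in py | same q x in qx
  ... | true  | true  | _    | _    = inj₁ (same⇒≡ px , same⇒≡ qy)
  ... | true  | false | true | true = inj₂ (same⇒≡ py , same⇒≡ qx)
  ... | false | _     | true | true = inj₂ (same⇒≡ py , same⇒≡ qx)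

  edge-sym : ∀ x y p q → edge x y p q ≡ edge x y q p
  edge-sym x y p q = trans (Bool.∨-comm (same p x ∧ same q y) _)
    (cong₂ _∨_ (Bool.∧-comm (same p y) _) (Bool.∧-comm (same p x) _))

  ⟦edge⟧ : ∀ {x y} → x ≢ y → ∀ p q →
    ⟦ edge x y p q ⟧ ≡ ⟦ same p x ⟧ * ⟦ same q y ⟧ + ⟦ same p y ⟧ * ⟦ same q x ⟧
  ⟦edge⟧ {x} {y} x≢y p q = trans
    (⟦∨⟧ (same p x ∧ same q y) _ λ (e , e′) →
      x≢y (trans (sym (same⇒≡ (proj₁ (∧-true _ _ e)))) (same⇒≡ (proj₁ (∧-true _ _ e′)))))
    (cong₂ _+_ (⟦∧⟧ (same p x) _) (⟦∧⟧ (same p y) _))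

  ∑∑-edge : ∀ {x y} → x ≢ y → (c : Fin n → Fin n → ℕ) →
    ∑ (λ p → ∑ (λ q → ⟦ edge x y p q ⟧ * c p q)) ≡ c x y + c y x
  ∑∑-edge {x} {y} x≢y c = trans (∑-cong λ p → trans (∑-cong λ q → cong (_* c p q) (⟦edge⟧ x≢y p q))
    (trans (∑-cong λ q → regroup ⟦ same p x ⟧ _ ⟦ same p y ⟧ _ (c p q))
      (trans (∑-+ _ _) (cong₂ _+_ (row x y p) (row y x p)))))
    (trans (∑-+ _ _) (cong₂ _+_ (∑-δ x (λ p → c p y)) (∑-δ y (λ p → c p x))))
    where
    regroup : ∀ a b e f g → (a * b + e * f) * g ≡ b * (a * g) + f * (e * g)
    regroup = solve-∀
    row : ∀ s t p → ∑ (λ q → ⟦ same q t ⟧ * (⟦ same p s ⟧ * c p q)) ≡ ⟦ same p s ⟧ * c p t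
    row s t p = ∑-δ t (λ q → ⟦ same p s ⟧ * c p q)

  ∑-edge : ∀ {x y} → x ≢ y → ∀ p → ∑ (λ q → ⟦ edge x y p q ⟧) ≡ ⟦ same p x ⟧ + ⟦ same p y ⟧
  ∑-edge {x} {y} x≢y p = trans (∑-cong (⟦edge⟧ x≢y p)) (trans (∑-+ _ _)
    (cong₂ _+_ (row x y) (row y x)))
    where
    row : ∀ s t → ∑ (λ q → ⟦ same p s ⟧ * ⟦ same q t ⟧) ≡ ⟦ same p s ⟧
    row s t = trans (∑-*ˡ ⟦ same p s ⟧ _) (trans (cong (⟦ same p s ⟧ *_) (∑-same t)) (*-identityʳ _))

  edges₂ : (x y u v : Fin n) → Rel n
  edges₂ x y u v p q = edge x y p q ∨ edge u v p q

  switch : (x y u v : Fin n) → Rel n → Rel n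
  switch x y u v a p q = (a p q ∧ not (edges₂ x y u v p q)) ∨ edges₂ x u y v p q

  record Switchable (S : Fin n → Bool) (a : Rel n) (x y u v : Fin n) : Set where
    constructor switchable
    field
      x∈ : S x ≡ true
      y∈ : S y ≡ true
      u∉ : S u ≡ false
      v∉ : S v ≡ false
      xy : a x y ≡ true
      uv : a u v ≡ true
      xu : a x u ≡ false
      yv : a y v ≡ false

  separated : ∀ (S : Fin n → Bool) {x u} → S x ≡ true → S u ≡ false → x ≢ u
  separated S x∈ u∉ refl with () ← trans (sym x∈) u∉

  adjacent⇒≢ : ∀ {d} {a : Rel n} → Regular d a → ∀ {x y} → a x y ≡ true → x ≢ y
  adjacent⇒≢ reg axy refl with () ← trans (sym axy) (Regular.irrefl reg _)

  module Switching {d : ℕ} {S : Fin n → Bool} {a : Rel n} (reg : Regular d a)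
           {x y u v : Fin n} (sw : Switchable S a x y u v) where
    open Regular reg
    open Switchable sw

    old⇒ : ∀ p q → edges₂ x y u v p q ≡ true → a p q ≡ true
    old⇒ p q e with edge x y p q in e₁
    ... | true with edge-cases x y p q e₁
    ...   | inj₁ (refl , refl) = xy
    ...   | inj₂ (refl , refl) = trans (symm p q) xy
    old⇒ p q e | false with edge-cases u v p q e
    ...   | inj₁ (refl , refl) = uv
    ...   | inj₂ (refl , refl) = trans (symm p q) uv

    new⇒ : ∀ p q → edges₂ x u y v p q ≡ true → a p q ≡ false
    new⇒ p q e with edge x u p q in e₁
    ... | true with edge-cases x u p q e₁
    ...   | inj₁ (refl , refl) = xu
    ...   | inj₂ (refl , refl) = trans (symm p q) xu
    new⇒ p q e | false with edge-cases y v p q e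
    ...   | inj₁ (refl , refl) = yv
    ...   | inj₂ (refl , refl) = trans (symm p q) yv

    x≢y : x ≢ y
    x≢y = adjacent⇒≢ reg xy

    u≢v : u ≢ v
    u≢v = adjacent⇒≢ reg uv

    x≢u : x ≢ u
    x≢u = separated S x∈ u∉

    y≢v : y ≢ v
    y≢v = separated S y∈ v∉

    ⟦old⟧ : ∀ p q → ⟦ edges₂ x y u v p q ⟧ ≡ ⟦ edge x y p q ⟧ + ⟦ edge u v p q ⟧
    ⟦old⟧ p q = ⟦∨⟧ _ _ λ (e , e′) → disjoint (edge-cases x y p q e) (edge-cases u v p q e′)
      where
      disjoint : (p ≡ x × q ≡ y) ⊎ (p ≡ y × q ≡ x) → (p ≡ u × q ≡ v) ⊎ (p ≡ v × q ≡ u) → ⊥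
      disjoint (inj₁ (refl , _)) (inj₁ (refl , _)) = x≢u refl
      disjoint (inj₁ (refl , _)) (inj₂ (refl , _)) = separated S x∈ v∉ refl
      disjoint (inj₂ (refl , _)) (inj₁ (refl , _)) = separated S y∈ u∉ refl
      disjoint (inj₂ (refl , _)) (inj₂ (refl , _)) = y≢v refl

    ⟦new⟧ : ∀ p q → ⟦ edges₂ x u y v p q ⟧ ≡ ⟦ edge x u p q ⟧ + ⟦ edge y v p q ⟧
    ⟦new⟧ p q = ⟦∨⟧ _ _ λ (e , e′) → disjoint (edge-cases x u p q e) (edge-cases y v p q e′)
      where
      disjoint : (p ≡ x × q ≡ u) ⊎ (p ≡ u × q ≡ x) → (p ≡ y × q ≡ v) ⊎ (p ≡ v × q ≡ y) → ⊥
      disjoint (inj₁ (refl , _)) (inj₁ (refl , _)) = x≢y refl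
      disjoint (inj₁ (refl , _)) (inj₂ (refl , _)) = separated S x∈ v∉ refl
      disjoint (inj₂ (refl , _)) (inj₁ (refl , _)) = separated S y∈ u∉ refl
      disjoint (inj₂ (refl , _)) (inj₂ (refl , _)) = u≢v refl

    -- The removed edges are present and the added ones absent, so the Boolean update becomes a
    -- linear identity of 0-1 matrices. Degrees and boundary of the new graph follow by summing it
    -- against suitable weights.
    balance : ∀ p q → ⟦ switch x y u v a p q ⟧ + ⟦ edges₂ x y u v p q ⟧ ≡ ⟦ a p q ⟧ + ⟦ edges₂ x u y v p q ⟧
    balance p q = table (a p q) _ _ (old⇒ p q) (new⇒ p q)
      where
      table : ∀ b o e → (o ≡ true → b ≡ true) → (e ≡ true → b ≡ false) →
              ⟦ (b ∧ not o) ∨ e ⟧ + ⟦ o ⟧ ≡ ⟦ b ⟧ + ⟦ e ⟧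
      table true  true  false _ _ = refl
      table true  false false _ _ = refl
      table false false false _ _ = refl
      table false false true  _ _ = refl
      table true  _     true  _ g with () ← g refl
      table false true  _     f _ with () ← f refl

    balance′ : ∀ p q → ⟦ switch x y u v a p q ⟧ + (⟦ edge x y p q ⟧ + ⟦ edge u v p q ⟧)
                     ≡ ⟦ a p q ⟧ + (⟦ edge x u p q ⟧ + ⟦ edge y v p q ⟧)
    balance′ p q = trans (cong (⟦ switch x y u v a p q ⟧ +_) (sym (⟦old⟧ p q)))
      (trans (balance p q) (cong (⟦ a p q ⟧ +_) (⟦new⟧ p q)))

    switch-symm : ∀ p q → switch x y u v a p q ≡ switch x y u v a q p
    switch-symm p q = cong₂ _∨_
      (cong₂ (λ b c → b ∧ not c) (symm p q) (cong₂ _∨_ (edge-sym x y p q) (edge-sym u v p q)))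
      (cong₂ _∨_ (edge-sym x u p q) (edge-sym y v p q))

    switch-irrefl : ∀ p → switch x y u v a p p ≡ false
    switch-irrefl p with edges₂ x u y v p p in e
    ... | false = trans (Bool.∨-identityʳ _) (cong (_∧ _) (irrefl p))
    ... | true  with edge x u p p in e₁
    ...   | true  with edge-cases x u p p e₁
    ...     | inj₁ (refl , x≡u) = contradiction x≡u x≢u
    ...     | inj₂ (refl , u≡x) = contradiction (sym u≡x) x≢u
    switch-irrefl p | true | false with edge-cases y v p p e
    ...     | inj₁ (refl , y≡v) = contradiction y≡v y≢v
    ...     | inj₂ (refl , v≡y) = contradiction (sym v≡y) y≢v

    switch-degree : ∀ p → ∑ (λ q → ⟦ switch x y u v a p q ⟧) ≡ d
    switch-degree p = trans (+-cancelʳ-≡ _ _ _ (begin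
      ∑ (λ q → ⟦ switch x y u v a p q ⟧) + ((sx + sy) + (su + sv))
        ≡⟨ cong (∑ (λ q → ⟦ switch x y u v a p q ⟧) +_) (cong₂ _+_ (∑-edge x≢y p) (∑-edge u≢v p)) ⟨
      ∑ (λ q → ⟦ switch x y u v a p q ⟧) + (∑ (λ q → ⟦ edge x y p q ⟧) + ∑ (λ q → ⟦ edge u v p q ⟧))
        ≡⟨ split _ _ _ ⟨
      ∑ (λ q → ⟦ switch x y u v a p q ⟧ + (⟦ edge x y p q ⟧ + ⟦ edge u v p q ⟧))
        ≡⟨ ∑-cong (balance′ p) ⟩
      ∑ (λ q → ⟦ a p q ⟧ + (⟦ edge x u p q ⟧ + ⟦ edge y v p q ⟧))
        ≡⟨ split _ _ _ ⟩
      ∑ (λ q → ⟦ a p q ⟧) + (∑ (λ q → ⟦ edge x u p q ⟧) + ∑ (λ q → ⟦ edge y v p q ⟧))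
        ≡⟨ cong (∑ (λ q → ⟦ a p q ⟧) +_) (cong₂ _+_ (∑-edge x≢u p) (∑-edge y≢v p)) ⟩
      ∑ (λ q → ⟦ a p q ⟧) + ((sx + su) + (sy + sv))
        ≡⟨ cong (∑ (λ q → ⟦ a p q ⟧) +_) (interchange sx su sy sv) ⟩
      ∑ (λ q → ⟦ a p q ⟧) + ((sx + sy) + (su + sv)) ∎)) (degree p)
      where
      open ≡-Reasoning
      sx = ⟦ same p x ⟧
      sy = ⟦ same p y ⟧
      su = ⟦ same p u ⟧
      sv = ⟦ same p v ⟧
      interchange : ∀ a b c e → (a + b) + (c + e) ≡ (a + c) + (b + e)
      interchange = solve-∀
      split : ∀ (f g h : Fin n → ℕ) → ∑ (λ q → f q + (g q + h q)) ≡ ∑ f + (∑ g + ∑ h)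
      split f g h = trans (∑-+ f _) (cong (∑ f +_) (∑-+ g h))

    switch-regular : Regular d (switch x y u v a)
    switch-regular = record
      { symm = switch-symm ; irrefl = switch-irrefl ; degree = switch-degree }

    switch-boundary : boundary (switch x y u v a) S ≡ 2 + boundary a S
    switch-boundary = begin
      boundary (switch x y u v a) S
        ≡⟨ +-identityʳ _ ⟨
      boundary (switch x y u v a) S + 0
        ≡⟨ cong (boundary (switch x y u v a) S +_) (trans (cong₂ _+_ (crossing x≢y) (crossing u≢v)) none) ⟨
      boundary (switch x y u v a) S + (weight x y + weight u v)
        ≡⟨ split (switch x y u v a) (edge x y) (edge u v) ⟨
      ∑ (λ p → ∑ (λ q → cross S p q * (⟦ switch x y u v a p q ⟧ + (⟦ edge x y p q ⟧ + ⟦ edge u v p q ⟧))))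
        ≡⟨ ∑-cong (λ p → ∑-cong λ q → cong (cross S p q *_) (balance′ p q)) ⟩
      ∑ (λ p → ∑ (λ q → cross S p q * (⟦ a p q ⟧ + (⟦ edge x u p q ⟧ + ⟦ edge y v p q ⟧))))
        ≡⟨ split a (edge x u) (edge y v) ⟩
      boundary a S + (weight x u + weight y v)
        ≡⟨ cong (boundary a S +_) (cong₂ _+_ (crossing x≢u) (crossing y≢v)) ⟩
      boundary a S + ((cross S x u + cross S u x) + (cross S y v + cross S v y))
        ≡⟨ cong (boundary a S +_) two ⟩
      boundary a S + 2
        ≡⟨ +-comm _ 2 ⟩
      2 + boundary a S ∎
      where
      open ≡-Reasoning
      weight : Fin n → Fin n → ℕ
      weight s t = ∑ (λ p → ∑ (λ q → cross S p q * ⟦ edge s t p q ⟧))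
      crossing : ∀ {s t} → s ≢ t → weight s t ≡ cross S s t + cross S t s
      crossing s≢t = trans (∑-cong λ p → ∑-cong λ q → *-comm (cross S p q) _) (∑∑-edge s≢t (cross S))
      split : ∀ (f g h : Rel n) →
        ∑ (λ p → ∑ (λ q → cross S p q * (⟦ f p q ⟧ + (⟦ g p q ⟧ + ⟦ h p q ⟧))))
        ≡ ∑ (λ p → ∑ (λ q → cross S p q * ⟦ f p q ⟧))
          + (∑ (λ p → ∑ (λ q → cross S p q * ⟦ g p q ⟧)) + ∑ (λ p → ∑ (λ q → cross S p q * ⟦ h p q ⟧)))
      split f g h = trans (∑-cong λ p → trans (∑-cong λ q → distrib (cross S p q) _ _ _)
          (trans (∑-+ _ _) (cong (∑ (λ q → cross S p q * ⟦ f p q ⟧) +_) (∑-+ _ _))))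
        (trans (∑-+ _ _) (cong (∑ (λ p → ∑ (λ q → cross S p q * ⟦ f p q ⟧)) +_) (∑-+ _ _)))
        where
        distrib : ∀ c f g h → c * (f + (g + h)) ≡ c * f + (c * g + c * h)
        distrib = solve-∀
      none : (cross S x y + cross S y x) + (cross S u v + cross S v u) ≡ 0
      none rewrite x∈ | y∈ | u∉ | v∉ = refl
      two : (cross S x u + cross S u x) + (cross S y v + cross S v y) ≡ 2
      two rewrite x∈ | y∈ | u∉ | v∉ = refl

  -- On the four altered edges switchability prescribes the same values for both graphs; elsewhere
  -- each graph agrees with its image.
  switch-injective : ∀ {d} {S : Fin n → Bool} {a b : Rel n} → Regular d a → Regular d b →
    ∀ {x y u v} → Switchable S a x y u v → Switchable S b x y u v →
    (∀ p q → switch x y u v a p q ≡ switch x y u v b p q) → ∀ p q → a p q ≡ b p q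
  switch-injective {a = a} {b} ra rb {x} {y} {u} {v} sa sb eq p q =
    table _ _ _ _ (Sa.old⇒ p q) (Sa.new⇒ p q) (Sb.old⇒ p q) (Sb.new⇒ p q) (eq p q)
    where
    module Sa = Switching ra sa
    module Sb = Switching rb sb
    table : ∀ b c o e → (o ≡ true → b ≡ true) → (e ≡ true → b ≡ false) →
            (o ≡ true → c ≡ true) → (e ≡ true → c ≡ false) →
            (b ∧ not o) ∨ e ≡ (c ∧ not o) ∨ e → b ≡ c
    table b c true  e     f _ f′ _ _ = trans (f refl) (sym (f′ refl))
    table b c false true  _ g _ g′ _ = trans (g refl) (sym (g′ refl))
    table true  true  false false _ _ _ _ _ = refl
    table false false false false _ _ _ _ _ = refl

-- Double counting of switchings

∑⁴ : (Fin n → Fin n → Fin n → Fin n → ℕ) → ℕ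
∑⁴ f = ∑ λ x → ∑ λ y → ∑ λ u → ∑ λ v → f x y u v

∑⁴-mono : {f g : Fin n → Fin n → Fin n → Fin n → ℕ} →
  (∀ x y u v → f x y u v ≤ g x y u v) → ∑⁴ f ≤ ∑⁴ g
∑⁴-mono f≤g = ∑-mono λ x → ∑-mono λ y → ∑-mono λ u → ∑-mono λ v → f≤g x y u v

∑⁴-cong : {f g : Fin n → Fin n → Fin n → Fin n → ℕ} →
  (∀ x y u v → f x y u v ≡ g x y u v) → ∑⁴ f ≡ ∑⁴ g
∑⁴-cong f≡g = ∑-cong λ x → ∑-cong λ y → ∑-cong λ u → ∑-cong λ v → f≡g x y u v

∑⁴-+ : (f g : Fin n → Fin n → Fin n → Fin n → ℕ) →
  ∑⁴ (λ x y u v → f x y u v + g x y u v) ≡ ∑⁴ f + ∑⁴ g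
∑⁴-+ f g = trans (∑-cong λ x → trans (∑-cong λ y → trans (∑-cong λ u → ∑-+ _ _) (∑-+ _ _)) (∑-+ _ _)) (∑-+ _ _)

∑-∑⁴ : (f : Fin m → Fin n → Fin n → Fin n → Fin n → ℕ) →
  ∑ (λ i → ∑⁴ (f i)) ≡ ∑⁴ (λ x y u v → ∑ (λ i → f i x y u v))
∑-∑⁴ f = trans (∑-swap _) (∑-cong λ x → trans (∑-swap _) (∑-cong λ y → trans (∑-swap _) (∑-cong λ u → ∑-swap _)))

∑⁴-*ˡ : ∀ c (f : Fin n → Fin n → Fin n → Fin n → ℕ) → ∑⁴ (λ x y u v → c * f x y u v) ≡ c * ∑⁴ f
∑⁴-*ˡ c f = trans (∑-cong λ x → trans (∑-cong λ y → trans (∑-cong λ u → ∑-*ˡ c _) (∑-*ˡ c _)) (∑-*ˡ c _)) (∑-*ˡ c _)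

∑⁴-product : ∀ (f g : Fin n → Fin n → ℕ) → ∑⁴ (λ x y u v → f x y * g u v)
  ≡ ∑ (λ x → ∑ (f x)) * ∑ (λ u → ∑ (g u))
∑⁴-product f g = trans (∑-cong λ x → trans (∑-cong λ y → trans (∑-cong λ u → ∑-*ˡ (f x y) (g u)) (∑-*ˡ (f x y) _))
  (∑-*ʳ _ (f x))) (∑-*ʳ _ _)

inner : Rel n → (Fin n → Bool) → Fin n → Fin n → ℕ
inner a S x y = ⟦ S x ⟧ * (⟦ S y ⟧ * ⟦ a x y ⟧)

-- Twice the number of edges inside S, since both orientations count, whereas `boundary` counts
-- every edge of the cut once.
volume : Rel n → (Fin n → Bool) → ℕ
volume a S = ∑ λ x → ∑ λ y → inner a S x y

volume+boundary : ∀ {d} {a : Rel n} → Regular d a → ∀ S → volume a S + boundary a S ≡ d * size S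
volume+boundary {d = d} {a} reg S = trans (sym (∑-+ _ _)) (trans (∑-cong row) (∑-*ˡ d _))
  where
  open Regular reg
  cell : ∀ s t b → ⟦ s ⟧ * (⟦ t ⟧ * ⟦ b ⟧) + ⟦ s ⟧ * ⟦ not t ⟧ * ⟦ b ⟧ ≡ ⟦ s ⟧ * ⟦ b ⟧
  cell false t     b = refl
  cell true  true  b = trans (+-identityʳ (1 * (1 * ⟦ b ⟧))) (cong (1 *_) (*-identityˡ ⟦ b ⟧))
  cell true  false b = refl
  row : ∀ x → ∑ (inner a S x) + ∑ (λ y → cross S x y * ⟦ a x y ⟧) ≡ d * ⟦ S x ⟧
  row x = trans (sym (∑-+ _ _)) (trans (∑-cong λ y → cell (S x) (S y) (a x y))
    (trans (∑-*ˡ ⟦ S x ⟧ _) (trans (cong (⟦ S x ⟧ *_) (degree x)) (*-comm ⟦ S x ⟧ d))))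

-- `forward` is the Boolean form of `Switchable`. `reverse` retains of the image only the two
-- crossing edges, an overcount that makes its number exactly the square of the boundary.
forward reverse : Rel n → (Fin n → Bool) → (x y u v : Fin n) → Bool
forward a S x y u v = S x ∧ (S y ∧ (not (S u) ∧ (not (S v) ∧ (a x y ∧ (a u v ∧ (not (a x u) ∧ not (a y v)))))))
reverse a S x y u v = S x ∧ (not (S u) ∧ (a x u ∧ (S y ∧ (not (S v) ∧ a y v))))

forward⇒switchable : ∀ {a : Rel n} {S x y u v} → forward a S x y u v ≡ true → Switchable S a x y u v
forward⇒switchable {a = a} {S} {x} {y} {u} {v} e
  with S x in x∈ | S y in y∈ | S u in u∉ | S v in v∉ | a x y in xy | a u v in uv | a x u in xu | a y v in yv
... | true | true | false | false | true | true | false | false = switchable x∈ y∈ u∉ v∉ xy uv xu yv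

reverse-intro : ∀ (a : Rel n) S {x y u v} → S x ≡ true → S y ≡ true → S u ≡ false → S v ≡ false →
  a x u ≡ true → a y v ≡ true → reverse a S x y u v ≡ true
reverse-intro a S x∈ y∈ u∉ v∉ xu yv rewrite x∈ | y∈ | u∉ | v∉ | xu | yv = refl

-- A pair of edges xy, uv blocked by an existing edge xu (or yv) is determined
-- by xy and a path of length two starting at x (or y).
forward-count : ∀ {d} {a : Rel n} → Regular d a → ∀ S →
  volume a S * volume a (not ∘ S) ≤ ∑⁴ (λ x y u v → ⟦ forward a S x y u v ⟧) + 2 * (volume a S * (d * d))
forward-count {n} {d} {a} reg S = begin
  volume a S * volume a (not ∘ S)
    ≡⟨ ∑⁴-product (inner a S) (inner a (not ∘ S)) ⟨
  ∑⁴ (λ x y u v → inner a S x y * inner a (not ∘ S) u v)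
    ≤⟨ ∑⁴-mono (λ x y u v → ≤-trans (table (S x) (S y) (S u) (S v) (a x y) (a u v) (a x u) (a y v))
         (≤-reflexive (cong (λ b → ⟦ forward a S x y u v ⟧ + (blocked x y x u v + inner a S x y * (⟦ a y v ⟧ * ⟦ b ⟧))) (symm u v)))) ⟩
  ∑⁴ (λ x y u v → ⟦ forward a S x y u v ⟧ + (blocked x y x u v + blocked x y y v u))
    ≡⟨ trans (∑⁴-+ (λ x y u v → ⟦ forward a S x y u v ⟧) _) (cong (F +_) (∑⁴-+ (λ x y u v → blocked x y x u v) _)) ⟩
  F + (∑⁴ (λ x y u v → blocked x y x u v) + ∑⁴ (λ x y u v → blocked x y y v u))
    ≡⟨ cong (F +_) (cong₂ _+_ (total λ x y → x) (trans (∑-cong λ x → ∑-cong λ y → ∑-swap _) (total λ x y → y))) ⟩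
  F + (volume a S * (d * d) + volume a S * (d * d))
    ≡⟨ cong (F +_) (cong (volume a S * (d * d) +_) (+-identityʳ _)) ⟨
  F + 2 * (volume a S * (d * d)) ∎
  where
  open ≤-Reasoning
  open Regular reg
  F = ∑⁴ (λ x y u v → ⟦ forward a S x y u v ⟧)
  blocked : (x y w u v : Fin n) → ℕ
  blocked x y w u v = inner a S x y * (⟦ a w u ⟧ * ⟦ a u v ⟧)
  total : (w : Fin n → Fin n → Fin n) →
    ∑⁴ (λ x y u v → blocked x y (w x y) u v) ≡ volume a S * (d * d)
  total w = trans (∑-cong λ x → trans (∑-cong λ y → paths x y) (∑-*ʳ (d * d) _)) (∑-*ʳ (d * d) _)
    where
    paths : ∀ x y → ∑ (λ u → ∑ (λ v → blocked x y (w x y) u v)) ≡ inner a S x y * (d * d)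
    paths x y = trans (∑-cong λ u → trans (∑-*ˡ (inner a S x y) _)
        (cong (inner a S x y *_) (trans (∑-*ˡ ⟦ a (w x y) u ⟧ _) (cong (⟦ a (w x y) u ⟧ *_) (degree u)))))
      (trans (∑-*ˡ (inner a S x y) _) (cong (inner a S x y *_) (trans (∑-*ʳ d _) (cong (_* d) (degree (w x y))))))
  table : ∀ sx sy su sv xy uv xu yv →
    ⟦ sx ⟧ * (⟦ sy ⟧ * ⟦ xy ⟧) * (⟦ not su ⟧ * (⟦ not sv ⟧ * ⟦ uv ⟧)) ≤
    ⟦ sx ∧ (sy ∧ (not su ∧ (not sv ∧ (xy ∧ (uv ∧ (not xu ∧ not yv)))))) ⟧ +
    (⟦ sx ⟧ * (⟦ sy ⟧ * ⟦ xy ⟧) * (⟦ xu ⟧ * ⟦ uv ⟧) + ⟦ sx ⟧ * (⟦ sy ⟧ * ⟦ xy ⟧) * (⟦ yv ⟧ * ⟦ uv ⟧))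
  table false _ _ _ _ _ _ _ = z≤n
  table true false _ _ _ _ _ _ = z≤n
  table true true _ _ false _ _ _ = z≤n
  table true true true _ true _ _ _ = z≤n
  table true true false true true _ _ _ = z≤n
  table true true false false true false _ _ = z≤n
  table true true false false true true false false = ≤-refl
  table true true false false true true true  _     = s≤s z≤n
  table true true false false true true false true  = ≤-refl

reverse-count : ∀ (a : Rel n) S → ∑⁴ (λ x y u v → ⟦ reverse a S x y u v ⟧) ≡ boundary a S * boundary a S
reverse-count a S = trans (∑-cong λ x → ∑-swap _) (trans (∑⁴-cong λ x u y v → table (S x) (S u) (a x u) (S y) (S v) (a y v))
  (∑⁴-product (λ x u → cross S x u * ⟦ a x u ⟧) (λ x u → cross S x u * ⟦ a x u ⟧)))
  where
  table : ∀ x u xu y v yv → ⟦ x ∧ (not u ∧ (xu ∧ (y ∧ (not v ∧ yv)))) ⟧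
        ≡ ⟦ x ⟧ * ⟦ not u ⟧ * ⟦ xu ⟧ * (⟦ y ⟧ * ⟦ not v ⟧ * ⟦ yv ⟧)
  table false _ _ _ _ _ = refl
  table true true  _ _ _ _ = refl
  table true false false _ _ _ = refl
  table true false true false _ _ = refl
  table true false true true true _ = refl
  table true false true true false true = refl
  table true false true true false false = refl

record Enumeration (d : ℕ) {N : ℕ} (g : Fin N → Rel n) : Set where
  field
    regular  : ∀ i → Regular d (g i)
    complete : ∀ {a} → Regular d a → ∃[ i ] (∀ u v → g i u v ≡ a u v)
    distinct : ∀ {i j} → (∀ u v → g i u v ≡ g j u v) → i ≡ j

boundary-cong : {a b : Rel n} → (∀ u v → a u v ≡ b u v) → ∀ S → boundary a S ≡ boundary b S
boundary-cong eq S = ∑-cong λ u → ∑-cong λ v → cong (λ e → cross S u v * ⟦ e ⟧) (eq u v)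

module Counting {d N : ℕ} {g : Fin N → Rel n} (enum : Enumeration d g) (S : Fin n → Bool) where
  open Enumeration enum

  withBoundary : ℕ → Fin N → Bool
  withBoundary k i = does (boundary (g i) S ≟ k)

  W : ℕ → ℕ
  W k = ∑ λ i → ⟦ withBoundary k i ⟧

  withBoundary⇒≡ : ∀ k i → withBoundary k i ≡ true → boundary (g i) S ≡ k
  withBoundary⇒≡ k i = does-true (boundary (g i) S ≟ k)

  switchings : ∀ k x y u v → ∑ (λ i → ⟦ withBoundary k i ∧ forward (g i) S x y u v ⟧)
                           ≤ ∑ (λ i → ⟦ withBoundary (2 + k) i ∧ reverse (g i) S x y u v ⟧)
  switchings k x y u v = ∑-injection _ _ target hits inj
    where
    sw : ∀ i → withBoundary k i ∧ forward (g i) S x y u v ≡ true → Switchable S (g i) x y u v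
    sw i e = forward⇒switchable {a = g i} {S} (proj₂ (∧-true (withBoundary k i) _ e))
    image : ∀ i → withBoundary k i ∧ forward (g i) S x y u v ≡ true →
            ∃[ j ] (∀ p q → g j p q ≡ switch x y u v (g i) p q)
    image i e = complete (Switching.switch-regular (regular i) (sw i e))
    target′ : ∀ i b → withBoundary k i ∧ forward (g i) S x y u v ≡ b → Fin N
    target′ i true  e = proj₁ (image i e)
    -- A default value outside the domain of the switching.
    target′ i false e = i
    target : Fin N → Fin N
    target i = target′ i _ refl
    target-spec′ : ∀ i b (e : withBoundary k i ∧ forward (g i) S x y u v ≡ b) → b ≡ true →
                   ∀ p q → g (target′ i b e) p q ≡ switch x y u v (g i) p q
    target-spec′ i true e _ = proj₂ (image i e)
    target-spec : ∀ i → withBoundary k i ∧ forward (g i) S x y u v ≡ true →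
                  ∀ p q → g (target i) p q ≡ switch x y u v (g i) p q
    target-spec i e = target-spec′ i _ refl e
    edge-self : ∀ (s t : Fin n) → edge s t s t ≡ true
    edge-self s t = cong₂ (λ b c → b ∧ c ∨ (same s t ∧ same t s)) (same-refl s) (same-refl t)
    hits : ∀ i → withBoundary k i ∧ forward (g i) S x y u v ≡ true →
           withBoundary (2 + k) (target i) ∧ reverse (g (target i)) S x y u v ≡ true
    hits i e = cong₂ _∧_ (dec-true (boundary (g (target i)) S ≟ 2 + k) bd) rev
      where
      open Switchable (sw i e)
      bd : boundary (g (target i)) S ≡ 2 + k
      bd = trans (boundary-cong (target-spec i e) S)
        (trans (Switching.switch-boundary (regular i) (sw i e))
          (cong (2 +_) (withBoundary⇒≡ k i (proj₁ (∧-true _ _ e)))))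
      xu′ : g (target i) x u ≡ true
      xu′ = trans (target-spec i e x u)
        (trans (cong (λ b → (g i x u ∧ not (edges₂ x y u v x u)) ∨ (b ∨ edge y v x u)) (edge-self x u)) (Bool.∨-zeroʳ _))
      yv′ : g (target i) y v ≡ true
      yv′ = trans (target-spec i e y v)
        (trans (cong (λ b → (g i y v ∧ not (edges₂ x y u v y v)) ∨ (edge x u y v ∨ b)) (edge-self y v))
          (trans (cong ((g i y v ∧ not (edges₂ x y u v y v)) ∨_) (Bool.∨-zeroʳ (edge x u y v))) (Bool.∨-zeroʳ _)))
      rev : reverse (g (target i)) S x y u v ≡ true
      rev = reverse-intro (g (target i)) S x∈ y∈ u∉ v∉ xu′ yv′
    inj : ∀ i j → withBoundary k i ∧ forward (g i) S x y u v ≡ true →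
          withBoundary k j ∧ forward (g j) S x y u v ≡ true → target i ≡ target j → i ≡ j
    inj i j ei ej eq = distinct (switch-injective (regular i) (regular j) (sw i ei) (sw j ej)
      λ p q → trans (sym (target-spec i ei p q)) (trans (cong (λ t → g t p q) eq) (target-spec j ej p q)))

  -- Pairs of a graph and a switching of it are counted from both ends. Here m and m′ are the
  -- volumes of S and of its complement, the same for all graphs with boundary k; the last term
  -- accounts for the pairs of edges blocked by an existing edge.
  switching-inequality : ∀ k {m m′} → m + k ≡ d * size S → m′ + k ≡ d * size (not ∘ S) →
    W k * (m * m′) ≤ W (2 + k) * ((2 + k) * (2 + k)) + W k * (2 * (m * (d * d)))
  switching-inequality k {m} {m′} m+k m′+k = begin
    W k * (m * m′)
      ≡⟨ ∑-*ʳ (m * m′) _ ⟨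
    ∑ (λ i → ⟦ withBoundary k i ⟧ * (m * m′))
      ≤⟨ ∑-mono each ⟩
    ∑ (λ i → ⟦ withBoundary k i ⟧ * ∑⁴ (λ x y u v → ⟦ forward (g i) S x y u v ⟧)
           + ⟦ withBoundary k i ⟧ * (2 * (m * (d * d))))
      ≡⟨ trans (∑-+ _ _) (cong₂ _+_ (gather k (λ i → forward (g i) S)) (∑-*ʳ (2 * (m * (d * d))) _)) ⟩
    ∑⁴ (λ x y u v → ∑ (λ i → ⟦ withBoundary k i ∧ forward (g i) S x y u v ⟧)) + W k * (2 * (m * (d * d)))
      ≤⟨ +-monoˡ-≤ _ (∑⁴-mono (switchings k)) ⟩
    ∑⁴ (λ x y u v → ∑ (λ i → ⟦ withBoundary (2 + k) i ∧ reverse (g i) S x y u v ⟧)) + W k * (2 * (m * (d * d)))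
      ≡⟨ cong (_+ W k * (2 * (m * (d * d)))) (sym (gather (2 + k) (λ i → reverse (g i) S))) ⟩
    ∑ (λ i → ⟦ withBoundary (2 + k) i ⟧ * ∑⁴ (λ x y u v → ⟦ reverse (g i) S x y u v ⟧)) + W k * (2 * (m * (d * d)))
      ≡⟨ cong (_+ W k * (2 * (m * (d * d)))) (trans (∑-cong square) (∑-*ʳ ((2 + k) * (2 + k)) _)) ⟩
    W (2 + k) * ((2 + k) * (2 + k)) + W k * (2 * (m * (d * d))) ∎
    where
    open ≤-Reasoning
    gather : ∀ k (P : Fin N → (x y u v : Fin n) → Bool) →
      ∑ (λ i → ⟦ withBoundary k i ⟧ * ∑⁴ (λ x y u v → ⟦ P i x y u v ⟧))
      ≡ ∑⁴ (λ x y u v → ∑ (λ i → ⟦ withBoundary k i ∧ P i x y u v ⟧))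
    gather k P = trans (∑-cong λ i → trans (sym (∑⁴-*ˡ ⟦ withBoundary k i ⟧ _))
      (∑⁴-cong λ x y u v → sym (⟦∧⟧ (withBoundary k i) (P i x y u v)))) (∑-∑⁴ _)
    each : ∀ i → ⟦ withBoundary k i ⟧ * (m * m′) ≤
      ⟦ withBoundary k i ⟧ * ∑⁴ (λ x y u v → ⟦ forward (g i) S x y u v ⟧) + ⟦ withBoundary k i ⟧ * (2 * (m * (d * d)))
    each i with withBoundary k i in e
    ... | false = z≤n
    ... | true  = ≤-trans (*-monoʳ-≤ 1 (subst₂ (λ p q → p * q ≤ F + 2 * (p * (d * d))) vol vol′ (forward-count (regular i) S)))
                    (≤-reflexive (*-distribˡ-+ 1 F (2 * (m * (d * d)))))
      where
      F = ∑⁴ (λ x y u v → ⟦ forward (g i) S x y u v ⟧)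
      bd = withBoundary⇒≡ k i e
      vol : volume (g i) S ≡ m
      vol = +-cancelʳ-≡ k _ _ (trans (cong (volume (g i) S +_) (sym bd)) (trans (volume+boundary (regular i) S) (sym m+k)))
      vol′ : volume (g i) (not ∘ S) ≡ m′
      vol′ = +-cancelʳ-≡ k _ _ (trans (cong (volume (g i) (not ∘ S) +_) (sym (trans (boundary-not (regular i) S) bd)))
        (trans (volume+boundary (regular i) (not ∘ S)) (sym m′+k)))
    square : ∀ i → ⟦ withBoundary (2 + k) i ⟧ * ∑⁴ (λ x y u v → ⟦ reverse (g i) S x y u v ⟧)
                 ≡ ⟦ withBoundary (2 + k) i ⟧ * ((2 + k) * (2 + k))
    square i with withBoundary (2 + k) i in e
    ... | false = refl
    ... | true  = cong (1 *_) (trans (reverse-count (g i) S) (cong₂ _*_ bd bd))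
      where bd = withBoundary⇒≡ (2 + k) i e

-- Binomial coefficients

-- paths a b is the number of lattice paths from (0 , 0) to (a , b), that is,
-- the binomial coefficient (a + b) C a.
paths : ℕ → ℕ → ℕ
paths zero    b       = 1
paths (suc a) zero    = 1
paths (suc a) (suc b) = paths a (suc b) + paths (suc a) b

paths-zeroʳ : ∀ a → paths a 0 ≡ 1
paths-zeroʳ zero    = refl
paths-zeroʳ (suc a) = refl

paths-C : ∀ a b → paths a b ≡ (a + b) C a
paths-C zero    b    = refl
paths-C (suc a) zero = sym (trans (cong (_C suc a) (+-identityʳ (suc a))) (nCn≡1 (suc a)))
paths-C (suc a) (suc b) = trans
  (cong₂ _+_ (paths-C a (suc b)) (trans (paths-C (suc a) b) (cong (_C suc a) (sym (+-suc a b)))))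
  (nCk+nC[k+1]≡[n+1]C[k+1] (a + suc b) a)

mutual
  paths-absorbʳ : ∀ a b → suc b * paths a (suc b) ≡ (a + suc b) * paths a b
  paths-absorbʳ zero    b    = refl
  paths-absorbʳ (suc a) zero = trans (*-identityˡ (paths a 1 + 1)) (trans
    (cong (_+ 1) (trans (sym (*-identityˡ (paths a 1))) (trans (paths-absorbʳ a 0) (cong ((a + 1) *_) (paths-zeroʳ a)))))
    (arith a))
    where
    arith : ∀ a → (a + 1) * 1 + 1 ≡ (suc a + 1) * 1
    arith = solve-∀
  paths-absorbʳ (suc a) (suc b) = begin
    suc (suc b) * (P + Q)                          ≡⟨ *-distribˡ-+ (suc (suc b)) P Q ⟩
    suc (suc b) * P + suc (suc b) * Q              ≡⟨ cong (_+ suc (suc b) * Q) (paths-absorbʳ a (suc b)) ⟩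
    (a + suc (suc b)) * paths a (suc b) + suc (suc b) * Q
      ≡⟨ cong (λ t → t * paths a (suc b) + suc (suc b) * Q) (+-suc a (suc b)) ⟩
    (suc a + suc b) * paths a (suc b) + suc (suc b) * Q
      ≡⟨ cong (_+ suc (suc b) * Q) (sym (paths-absorbˡ a (suc b))) ⟩
    suc a * Q + suc (suc b) * Q                    ≡⟨ *-distribʳ-+ Q (suc a) (suc (suc b)) ⟨
    (suc a + suc (suc b)) * Q                      ∎
    where
    open ≡-Reasoning
    P = paths a (suc (suc b))
    Q = paths (suc a) (suc b)

  paths-absorbˡ : ∀ a b → suc a * paths (suc a) b ≡ (suc a + b) * paths a b
  paths-absorbˡ a zero = cong₂ _*_ (sym (+-identityʳ (suc a))) (sym (paths-zeroʳ a))
  paths-absorbˡ a (suc b) = +-cancelʳ-≡ (suc b * Q) _ _ (begin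
    suc a * Q + suc b * Q                     ≡⟨ *-distribʳ-+ Q (suc a) (suc b) ⟨
    (suc a + suc b) * (X + Y)                 ≡⟨ *-distribˡ-+ (suc a + suc b) X Y ⟩
    (suc a + suc b) * X + (suc a + suc b) * Y ≡⟨ cong ((suc a + suc b) * X +_) (paths-absorbʳ (suc a) b) ⟨
    (suc a + suc b) * X + suc b * Q           ∎)
    where
    open ≡-Reasoning
    X = paths a (suc b)
    Y = paths (suc a) b
    Q = paths (suc a) (suc b)

C-absorb′ : ∀ j c → suc j * ((j + c) C suc j) ≡ c * ((j + c) C j)
C-absorb′ j zero = trans (cong (suc j *_) (k>n⇒nCk≡0 {j + 0} {suc j} (s≤s (≤-reflexive (+-identityʳ j))))) (*-zeroʳ (suc j))
C-absorb′ j (suc c) = begin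
  suc j * ((j + suc c) C suc j) ≡⟨ cong (λ t → suc j * (t C suc j)) (+-suc j c) ⟩
  suc j * ((suc j + c) C suc j) ≡⟨ cong (suc j *_) (paths-C (suc j) c) ⟨
  suc j * paths (suc j) c       ≡⟨ paths-absorbˡ j c ⟩
  (suc j + c) * paths j c       ≡⟨ cong (_* paths j c) (sym (+-suc j c)) ⟩
  (j + suc c) * paths j c       ≡⟨ paths-absorbʳ j c ⟨
  suc c * paths j (suc c)       ≡⟨ cong (suc c *_) (paths-C j (suc c)) ⟩
  suc c * ((j + suc c) C j)     ∎
  where open ≡-Reasoning

C-absorb : ∀ A j → suc j * (A C suc j) ≡ (A ∸ j) * (A C j)
C-absorb A j with j ≤? A
... | no j≰A = trans (trans (cong (suc j *_) (k>n⇒nCk≡0 {A} {suc j} (m<n⇒m<1+n (≰⇒> j≰A)))) (*-zeroʳ (suc j)))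
                (cong (_* (A C j)) (sym (m≤n⇒m∸n≡0 (<⇒≤ (≰⇒> j≰A)))))
... | yes j≤A = subst (λ t → suc j * (t C suc j) ≡ (A ∸ j) * (t C j)) (m+[n∸m]≡n j≤A) (C-absorb′ j (A ∸ j))

vandermonde : ∀ A B m → (A + B) C m ≡ ∑ {suc m} (λ j → (A C toℕ j) * (B C (m ∸ toℕ j)))
vandermonde zero B m = sym (trans (∑-suc _) (trans (cong₂ _+_ (*-identityˡ (B C m)) (∑-zero {m} λ j → refl)) (+-identityʳ _)))
vandermonde (suc A) B zero = sym (trans (∑-suc _) (cong (1 +_) (∑-empty _)))
vandermonde (suc A) B (suc m) = begin
  suc (A + B) C suc m
    ≡⟨ nCk+nC[k+1]≡[n+1]C[k+1] (A + B) m ⟨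
  (A + B) C m + (A + B) C suc m
    ≡⟨ cong₂ _+_ (vandermonde A B m) (trans (vandermonde A B (suc m)) (∑-suc _)) ⟩
  ∑ X + (1 * (B C suc m) + ∑ Y)
    ≡⟨ shuffle (∑ X) (1 * (B C suc m)) (∑ Y) ⟩
  1 * (B C suc m) + (∑ X + ∑ Y)
    ≡⟨ cong (1 * (B C suc m) +_) (trans (sym (∑-+ X Y)) (∑-cong pascal)) ⟩
  1 * (B C suc m) + ∑ {suc m} (λ j → (suc A C suc (toℕ j)) * (B C (m ∸ toℕ j)))
    ≡⟨ ∑-suc _ ⟨
  ∑ {suc (suc m)} (λ j → (suc A C toℕ j) * (B C (suc m ∸ toℕ j))) ∎
  where
  open ≡-Reasoning
  X Y : Fin (suc m) → ℕ
  X j = (A C toℕ j) * (B C (m ∸ toℕ j))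
  Y j = (A C suc (toℕ j)) * (B C (m ∸ toℕ j))
  shuffle : ∀ a b c → a + (b + c) ≡ b + (a + c)
  shuffle = solve-∀
  pascal : ∀ j → X j + Y j ≡ (suc A C suc (toℕ j)) * (B C (m ∸ toℕ j))
  pascal j = trans (sym (*-distribʳ-+ (B C (m ∸ toℕ j)) (A C toℕ j) _))
    (cong (_* (B C (m ∸ toℕ j))) (nCk+nC[k+1]≡[n+1]C[k+1] A (toℕ j)))

-- The lower index is the same in both factors, which is the product that a chain of switchings
-- produces.
paths-vandermonde : ∀ A B → paths A B ≡ ∑ {suc A} (λ j → (A C (A ∸ toℕ j)) * (B C (A ∸ toℕ j)))
paths-vandermonde A B = trans (paths-C A B) (trans (vandermonde A B A)
  (∑-cong λ j → cong (_* (B C (A ∸ toℕ j))) (nCk≡nC[n∸k] (≤-pred (Fin.toℕ<n j)))))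

paths-monoʳ : ∀ a {b c} → b ≤ c → paths a b ≤ paths a c
paths-monoʳ zero    b≤c = ≤-refl
paths-monoʳ (suc a) {zero}  {zero}  b≤c = ≤-refl
paths-monoʳ (suc a) {zero}  {suc c} b≤c = ≤-trans (paths-monoʳ (suc a) {zero} {c} z≤n) (m≤n+m _ (paths a (suc c)))
paths-monoʳ (suc a) {suc b} {suc c} (s≤s b≤c) = paths-monoʳ a (s≤s b≤c) ⊕ paths-monoʳ (suc a) b≤c

paths-comm : ∀ a b → paths a b ≡ paths b a
paths-comm zero    b       = sym (paths-zeroʳ b)
paths-comm (suc a) zero    = refl
paths-comm (suc a) (suc b) = trans (cong₂ _+_ (paths-comm a (suc b)) (paths-comm (suc a) b)) (+-comm (paths (suc b) a) _)

paths-mono : ∀ {a a′ b b′} → a ≤ a′ → b ≤ b′ → paths a b ≤ paths a′ b′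
paths-mono {a} {a′} {b} {b′} a≤ b≤ = ≤-trans (paths-monoʳ a b≤)
  (subst₂ _≤_ (paths-comm b′ a) (paths-comm b′ a′) (paths-monoʳ b′ a≤))

paths-pos : ∀ a b → 1 ≤ paths a b
paths-pos a b = ≤-trans (≤-reflexive (sym (paths-zeroʳ a))) (paths-monoʳ a z≤n)

-- The left side counts the lattice paths to (a + a′ , b + b′) that pass through (a , b).
paths-* : ∀ a b a′ b′ → paths a b * paths a′ b′ ≤ paths (a + a′) (b + b′)
paths-* zero    b    a′ b′ = ≤-trans (≤-reflexive (*-identityˡ _)) (paths-monoʳ a′ (m≤n+m b′ b))
paths-* (suc a) zero a′ b′ = ≤-trans (≤-reflexive (*-identityˡ _)) (paths-mono (m≤n+m a′ (suc a)) ≤-refl)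
paths-* (suc a) (suc b) a′ b′ = ≤-trans (≤-reflexive (*-distribʳ-+ (paths a′ b′) (paths a (suc b)) _))
  (paths-* a (suc b) a′ b′ ⊕ paths-* (suc a) b a′ b′)

2^≤paths : ∀ c → 2 ^ c ≤ paths c c
2^≤paths zero    = ≤-refl
2^≤paths (suc c) = ≤-trans (2 ⊗ 2^≤paths c)
  (≤-trans (≤-reflexive (cong (paths c c +_) (+-identityʳ _)))
    (paths-mono (≤-refl {c}) (n≤1+n c) ⊕ paths-mono (n≤1+n c) (≤-refl {c})))

paths≤2^ : ∀ a b → paths a b ≤ 2 ^ (a + b)
paths≤2^ zero    b    = m^n>0 2 b
paths≤2^ (suc a) zero = m^n>0 2 (suc a + 0)
paths≤2^ (suc a) (suc b) = ≤-trans (paths≤2^ a (suc b) ⊕ paths≤2^ (suc a) b)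
  (≤-reflexive (trans (cong (λ t → 2 ^ (a + suc b) + 2 ^ t) (sym (+-suc a b)))
    (cong (2 ^ (a + suc b) +_) (sym (+-identityʳ _)))))

!-paths : ∀ t x → suc t ! * paths (suc t) x ≡ (suc t + x) * (t ! * paths t x)
!-paths t x = trans (swap₁ (suc t) (t !) _) (trans (cong (t ! *_) (paths-absorbˡ t x)) (swap₂ (t !) (suc t + x) _))
  where
  swap₁ : ∀ a b c → a * b * c ≡ b * (a * c)
  swap₁ = solve-∀
  swap₂ : ∀ a b c → a * (b * c) ≡ b * (a * c)
  swap₂ = solve-∀

!*paths≤^ : ∀ t x → t ! * paths t x ≤ (t + x) ^ t
!*paths≤^ zero    x = ≤-refl
!*paths≤^ (suc t) x = ≤-trans (≤-reflexive (!-paths t x))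
  (*-monoʳ-≤ (suc t + x) (≤-trans (!*paths≤^ t x) (^-monoˡ-≤ t (n≤1+n (t + x)))))

^≤!*paths : ∀ t x → x ^ t ≤ t ! * paths t x
^≤!*paths zero    x = ≤-refl
^≤!*paths (suc t) x = ≤-trans (*-mono-≤ (m≤n+m x (suc t)) (^≤!*paths t x)) (≤-reflexive (sym (!-paths t x)))

-- The usual bound (e m / t)^t for a binomial coefficient, with 4 in place of e: t^t / t! is at most
-- C(2t, t), hence at most 4^t.
paths≤[4p]^ : ∀ t x p → t + x ≤ p * t → paths t x ≤ (4 * p) ^ t
paths≤[4p]^ t x p t+x≤pt = *-cancelˡ-≤ (t !) {{>-nonZero (1≤n! t)}} (begin
  t ! * paths t x              ≤⟨ !*paths≤^ t x ⟩
  (t + x) ^ t                    ≤⟨ ^-monoˡ-≤ t t+x≤pt ⟩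
  (p * t) ^ t                    ≡⟨ ^-distribʳ-* t p t ⟩
  p ^ t * t ^ t                  ≤⟨ *-monoʳ-≤ (p ^ t) (^≤!*paths t t) ⟩
  p ^ t * (t ! * paths t t)    ≤⟨ *-monoʳ-≤ (p ^ t) (*-monoʳ-≤ (t !) (paths≤2^ t t)) ⟩
  p ^ t * (t ! * 2 ^ (t + t))  ≡⟨ cong (λ e → p ^ t * (t ! * e)) 4^t ⟩
  p ^ t * (t ! * 4 ^ t)        ≡⟨ shuffle (p ^ t) (t !) (4 ^ t) ⟩
  t ! * (4 ^ t * p ^ t)        ≡⟨ cong (t ! *_) (^-distribʳ-* t 4 p) ⟨
  t ! * (4 * p) ^ t            ∎)
  where
  open ≤-Reasoning
  ^-distribʳ-* : ∀ t a b → (a * b) ^ t ≡ a ^ t * b ^ t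
  ^-distribʳ-* zero    a b = refl
  ^-distribʳ-* (suc t) a b = trans (cong (a * b *_) (^-distribʳ-* t a b)) (regroup a b (a ^ t) (b ^ t))
    where
    regroup : ∀ a b c e → a * b * (c * e) ≡ a * c * (b * e)
    regroup = solve-∀
  4^t : 2 ^ (t + t) ≡ 4 ^ t
  4^t = trans (cong (2 ^_) (cong (t +_) (sym (+-identityʳ t)))) (sym (^-*-assoc 2 2 t))
  shuffle : ∀ a b c → a * (b * c) ≡ b * (c * a)
  shuffle = solve-∀

-- The product of the first j steps. The factors A - i and B - i multiply to j! C(A, j) and j! C(B,
-- j), the factors K + i + 1 to j! C(K + j, j), and the factorials cancel.
chain : ∀ (w : ℕ → ℕ) A B K →
  (∀ i → w i * ((A ∸ i) * (B ∸ i)) ≤ w (suc i) * ((K + suc i) * (K + suc i))) →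
  ∀ j → w 0 * ((A C j) * (B C j)) ≤ w j * (paths K j * paths K j)
chain w A B K step zero = ≤-reflexive (cong (w 0 *_) (sym (cong₂ _*_ (paths-zeroʳ K) (paths-zeroʳ K))))
chain w A B K step (suc j) = *-cancelˡ-≤ (suc j * suc j) (begin
  suc j * suc j * (w 0 * ((A C suc j) * (B C suc j)))     ≡⟨ e₁ (suc j) (w 0) (A C suc j) (B C suc j) ⟩
  w 0 * ((suc j * (A C suc j)) * (suc j * (B C suc j)))   ≡⟨ cong (w 0 *_) (cong₂ _*_ (C-absorb A j) (C-absorb B j)) ⟩
  w 0 * (((A ∸ j) * (A C j)) * ((B ∸ j) * (B C j)))       ≡⟨ e₂ (w 0) (A ∸ j) (A C j) (B ∸ j) (B C j) ⟩
  w 0 * ((A C j) * (B C j)) * ((A ∸ j) * (B ∸ j))         ≤⟨ *-monoˡ-≤ _ (chain w A B K step j) ⟩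
  w j * (P * P) * ((A ∸ j) * (B ∸ j))                     ≡⟨ e₃ (w j) (P * P) _ ⟩
  w j * ((A ∸ j) * (B ∸ j)) * (P * P)                     ≤⟨ *-monoˡ-≤ _ (step j) ⟩
  w (suc j) * ((K + suc j) * (K + suc j)) * (P * P)       ≡⟨ e₄ (w (suc j)) (K + suc j) P ⟩
  w (suc j) * (((K + suc j) * P) * ((K + suc j) * P))     ≡⟨ cong (λ t → w (suc j) * (t * t)) (sym (paths-absorbʳ K j)) ⟩
  w (suc j) * ((suc j * Q) * (suc j * Q))                 ≡⟨ e₅ (w (suc j)) (suc j) Q ⟩
  suc j * suc j * (w (suc j) * (Q * Q))                   ∎)
  where
  open ≤-Reasoning
  P = paths K j
  Q = paths K (suc j)
  e₁ : ∀ s w a b → s * s * (w * (a * b)) ≡ w * ((s * a) * (s * b))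
  e₁ = solve-∀
  e₂ : ∀ w x a y b → w * ((x * a) * (y * b)) ≡ w * (a * b) * (x * y)
  e₂ = solve-∀
  e₃ : ∀ a b c → a * b * c ≡ a * c * b
  e₃ = solve-∀
  e₄ : ∀ w k p → w * (k * k) * (p * p) ≡ w * ((k * p) * (k * p))
  e₄ = solve-∀
  e₅ : ∀ w s q → w * ((s * q) * (s * q)) ≡ s * s * (w * (q * q))
  e₅ = solve-∀

-- Summing over all lengths of the chain, instead of choosing the best one, turns the left side into
-- a single binomial coefficient by Vandermonde's identity.
chain-sum : ∀ (w : ℕ → ℕ) A B K →
  (∀ i → w i * ((A ∸ i) * (B ∸ i)) ≤ w (suc i) * ((K + suc i) * (K + suc i))) →
  w 0 * paths A B ≤ ∑ {suc A} (λ j → w (A ∸ toℕ j)) * (paths K A * paths K A)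
chain-sum w A B K step = begin
  w 0 * paths A B
    ≡⟨ cong (w 0 *_) (paths-vandermonde A B) ⟩
  w 0 * ∑ {suc A} (λ j → (A C (A ∸ toℕ j)) * (B C (A ∸ toℕ j)))
    ≡⟨ ∑-*ˡ (w 0) _ ⟨
  ∑ {suc A} (λ j → w 0 * ((A C (A ∸ toℕ j)) * (B C (A ∸ toℕ j))))
    ≤⟨ ∑-mono (λ j → ≤-trans (chain w A B K step (A ∸ toℕ j)) (*-monoʳ-≤ (w (A ∸ toℕ j)) (square (A ∸ toℕ j) (m∸n≤m A (toℕ j))))) ⟩
  ∑ {suc A} (λ j → w (A ∸ toℕ j) * (paths K A * paths K A))
    ≡⟨ ∑-*ʳ _ _ ⟩
  ∑ {suc A} (λ j → w (A ∸ toℕ j)) * (paths K A * paths K A) ∎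
  where
  open ≤-Reasoning
  square : ∀ i → i ≤ A → paths K i * paths K i ≤ paths K A * paths K A
  square i i≤A = *-mono-≤ (paths-monoʳ K i≤A) (paths-monoʳ K i≤A)

-- Bounds on the number of graphs with a given cut

module _ {d N : ℕ} {g : Fin N → Rel n} (enum : Enumeration d g) (S : Fin n → Bool) where
  open Counting enum S

  private
    s s′ : ℕ
    s  = size S
    s′ = size (not ∘ S)

  -- A and B are lower bounds for half the volumes, and K is an upper bound for half the boundary.
  -- The reserve 2d² in the hypothesis on B absorbs the blocked pairs of `switching-inequality`.
  -- Once i passes A or B, truncated subtraction makes the left side vanish.
  W-step : ∀ k A B K → 2 * A + k ≤ d * s → 2 * B + 2 * (d * d) + k ≤ d * s′ → k ≤ 2 * K → ∀ i →
    W (k + 2 * i) * ((A ∸ i) * (B ∸ i)) ≤ W (k + 2 * suc i) * ((K + suc i) * (K + suc i))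
  W-step k A B K hA hB hK i with i ≤? A | i ≤? B
  ... | no i≰A | _ = ≤-trans (≤-reflexive (trans (cong (λ t → w * (t * (B ∸ i))) (m≤n⇒m∸n≡0 (<⇒≤ (≰⇒> i≰A)))) (*-zeroʳ w))) z≤n
    where w = W (k + 2 * i)
  ... | yes _ | no i≰B = ≤-trans (≤-reflexive (trans (cong (λ t → w * ((A ∸ i) * t)) (m≤n⇒m∸n≡0 (<⇒≤ (≰⇒> i≰B)))) (trans (cong (w *_) (*-zeroʳ (A ∸ i))) (*-zeroʳ w)))) z≤n
    where w = W (k + 2 * i)
  ... | yes i≤A | yes i≤B = *-cancelˡ-≤ 4 (begin
    4 * (w * (a * b))                ≡⟨ e₁ w a b ⟩
    w * ((2 * a) * (2 * b))          ≤⟨ *-monoʳ-≤ w (*-monoˡ-≤ (2 * b) 2a≤v) ⟩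
    w * (v * (2 * b))                ≤⟨ +-cancelʳ-≤ (w * (2 * (v * (d * d)))) _ _ main ⟩
    w⁺ * ((2 + k′) * (2 + k′))       ≤⟨ *-monoʳ-≤ w⁺ (*-mono-≤ 2+k′≤ 2+k′≤) ⟩
    w⁺ * ((2 * (K + suc i)) * (2 * (K + suc i))) ≡⟨ e₂ w⁺ (K + suc i) ⟩
    4 * (w⁺ * ((K + suc i) * (K + suc i)))       ≡⟨ cong (λ t → 4 * (W t * ((K + suc i) * (K + suc i)))) (e₃ k i) ⟩
    4 * (W (k + 2 * suc i) * ((K + suc i) * (K + suc i))) ∎)
    where
    open ≤-Reasoning
    k′ = k + 2 * i
    w  = W k′
    w⁺ = W (2 + k′)
    a  = A ∸ i
    b  = B ∸ i
    e₁ : ∀ w a b → 4 * (w * (a * b)) ≡ w * ((2 * a) * (2 * b))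
    e₁ = solve-∀
    e₂ : ∀ w c → w * ((2 * c) * (2 * c)) ≡ 4 * (w * (c * c))
    e₂ = solve-∀
    e₃ : ∀ k i → 2 + (k + 2 * i) ≡ k + 2 * suc i
    e₃ = solve-∀
    A≡ : i + a ≡ A
    A≡ = m+[n∸m]≡n i≤A
    B≡ : i + b ≡ B
    B≡ = m+[n∸m]≡n i≤B
    hA′ : 2 * a + k′ ≤ d * s
    hA′ = ≤-trans (≤-reflexive (trans (e i a k) (cong (λ t → 2 * t + k) A≡))) hA
      where
      e : ∀ i a k → 2 * a + (k + 2 * i) ≡ 2 * (i + a) + k
      e = solve-∀
    hB′ : 2 * b + 2 * (d * d) + k′ ≤ d * s′
    hB′ = ≤-trans (≤-reflexive (trans (e i b k (2 * (d * d))) (cong (λ t → 2 * t + 2 * (d * d) + k) B≡))) hB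
      where
      e : ∀ i a k c → 2 * a + c + (k + 2 * i) ≡ 2 * (i + a) + c + k
      e = solve-∀
    v v′ : ℕ
    v  = d * s ∸ k′
    v′ = d * s′ ∸ k′
    v+k : v + k′ ≡ d * s
    v+k = m∸n+n≡m (≤-trans (m≤n+m k′ (2 * a)) hA′)
    v′+k : v′ + k′ ≡ d * s′
    v′+k = m∸n+n≡m (≤-trans (m≤n+m k′ (2 * b + 2 * (d * d))) hB′)
    2a≤v : 2 * a ≤ v
    2a≤v = +-cancelʳ-≤ k′ _ _ (≤-trans hA′ (≤-reflexive (sym v+k)))
    2b≤v′ : 2 * b + 2 * (d * d) ≤ v′
    2b≤v′ = +-cancelʳ-≤ k′ _ _ (≤-trans hB′ (≤-reflexive (sym v′+k)))
    main : w * (v * (2 * b)) + w * (2 * (v * (d * d))) ≤ w⁺ * ((2 + k′) * (2 + k′)) + w * (2 * (v * (d * d)))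
    main = begin
      w * (v * (2 * b)) + w * (2 * (v * (d * d))) ≡⟨ e w v b (d * d) ⟩
      w * (v * (2 * b + 2 * (d * d)))             ≤⟨ *-monoʳ-≤ w (*-monoʳ-≤ v 2b≤v′) ⟩
      w * (v * v′)                                ≤⟨ switching-inequality k′ {v} {v′} v+k v′+k ⟩
      w⁺ * ((2 + k′) * (2 + k′)) + w * (2 * (v * (d * d))) ∎
      where
      e : ∀ w v b c → w * (v * (2 * b)) + w * (2 * (v * c)) ≡ w * (v * (2 * b + 2 * c))
      e = solve-∀
    2+k′≤ : 2 + k′ ≤ 2 * (K + suc i)
    2+k′≤ = linarith (2 + k′) (2 * (K + suc i)) 0 hK (e k i K)
      where
      e : ∀ k i K → 2 + (k + 2 * i) + 2 * K + 0 ≡ 2 * (K + suc i) + k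
      e = solve-∀

  -- A graph has only one boundary value, so it is counted at most once along the chain.
  W-sum : ∀ k A → ∑ {suc A} (λ j → W (k + 2 * (A ∸ toℕ j))) ≤ N
  W-sum k A = begin
    ∑ {suc A} (λ j → W (k + 2 * (A ∸ toℕ j)))                            ≡⟨ ∑-swap _ ⟩
    ∑ (λ i → ∑ {suc A} (λ j → ⟦ withBoundary (k + 2 * (A ∸ toℕ j)) i ⟧)) ≤⟨ ∑-≤const (λ i → ∑-atMostOne _ (unique i)) ⟩
    N * 1                                                                ≡⟨ *-identityʳ N ⟩
    N                                                                    ∎
    where
    open ≤-Reasoning
    unique : ∀ i (j j′ : Fin (suc A)) → withBoundary (k + 2 * (A ∸ toℕ j)) i ≡ true →
             withBoundary (k + 2 * (A ∸ toℕ j′)) i ≡ true → j ≡ j′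
    unique i j j′ e e′ = Fin.toℕ-injective (∸-cancelˡ-≡ (≤-pred (Fin.toℕ<n j)) (≤-pred (Fin.toℕ<n j′))
      (*-cancelˡ-≡ _ _ 2 (+-cancelˡ-≡ k _ _ (trans (sym (withBoundary⇒≡ _ i e)) (withBoundary⇒≡ _ i e′)))))

  W-bound : ∀ k A B K → 2 * A + k ≤ d * s → 2 * B + 2 * (d * d) + k ≤ d * s′ → k ≤ 2 * K →
    W k * paths A B ≤ N * (paths K A * paths K A)
  W-bound k A B K hA hB hK = begin
    W k * paths A B           ≡⟨ cong (λ t → W t * paths A B) (sym (+-identityʳ k)) ⟩
    W (k + 2 * 0) * paths A B ≤⟨ chain-sum (λ i → W (k + 2 * i)) A B K (W-step k A B K hA hB hK) ⟩
    ∑ {suc A} (λ j → W (k + 2 * (A ∸ toℕ j))) * (paths K A * paths K A) ≤⟨ *-monoˡ-≤ _ (W-sum k A) ⟩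
    N * (paths K A * paths K A) ∎
    where open ≤-Reasoning

  module _ {h x : ℕ} (3≤d : 3 ≤ d) (2h≤d : 2 * h ≤ d) (large : 8 * x + 8 * (d * d) + 4 * d ≤ n)
           (4≤s : 4 ≤ s) (2s≤n : 2 * s ≤ n) where

    private
      s≤s′ : s ≤ s′
      s≤s′ = +-cancelˡ-≤ s s s′ (≤-trans (≤-reflexive (cong (s +_) (sym (+-identityʳ s))))
        (≤-trans 2s≤n (≤-reflexive (sym (size+size-not S)))))

      n≤2s′ : n ≤ 2 * s′
      n≤2s′ = ≤-trans (≤-reflexive (sym (size+size-not S)))
        (≤-trans (+-monoˡ-≤ s′ s≤s′) (≤-reflexive (cong (s′ +_) (sym (+-identityʳ s′)))))

    -- Because d ≥ 3, the half volumes leave room for A = s + 1 and B = s′ + x. The enlarged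
    -- binomial coefficient exceeds C(n, s) by a factor x + 1, and the loss stays bounded because s
    -- < s₀.
    W-small : ∀ {s₀} → s < s₀ → ∀ k → k ≤ 2 * h →
      W k * (paths s s′ * suc x) ≤ N * (2 ^ (h + s₀) * 2 ^ (h + s₀))
    W-small {s₀} s<s₀ k k≤2h = begin
      W k * (paths s s′ * suc x)        ≡⟨ cong (λ t → W k * (paths s s′ * t)) (sym (paths1 x)) ⟩
      W k * (paths s s′ * paths 1 x)    ≤⟨ *-monoʳ-≤ (W k) (paths-* s s′ 1 x) ⟩
      W k * paths (s + 1) (s′ + x)      ≤⟨ W-bound k (s + 1) (s′ + x) h hA hB k≤2h ⟩
      N * (paths h (s + 1) * paths h (s + 1)) ≤⟨ *-monoʳ-≤ N (*-mono-≤ p≤ p≤) ⟩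
      N * (2 ^ (h + s₀) * 2 ^ (h + s₀)) ∎
      where
      open ≤-Reasoning
      paths1 : ∀ x → paths 1 x ≡ suc x
      paths1 zero    = refl
      paths1 (suc x) = cong suc (paths1 x)
      p≤ : paths h (s + 1) ≤ 2 ^ (h + s₀)
      p≤ = ≤-trans (paths≤2^ h (s + 1)) (^-monoʳ-≤ 2 (+-monoʳ-≤ h (≤-trans (≤-reflexive (+-comm s 1)) s<s₀)))
      k≤d : k ≤ d
      k≤d = ≤-trans k≤2h 2h≤d
      -- The case d = 3 has k ≤ 2 and is tight at s = 4. For d ≥ 4 one of the s terms d pays for k,
      -- and the others contribute at least 4 each.
      hA : 2 * (s + 1) + k ≤ d * s
      hA with d ≤? 3
      ... | yes d≤3 = begin
        2 * (s + 1) + k ≤⟨ linarith (2 * (s + 1) + k) (3 * s) 0 (k≤2h ⊕ 2 ⊗ h≤1 ⊕ 4≤s) (e s k h) ⟩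
        3 * s           ≤⟨ *-monoˡ-≤ s 3≤d ⟩
        d * s           ∎
        where
        h≤1 : h ≤ 1
        h≤1 = ≮⇒≥ λ 2≤h → <⇒≱ (s≤s d≤3) (≤-trans (2 ⊗ 2≤h) 2h≤d)
        e : ∀ s k h → 2 * (s + 1) + k + (2 * h + (2 * 1 + s)) + 0 ≡ 3 * s + (k + (2 * h + 4))
        e = solve-∀
      ... | no d≰3 = begin
        2 * (s + 1) + k           ≤⟨ linarith (2 * (s + 1) + k) (d + 4 * t₃) 2 (k≤d ⊕ 2 ⊗ 4≤s) (e d k t₃ s (sym (m+[n∸m]≡n 1≤s))) ⟩
        d + 4 * t₃                ≤⟨ +-monoʳ-≤ d (*-monoˡ-≤ t₃ (≰⇒> d≰3)) ⟩
        d + d * t₃                ≡⟨ trans (cong (_+ d * t₃) (sym (*-identityʳ d))) (sym (*-distribˡ-+ d 1 t₃)) ⟩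
        d * (1 + t₃)              ≡⟨ cong (d *_) (m+[n∸m]≡n 1≤s) ⟩
        d * s                     ∎
        where
        1≤s : 1 ≤ s
        1≤s = ≤-trans (s≤s z≤n) 4≤s
        t₃ = s ∸ 1
        e : ∀ d k t s → s ≡ 1 + t → 2 * (s + 1) + k + (d + 2 * s) + 2 ≡ d + 4 * t + (k + 2 * 4)
        e d k t _ refl = e′ d k t
          where
          e′ : ∀ d k t → 2 * (1 + t + 1) + k + (d + 2 * (1 + t)) + 2 ≡ d + 4 * t + (k + 2 * 4)
          e′ = solve-∀
      hB : 2 * (s′ + x) + 2 * (d * d) + k ≤ d * s′
      hB = begin
        2 * (s′ + x) + 2 * (d * d) + k ≤⟨ *-cancelˡ-≤ 2 (linarith (2 * (2 * (s′ + x) + 2 * (d * d) + k)) (2 * (3 * s′)) (4 * x + 4 * (d * d) + 2 * d)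
                                            (large ⊕ n≤2s′ ⊕ 2 ⊗ k≤d) (e s′ x (d * d) d k n)) ⟩
        3 * s′                         ≤⟨ *-monoˡ-≤ s′ 3≤d ⟩
        d * s′                         ∎
        where
        e : ∀ s x D d k n → 2 * (2 * (s + x) + 2 * D + k) + (n + (2 * s + 2 * d)) + (4 * x + 4 * D + 2 * d)
          ≡ 2 * (3 * s) + ((8 * x + 8 * D + 4 * d) + (n + 2 * k))
        e = solve-∀

    -- With T = ⌊s / 384⌋ and E = 24 T, the loss (paths T A)² is at most 2 ^ E,
    -- because T + A ≤ 796 T and 4 * 796 ≤ 2 ^ 12.  The constant 384 is large
    -- enough to leave E spare edges in S and in its complement, which gain as much.
    W-large : 1 ≤ s / 384 → ∀ k → k ≤ s / 384 → W k * (paths s s′ * x ^ 3) ≤ 6 * N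
    W-large 1≤T k k≤T = *-cancelʳ-≤ _ _ (2 ^ E) {{m^n≢0 2 E}} (begin
      W k * (paths s s′ * x ^ 3) * 2 ^ E            ≤⟨ *-monoˡ-≤ (2 ^ E) (*-monoʳ-≤ (W k) (*-monoʳ-≤ (paths s s′) (^≤!*paths 3 x))) ⟩
      W k * (paths s s′ * (6 * paths 3 x)) * 2 ^ E  ≤⟨ *-monoʳ-≤ (W k * (paths s s′ * (6 * paths 3 x))) (2^≤paths E) ⟩
      W k * (paths s s′ * (6 * paths 3 x)) * paths E E ≡⟨ e₁ (W k) (paths s s′) (paths 3 x) (paths E E) ⟩
      6 * (W k * (paths s s′ * (paths 3 x * paths E E))) ≤⟨ *-monoʳ-≤ 6 (*-monoʳ-≤ (W k) (≤-trans (*-monoʳ-≤ (paths s s′) (paths-* 3 x E E)) (paths-* s s′ (3 + E) (x + E)))) ⟩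
      6 * (W k * paths A B)                         ≤⟨ *-monoʳ-≤ 6 (W-bound k A B T hA hB (≤-trans k≤T (m≤m+n T _))) ⟩
      6 * (N * (paths T A * paths T A))             ≤⟨ *-monoʳ-≤ 6 (*-monoʳ-≤ N (*-mono-≤ p≤ p≤)) ⟩
      6 * (N * (2 ^ (12 * T) * 2 ^ (12 * T)))       ≡⟨ cong (λ t → 6 * (N * t)) (trans (sym (^-distribˡ-+-* 2 (12 * T) (12 * T))) (cong (2 ^_) (e₂ T))) ⟩
      6 * (N * 2 ^ E)                               ≡⟨ *-assoc 6 N (2 ^ E) ⟨
      6 * N * 2 ^ E                                 ∎)
      where
      open ≤-Reasoning
      T = s / 384
      E = 24 * T
      A = s + (3 + E)
      B = s′ + (x + E)
      e₁ : ∀ w p q r → w * (p * (6 * q)) * r ≡ 6 * (w * (p * (q * r)))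
      e₁ = solve-∀
      e₂ : ∀ t → 12 * t + 12 * t ≡ 24 * t
      e₂ = solve-∀
      384T≤s : T * 384 ≤ s
      384T≤s = m/n*n≤m s 384
      s≤384T : s ≤ 383 + T * 384
      s≤384T = ≤-trans (≤-reflexive (m≡m%n+[m/n]*n s 384)) (+-monoˡ-≤ (T * 384) (≤-pred (m%n<n s 384)))
      T+A≤ : T + A ≤ 796 * T
      T+A≤ = linarith (T + A) (796 * T) 1 (s≤384T ⊕ 387 ⊗ 1≤T) (e T s)
        where
        e : ∀ T s → T + (s + (3 + 24 * T)) + (383 + T * 384 + 387 * T) + 1 ≡ 796 * T + (s + 387 * 1)
        e = solve-∀
      p≤ : paths T A ≤ 2 ^ (12 * T)
      p≤ = ≤-trans (paths≤[4p]^ T A 796 T+A≤) (≤-trans (^-monoˡ-≤ T 4p≤) (≤-reflexive (^-*-assoc 2 12 T)))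
        where
        4p≤ : 4 * 796 ≤ 2 ^ 12
        4p≤ = m≤m+n (4 * 796) 912
      hA : 2 * A + k ≤ d * s
      hA = ≤-trans (linarith (2 * A + k) (3 * s) (329 * T) (384T≤s ⊕ k≤T ⊕ 6 ⊗ 1≤T) (e s T k)) (*-monoˡ-≤ s 3≤d)
        where
        e : ∀ s T k → 2 * (s + (3 + 24 * T)) + k + (s + (T + 6 * T)) + 329 * T ≡ 3 * s + (T * 384 + (k + 6 * 1))
        e = solve-∀
      hB : 2 * B + 2 * (d * d) + k ≤ d * s′
      hB = ≤-trans (*-cancelˡ-≤ 4 (linarith (4 * (2 * B + 2 * (d * d) + k)) (4 * (3 * s′)) (4 * d + 572 * T)
        (large ⊕ n≤2s′ ⊕ 2 ⊗ s≤s′ ⊕ 2 ⊗ 384T≤s ⊕ 4 ⊗ k≤T) (e s s′ x T (d * d) k n d))) (*-monoˡ-≤ s′ 3≤d)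
        where
        e : ∀ s s′ x T D k n d → 4 * (2 * (s′ + (x + 24 * T)) + 2 * D + k) + (n + (2 * s′ + (2 * s′ + (2 * s + 4 * T)))) + (4 * d + 572 * T)
          ≡ 4 * (3 * s′) + ((8 * x + 8 * D + 4 * d) + (n + (2 * s + (2 * (T * 384) + 4 * k))))
        e = solve-∀

-- Expansion of random regular graphs

∑ₛ-zero : {F : Subset n → ℕ} → (∀ S → F S ≡ 0) → ∑ₛ F ≡ 0
∑ₛ-zero {zero}  F≡0 = F≡0 []
∑ₛ-zero {suc n} F≡0 = cong₂ _+_ (∑ₛ-zero (F≡0 ∘ (true ∷_))) (∑ₛ-zero (F≡0 ∘ (false ∷_)))

∑ₛ-card : ∀ n s → ∑ₛ {n} (λ S → ⟦ does (card S ≟ s) ⟧) ≡ n C s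
∑ₛ-card zero    zero    = refl
∑ₛ-card zero    (suc s) = refl
∑ₛ-card (suc n) zero    = cong₂ _+_ (∑ₛ-zero {n} λ _ → refl) (∑ₛ-card n zero)
∑ₛ-card (suc n) (suc s) = trans (cong₂ _+_ (∑ₛ-card n s) (∑ₛ-card n (suc s))) (nCk+nC[k+1]≡[n+1]C[k+1] n s)

-- A union bound: the C(n, s) sets of size s each contribute at most Y s / C(n, s).
∑ₛ-bySize : (F : Subset n → ℕ) (Y : ℕ → ℕ) →
  (∀ S → F S * paths (card S) (n ∸ card S) ≤ Y (card S)) → ∑ₛ F ≤ ∑ {suc n} (λ s → Y (toℕ s))
∑ₛ-bySize {n} F Y bound = begin
  ∑ₛ F                                                                ≡⟨ ∑ₛ-cong (λ S → sym (slice S)) ⟩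
  ∑ₛ (λ S → ∑ {suc n} (λ s → ⟦ does (card S ≟ toℕ s) ⟧ * F S))        ≡⟨ ∑-∑ₛ-swap (λ s S → ⟦ does (card S ≟ toℕ s) ⟧ * F S) ⟨
  ∑ {suc n} (λ s → ∑ₛ (λ S → ⟦ does (card S ≟ toℕ s) ⟧ * F S))        ≤⟨ ∑-mono (λ s → level (toℕ s) (≤-pred (Fin.toℕ<n s))) ⟩
  ∑ {suc n} (λ s → Y (toℕ s))                                         ∎
  where
  open ≤-Reasoning
  same-toℕ : ∀ {c} (c≤n : c < suc n) (s : Fin (suc n)) → does (c ≟ toℕ s) ≡ same s (Fin.fromℕ< c≤n)
  same-toℕ {c} c<n s = case c ≟ toℕ s of λ
    { (yes c≡s) → trans (dec-true (c ≟ toℕ s) c≡s)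
        (sym (trans (cong (same s) (Fin.toℕ-injective (trans (Fin.toℕ-fromℕ< c<n) c≡s))) (same-refl s)))
    ; (no c≢s)  → trans (dec-false (c ≟ toℕ s) c≢s)
        (sym (same-≢ λ s≡ → c≢s (sym (trans (cong toℕ s≡) (Fin.toℕ-fromℕ< c<n))))) }
  slice : ∀ S → ∑ {suc n} (λ s → ⟦ does (card S ≟ toℕ s) ⟧ * F S) ≡ F S
  slice S = trans (∑-cong λ s → cong (λ b → ⟦ b ⟧ * F S) (same-toℕ (s≤s (Subset.∣p∣≤n S)) s))
    (∑-δ (Fin.fromℕ< (s≤s (Subset.∣p∣≤n S))) (λ _ → F S))
  level : ∀ s → s ≤ n → ∑ₛ (λ S → ⟦ does (card S ≟ s) ⟧ * F S) ≤ Y s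
  level s s≤n = *-cancelʳ-≤ _ _ (n C s) {{>-nonZero nCs>0}} (begin
    ∑ₛ (λ S → ⟦ does (card S ≟ s) ⟧ * F S) * (n C s)   ≡⟨ ∑ₛ-*ʳ (n C s) (λ S → ⟦ does (card S ≟ s) ⟧ * F S) ⟨
    ∑ₛ (λ S → ⟦ does (card S ≟ s) ⟧ * F S * (n C s))   ≤⟨ ∑ₛ-mono each ⟩
    ∑ₛ {n} (λ S → ⟦ does (card S ≟ s) ⟧ * Y s)         ≡⟨ ∑ₛ-*ʳ (Y s) (λ (S : Subset n) → ⟦ does (card S ≟ s) ⟧) ⟩
    ∑ₛ {n} (λ S → ⟦ does (card S ≟ s) ⟧) * Y s         ≡⟨ cong (_* Y s) (∑ₛ-card n s) ⟩
    (n C s) * Y s                                      ≡⟨ *-comm (n C s) (Y s) ⟩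
    Y s * (n C s)                                      ∎)
    where
    paths≡ : paths s (n ∸ s) ≡ n C s
    paths≡ = trans (paths-C s (n ∸ s)) (cong (_C s) (m+[n∸m]≡n s≤n))
    nCs>0 : 1 ≤ n C s
    nCs>0 = subst (1 ≤_) paths≡ (paths-pos s (n ∸ s))
    each : ∀ S → ⟦ does (card S ≟ s) ⟧ * F S * (n C s) ≤ ⟦ does (card S ≟ s) ⟧ * Y s
    each S = case card S ≟ s of λ
      { (no c≢s)   → ≤-trans (≤-reflexive (cong (λ b → ⟦ b ⟧ * F S * (n C s)) (dec-false (card S ≟ s) c≢s))) z≤n
      ; (yes refl) → ≤-trans (≤-reflexive (*-assoc ⟦ does (card S ≟ s) ⟧ (F S) (n C s)))
          (*-monoʳ-≤ ⟦ does (card S ≟ s) ⟧ (subst (λ t → F S * t ≤ Y s) paths≡ (bound S))) }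

threshold : ℕ → ℕ → ℕ
threshold h s = (2 * h) ⊔ (s / 384)

sparseCut : ℕ → Rel n → (Fin n → Bool) → Bool
sparseCut {n} h a S = does (4 ≤? size S) ∧ (does (2 * size S ≤? n) ∧ does (boundary a S ≤? threshold h (size S)))

sparseCut⇒ : ∀ h (a : Rel n) S → 4 ≤ size S → 2 * size S ≤ n → sparseCut h a S ≡ false → threshold h (size S) < boundary a S
sparseCut⇒ {n} h a S p q e
  rewrite dec-true (4 ≤? size S) p | dec-true (2 * size S ≤? n) q
  = ≰⇒> λ r → case trans (sym (dec-true (boundary a S ≤? threshold h (size S)) r)) e of λ ()

sparseCuts : ℕ → Rel n → ℕ
sparseCuts {n} h a = ∑ₛ {n} (λ S → ⟦ sparseCut h a (lookup S) ⟧)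

module _ {d N : ℕ} {g : Fin N → Rel n} (enum : Enumeration d g) {h x : ℕ}
         (3≤d : 3 ≤ d) (1≤h : 1 ≤ h) (2h≤d : 2 * h ≤ d) (large : 8 * x + 8 * (d * d) + 4 * d ≤ n) where

  private
    s₀ c₀ : ℕ
    -- The size at which the two terms of `threshold` change places: below it the value is 2h, from
    -- it on s / 384.
    s₀ = 2 * h * 384
    c₀ = 2 ^ (h + s₀) * 2 ^ (h + s₀)

    Y : ℕ → ℕ
    Y s = ⟦ does (s <? s₀) ⟧ * (suc (2 * h) * c₀ * x ^ 2) + 6 * n

  -- The parameter x will be of order n. From `s₀` on, fewer than n boundary values occur and about
  -- n sizes will be summed; x ^ 3 pays for both and leaves one factor to spare. Below `s₀` there
  -- are boundedly many sizes and values, so a single factor x is gained and x ^ 2 remains in `Y`.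
  sparseCut-count : ∀ S → ∑ (λ i → ⟦ sparseCut h (g i) S ⟧) * (paths (size S) (size (not ∘ S)) * x ^ 3) ≤ N * Y (size S)
  sparseCut-count S with 4 ≤? size S | 2 * size S ≤? n
  ... | no ¬p | _ = ≤-trans (≤-reflexive (cong (_* p) (∑-zero zeroes))) z≤n
    where
    p = paths (size S) (size (not ∘ S)) * x ^ 3
    zeroes : ∀ i → ⟦ sparseCut h (g i) S ⟧ ≡ 0
    zeroes i rewrite dec-false (4 ≤? size S) ¬p = refl
  ... | yes _ | no ¬q = ≤-trans (≤-reflexive (cong (_* p) (∑-zero zeroes))) z≤n
    where
    p = paths (size S) (size (not ∘ S)) * x ^ 3
    zeroes : ∀ i → ⟦ sparseCut h (g i) S ⟧ ≡ 0
    zeroes i rewrite dec-false (2 * size S ≤? n) ¬q = cong ⟦_⟧ (Bool.∧-zeroʳ _)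
  ... | yes 4≤s | yes 2s≤n = begin
    ∑ (λ i → ⟦ sparseCut h (g i) S ⟧) * p     ≤⟨ *-monoˡ-≤ p (∑-mono λ i → layers i) ⟩
    ∑ (λ i → ∑ {suc κ} (λ k → ⟦ withBoundary (toℕ k) i ⟧)) * p ≡⟨ cong (_* p) (∑-swap _) ⟩
    ∑ {suc κ} (λ k → W (toℕ k)) * p           ≡⟨ ∑-*ʳ p _ ⟨
    ∑ {suc κ} (λ k → W (toℕ k) * p)           ≤⟨ regimes (s <? s₀) ⟩
    N * Y s                                   ∎
    where
    open ≤-Reasoning
    open Counting enum S
    s = size S
    p = paths (size S) (size (not ∘ S)) * x ^ 3
    κ = threshold h s
    layers : ∀ i → ⟦ sparseCut h (g i) S ⟧ ≤ ∑ {suc κ} (λ k → ⟦ withBoundary (toℕ k) i ⟧)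
    layers i with boundary (g i) S ≤? κ
    ... | no ¬r rewrite dec-false (boundary (g i) S ≤? κ) ¬r =
      ≤-trans (≤-reflexive (cong ⟦_⟧ (trans (cong (does (4 ≤? s) ∧_) (Bool.∧-zeroʳ _)) (Bool.∧-zeroʳ _)))) z≤n
    ... | yes r = ≤-trans (⟦⟧≤1 _) (≤-trans (≤-reflexive (cong ⟦_⟧ (sym hit))) (≤∑ _ (Fin.fromℕ< (s≤s r))))
      where
      hit : withBoundary (toℕ (Fin.fromℕ< (s≤s r))) i ≡ true
      hit = dec-true (boundary (g i) S ≟ _) (sym (Fin.toℕ-fromℕ< (s≤s r)))
    regimes : (s<s₀? : Dec (s < s₀)) → ∑ {suc κ} (λ k → W (toℕ k) * p) ≤ N * Y s
    regimes (yes s<s₀) = begin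
      ∑ {suc κ} (λ k → W (toℕ k) * p)        ≤⟨ ∑-≤const {c = N * c₀ * x ^ 2} (λ k → each (toℕ k) (≤-trans (≤-pred (Fin.toℕ<n k)) κ≤2h)) ⟩
      suc κ * (N * c₀ * x ^ 2)               ≤⟨ *-monoˡ-≤ (N * c₀ * x ^ 2) (s≤s κ≤2h) ⟩
      suc (2 * h) * (N * c₀ * x ^ 2)         ≡⟨ e (suc (2 * h)) N c₀ (x ^ 2) ⟩
      N * (1 * (suc (2 * h) * c₀ * x ^ 2))   ≤⟨ *-monoʳ-≤ N (m≤m+n _ (6 * n)) ⟩
      N * (1 * (suc (2 * h) * c₀ * x ^ 2) + 6 * n) ≡⟨ cong (λ b → N * (⟦ b ⟧ * (suc (2 * h) * c₀ * x ^ 2) + 6 * n)) (sym (dec-true (s <? s₀) s<s₀)) ⟩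
      N * Y s ∎
      where
      κ≤2h : κ ≤ 2 * h
      κ≤2h = ⊔-lub ≤-refl (<⇒≤ (m<n*o⇒m/o<n s<s₀))
      e : ∀ a n c y → a * (n * c * y) ≡ n * (1 * (a * c * y))
      e = solve-∀
      each : ∀ k → k ≤ 2 * h → W k * p ≤ N * c₀ * x ^ 2
      each k k≤2h = begin
        W k * (P * x ^ 3)        ≡⟨ e₁ (W k) P x (x ^ 2) ⟩
        W k * (P * x) * x ^ 2    ≤⟨ *-monoˡ-≤ (x ^ 2) (*-monoʳ-≤ (W k) (*-monoʳ-≤ P (n≤1+n x))) ⟩
        W k * (P * suc x) * x ^ 2 ≤⟨ *-monoˡ-≤ (x ^ 2) (W-small enum S {h} {x} 3≤d 2h≤d large 4≤s 2s≤n s<s₀ k k≤2h) ⟩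
        N * c₀ * x ^ 2 ∎
        where
        P = paths s (size (not ∘ S))
        e₁ : ∀ w p x y → w * (p * (x * y)) ≡ w * (p * x) * y
        e₁ = solve-∀
    regimes (no s≮s₀) = begin
      ∑ {suc κ} (λ k → W (toℕ k) * p)  ≤⟨ ∑-≤const {c = 6 * N} (λ k → W-large enum S {h} {x} 3≤d 2h≤d large 4≤s 2s≤n (≤-trans 1≤2h 2h≤T) (toℕ k) (≤-trans (≤-pred (Fin.toℕ<n k)) κ≤T)) ⟩
      suc κ * (6 * N)                  ≤⟨ *-monoˡ-≤ (6 * N) (≤-trans (s≤s (≤-trans κ≤T (m/n≤m s 384))) s<n) ⟩
      n * (6 * N)                      ≡⟨ e n N ⟩
      N * (6 * n)                      ≤⟨ *-monoʳ-≤ N (m≤n+m (6 * n) (⟦ does (s <? s₀) ⟧ * (suc (2 * h) * c₀ * x ^ 2))) ⟩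
      N * Y s                          ∎
      where
      1≤2h : 1 ≤ 2 * h
      1≤2h = ≤-trans 1≤h (m≤m+n h _)
      2h≤T : 2 * h ≤ s / 384
      2h≤T = ≤-trans (≤-reflexive (sym (m*n/n≡m (2 * h) 384))) (/-mono-≤ (≮⇒≥ s≮s₀) (≤-refl {384}))
      κ≤T : κ ≤ s / 384
      κ≤T = ⊔-lub 2h≤T ≤-refl
      s<n : suc s ≤ n
      s<n = ≤-trans (≤-trans (+-monoˡ-≤ s (≤-trans (s≤s z≤n) 4≤s)) (≤-reflexive (cong (s +_) (sym (+-identityʳ s))))) 2s≤n
      e : ∀ n N → n * (6 * N) ≡ N * (6 * n)
      e = solve-∀

  -- The first moment: a random graph has on average at most a constant over x sparse cuts.
  sparseCuts-total : n ≤ 31 * x → 1 ≤ x →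
    ∑ (λ i → sparseCuts h (g i)) * x ≤ N * (s₀ * (suc (2 * h) * c₀) + 6 * (31 * 32))
  sparseCuts-total n≤31x 1≤x = *-cancelʳ-≤ _ _ (x ^ 2) {{m^n≢0 x 2 {{>-nonZero 1≤x}}}} (begin
    ∑ (λ i → sparseCuts h (g i)) * x * x ^ 2
      ≡⟨ *-assoc (∑ (λ i → sparseCuts h (g i))) x (x ^ 2) ⟩
    ∑ (λ i → sparseCuts h (g i)) * x ^ 3
      ≡⟨ cong (_* x ^ 3) (∑-∑ₛ-swap (λ i S → ⟦ sparseCut h (g i) (lookup S) ⟧)) ⟩
    ∑ₛ (λ S → ∑ (λ i → ⟦ sparseCut h (g i) (lookup S) ⟧)) * x ^ 3
      ≡⟨ ∑ₛ-*ʳ (x ^ 3) (λ S → ∑ (λ i → ⟦ sparseCut h (g i) (lookup S) ⟧)) ⟨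
    ∑ₛ (λ S → ∑ (λ i → ⟦ sparseCut h (g i) (lookup S) ⟧) * x ^ 3)
      ≤⟨ ∑ₛ-bySize _ (λ s → N * Y s) each ⟩
    ∑ {suc n} (λ s → N * Y (toℕ s))
      ≡⟨ ∑-*ˡ N _ ⟩
    N * ∑ {suc n} (λ s → Y (toℕ s))
      ≡⟨ cong (N *_) (trans (∑-+ _ _) (cong₂ _+_ (∑-*ʳ _ (λ s → ⟦ does (toℕ s <? s₀) ⟧)) (∑-const (suc n) (6 * n)))) ⟩
    N * (∑ {suc n} (λ s → ⟦ does (toℕ s <? s₀) ⟧) * (suc (2 * h) * c₀ * x ^ 2) + suc n * (6 * n))
      ≤⟨ *-monoʳ-≤ N (*-monoˡ-≤ (suc (2 * h) * c₀ * x ^ 2) (below (suc n) s₀) ⊕ *-mono-≤ n<32x (*-monoʳ-≤ 6 n≤31x)) ⟩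
    N * (s₀ * (suc (2 * h) * c₀ * x ^ 2) + 32 * x * (6 * (31 * x)))
      ≡⟨ e N s₀ (suc (2 * h) * c₀) x ⟩
    N * (s₀ * (suc (2 * h) * c₀) + 6 * (31 * 32)) * x ^ 2 ∎)
    where
    open ≤-Reasoning
    n<32x : suc n ≤ 32 * x
    n<32x = +-mono-≤ 1≤x n≤31x
    below : ∀ m s₀ → ∑ {m} (λ s → ⟦ does (toℕ s <? s₀) ⟧) ≤ s₀
    below zero    s₀       = ≤-trans (≤-reflexive (∑-empty _)) z≤n
    below (suc m) zero     = ≤-reflexive (∑-zero {suc m} λ s → refl)
    below (suc m) (suc s₀) = ≤-trans (≤-reflexive (∑-suc _)) (s≤s (below m s₀))
    e : ∀ N s c x → N * (s * (c * (x * (x * 1))) + 32 * x * (6 * (31 * x))) ≡ N * (s * c + 6 * (31 * 32)) * (x * (x * 1))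
    e = solve-∀
    each : ∀ S → ∑ (λ i → ⟦ sparseCut h (g i) (lookup S) ⟧) * x ^ 3 * paths (card S) (n ∸ card S) ≤ N * Y (card S)
    each S = begin
      w * x ^ 3 * paths (card S) (n ∸ card S)   ≡⟨ cong₂ (λ s t → w * x ^ 3 * paths s t) (card-∑ S) n∸s ⟩
      w * x ^ 3 * paths (size σ) (size (not ∘ σ)) ≡⟨ e₁ w (x ^ 3) _ ⟩
      w * (paths (size σ) (size (not ∘ σ)) * x ^ 3) ≤⟨ sparseCut-count σ ⟩
      N * Y (size σ)                            ≡⟨ cong (λ s → N * Y s) (card-∑ S) ⟨
      N * Y (card S)                            ∎
      where
      σ = lookup S
      w = ∑ (λ i → ⟦ sparseCut h (g i) σ ⟧)
      n∸s : n ∸ card S ≡ size (not ∘ σ)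
      n∸s = trans (cong₂ _∸_ (sym (size+size-not σ)) (card-∑ S)) (m+n∸m≡n (size σ) _)
      e₁ : ∀ a b c → a * b * c ≡ a * (c * b)
      e₁ = solve-∀

-- Partitions containing all edges of an expander

false≢true : ∀ {b} → b ≡ false → b ≡ true → ⊥
false≢true refl ()

size-positive : (S : Fin n → Bool) → ∀ v → S v ≡ true → 1 ≤ size S
size-positive S v e = ≤-trans (≤-reflexive (sym (cong ⟦_⟧ e))) (≤∑ (λ u → ⟦ S u ⟧) v)

size-witness : (S : Fin n → Bool) → 1 ≤ size S → ∃[ v ] S v ≡ true
size-witness S p with v , q ← ∑-pos (λ u → ⟦ S u ⟧) p = v , ⟦⟧-pos q

size-mono : {S T : Fin n → Bool} → (∀ v → S v ≡ true → T v ≡ true) → size S ≤ size T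
size-mono S⊆T = ∑-mono λ v → ⟦⟧-mono (S⊆T v)

size-insert : (S : Fin n → Bool) → ∀ {v} → S v ≡ false → size (λ u → S u ∨ same u v) ≡ suc (size S)
size-insert S {v} Sv = trans (∑-cong λ u → ⟦∨⟧ (S u) (same u v) λ (p , q) → false≢true Sv (trans (cong S (sym (same⇒≡ q))) p))
  (trans (∑-+ _ _) (trans (cong (size S +_) (∑-same v)) (+-comm (size S) 1)))

not-false : ∀ {b} → not b ≡ true → b ≡ false
not-false {false} _ = refl

not-true : ∀ {b} → b ≡ false → not b ≡ true
not-true refl = refl

neighbourhood-size : ∀ {d} {a : Rel n} → Regular d a → ∀ {C : Fin n → Bool} {w} → C w ≡ true →
  (∀ v → a w v ≡ true → C v ≡ true) → suc d ≤ size C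
neighbourhood-size {d = d} {a} reg {C} {w} Cw N⊆C = begin
  suc d                                        ≡⟨ cong₂ _+_ (∑-same w) (Regular.degree reg w) ⟨
  ∑ (λ v → ⟦ same v w ⟧) + ∑ (λ v → ⟦ a w v ⟧) ≡⟨ ∑-+ _ _ ⟨
  ∑ (λ v → ⟦ same v w ⟧ + ⟦ a w v ⟧)           ≤⟨ ∑-mono cell ⟩
  size C                                       ∎
  where
  open ≤-Reasoning
  cell : ∀ v → ⟦ same v w ⟧ + ⟦ a w v ⟧ ≤ ⟦ C v ⟧
  cell v with same v w in vw | a w v in awv
  ... | true  | true  = contradiction (sym (same⇒≡ vw)) (adjacent⇒≢ reg awv)
  ... | true  | false rewrite same⇒≡ vw | Cw = ≤-refl
  ... | false | true  rewrite N⊆C v awv = ≤-refl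
  ... | false | false = z≤n

GoodExpander : ℕ → Rel n → Set
GoodExpander {n} h a = ∀ S → 4 ≤ size S → 2 * size S ≤ n → threshold h (size S) < boundary a S

module _ {d h : ℕ} {a : Rel n} (reg : Regular d a) (3≤d : 3 ≤ d) (2h≤d : 2 * h ≤ d) (d≤2h+1 : d ≤ suc (2 * h))
         (good : GoodExpander h a) where
  open Regular reg

  -- A vertex of J has at most |J| - 1 neighbours inside J. The bound is useful only for very small
  -- J.
  boundary-lower : ∀ J → size J * suc d ≤ boundary a J + size J * size J
  boundary-lower J = linarith (size J * suc d) (boundary a J + size J * size J) 0 (volume-upper ⊕ ≤-reflexive (sym (volume+boundary reg J)))
    (e (size J) d (volume a J) (boundary a J))
    where
    e : ∀ j d v b → j * suc d + (j * j + (v + b)) + 0 ≡ b + j * j + (v + j + d * j)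
    e = solve-∀
    cell : ∀ x y → inner a J x y + ⟦ same y x ⟧ * ⟦ J x ⟧ ≤ ⟦ J x ⟧ * ⟦ J y ⟧
    cell x y with same y x in eq
    ... | true rewrite same⇒≡ eq | irrefl x with J x
    ...   | true  = ≤-refl
    ...   | false = z≤n
    cell x y | false with J x | J y
    ... | false | _     = z≤n
    ... | true  | false = z≤n
    ... | true  | true  with a x y
    ...   | true  = ≤-refl
    ...   | false = z≤n
    volume-upper : volume a J + size J ≤ size J * size J
    volume-upper = begin
      volume a J + size J
        ≡⟨ ∑-+ _ _ ⟨
      ∑ (λ x → ∑ (inner a J x) + ⟦ J x ⟧)
        ≡⟨ ∑-cong (λ x → trans (cong (∑ (inner a J x) +_) (sym (∑-δ x (λ _ → ⟦ J x ⟧)))) (sym (∑-+ _ _))) ⟩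
      ∑ (λ x → ∑ (λ y → inner a J x y + ⟦ same y x ⟧ * ⟦ J x ⟧))
        ≤⟨ ∑-mono (λ x → ∑-mono (cell x)) ⟩
      ∑ (λ x → ∑ (λ y → ⟦ J x ⟧ * ⟦ J y ⟧))
        ≡⟨ trans (∑-cong λ x → ∑-*ˡ ⟦ J x ⟧ _) (∑-*ʳ (size J) _) ⟩
      size J * size J ∎
      where open ≤-Reasoning

  -- From four vertices on, expansion applies to J or to its complement, whichever is at most half
  -- of the graph. For two and three vertices `boundary-lower` gives 2d - 2 and 3d - 6.
  2h<boundary : ∀ J → 2 ≤ size J → 4 ≤ size (not ∘ J) → 2 * h < boundary a J
  2h<boundary J 2≤j 4≤j′ with 4 ≤? size J
  ... | yes 4≤j with 2 * size J ≤? n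
  ...   | yes 2j≤n = ≤-trans (s≤s (m≤m⊔n (2 * h) _)) (good J 4≤j 2j≤n)
  ...   | no  2j≰n = ≤-trans (s≤s (m≤m⊔n (2 * h) _)) (≤-trans (good (not ∘ J) 4≤j′ 2j′≤n) (≤-reflexive (boundary-not reg J)))
    where
    2j′≤n : 2 * size (not ∘ J) ≤ n
    2j′≤n = linarith (2 * size (not ∘ J)) n 1 (≰⇒> 2j≰n ⊕ ≤-reflexive (cong (2 *_) (size+size-not J))) (e (size J) (size (not ∘ J)) n)
      where
      e : ∀ j j′ n → 2 * j′ + (2 * j + 2 * n) + 1 ≡ n + (suc n + 2 * (j + j′))
      e = solve-∀
  2h<boundary J 2≤j 4≤j′ | no 4≰j = case m≤n⇒m<n∨m≡n (≤-pred (≰⇒> 4≰j)) of λ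
    { (inj₁ j<3) → two (≤-antisym (≤-pred j<3) 2≤j)
    ; (inj₂ j≡3) → three j≡3 }
    where
    lower : size J * suc d ≤ boundary a J + size J * size J
    lower = boundary-lower J
    two : size J ≡ 2 → 2 * h < boundary a J
    two j≡2 = linarith (suc (2 * h)) (boundary a J) 0 (subst (λ j → j * suc d ≤ boundary a J + j * j) j≡2 lower ⊕ 2h≤d ⊕ 3≤d)
      (e (boundary a J) d h)
      where
      e : ∀ b d h → suc (2 * h) + (b + 4 + (d + d)) + 0 ≡ b + (2 * suc d + (2 * h + 3))
      e = solve-∀
    three : size J ≡ 3 → 2 * h < boundary a J
    three j≡3 with h ≤? 1
    ... | yes h≤1 = linarith (suc (2 * h)) (boundary a J) 0 (subst (λ j → j * suc d ≤ boundary a J + j * j) j≡3 lower ⊕ 2 ⊗ h≤1 ⊕ 3 ⊗ 3≤d)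
      (e (boundary a J) d h)
      where
      e : ∀ b d h → suc (2 * h) + (b + 9 + (2 * 1 + 3 * d)) + 0 ≡ b + (3 * suc d + (2 * h + 3 * 3))
      e = solve-∀
    ... | no h≰1 = linarith (suc (2 * h)) (boundary a J) 1 (subst (λ j → j * suc d ≤ boundary a J + j * j) j≡3 lower ⊕ 3 ⊗ 2h≤d ⊕ 4 ⊗ ≰⇒> h≰1)
      (e (boundary a J) d h)
      where
      e : ∀ b d h → suc (2 * h) + (b + 9 + (3 * d + 4 * h)) + 1 ≡ b + (3 * suc d + (3 * (2 * h) + 4 * 2))
      e = solve-∀

  degreeInto : (Fin n → Bool) → Fin n → ℕ
  degreeInto J x = ∑ (λ v → ⟦ J v ⟧ * ⟦ a x v ⟧)

  degreeInto-mono : ∀ {J J′} → (∀ v → J v ≡ true → J′ v ≡ true) → ∀ x → degreeInto J x ≤ degreeInto J′ x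
  degreeInto-mono J⊆J′ x = ∑-mono λ v → *-monoˡ-≤ ⟦ a x v ⟧ (⟦⟧-mono (J⊆J′ v))

  degreeInto-not : ∀ J x → degreeInto J x + degreeInto (not ∘ J) x ≡ d
  degreeInto-not J x = trans (sym (∑-+ _ _)) (trans (∑-cong λ v → trans (sym (*-distribʳ-+ ⟦ a x v ⟧ ⟦ J v ⟧ _))
    (trans (cong (_* ⟦ a x v ⟧) (⟦⟧+⟦not⟧ (J v))) (*-identityˡ _))) (degree x))

  module _ (I C : Fin n → Bool) where

    -- The sets met by greedily adding vertices of C that have more than h neighbours in the current
    -- set. Growing J only increases `degreeInto J`, so `added` persists for vertices added earlier.
    record Closed (J : Fin n → Bool) : Set where
      field
        I⊆J   : ∀ v → I v ≡ true → J v ≡ true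
        J⊆C   : ∀ v → J v ≡ true → C v ≡ true
        added : ∀ v → J v ≡ true → I v ≡ false → h < degreeInto J v

    closure : ∀ fuel J → Closed J → n ≤ fuel + size J →
      Σ[ J′ ∈ (Fin n → Bool) ] (Closed J′ × (∀ v → C v ≡ true → J′ v ≡ false → degreeInto J′ v ≤ h))
    closure fuel J cl n≤ with Fin.any? (λ v → (C v Bool.≟ true) ×-dec ((J v Bool.≟ false) ×-dec (h <? degreeInto J v)))
    ... | no none = J , cl , λ v Cv Jv → ≮⇒≥ λ h< → none (v , Cv , Jv , h<)
    closure zero J cl n≤ | yes (v , Cv , Jv , h<) = contradiction n≤ (<⇒≱ (begin-strict
      size J                       <⟨ m<m+n (size J) (size-positive (not ∘ J) v (not-true Jv)) ⟩
      size J + size (not ∘ J)      ≡⟨ size+size-not J ⟩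
      n                            ∎))
      where open ≤-Reasoning
    closure (suc fuel) J cl n≤ | yes (v , Cv , Jv , h<) = closure fuel J⁺ cl⁺ (≤-trans n≤ (≤-reflexive
      (trans (sym (+-suc fuel (size J))) (cong (fuel +_) (sym size⁺)))))
      where
      open Closed cl
      J⁺ : Fin n → Bool
      J⁺ u = J u ∨ same u v
      J⊆J⁺ : ∀ u → J u ≡ true → J⁺ u ≡ true
      J⊆J⁺ u e = cong (_∨ same u v) e
      inv : ∀ u → J⁺ u ≡ true → J u ≡ true ⊎ u ≡ v
      inv u e with J u
      ... | true  = inj₁ refl
      ... | false = inj₂ (same⇒≡ e)
      size⁺ : size J⁺ ≡ suc (size J)
      size⁺ = size-insert J Jv
      cl⁺ : Closed J⁺
      cl⁺ = record
        { I⊆J   = λ u e → J⊆J⁺ u (I⊆J u e)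
        ; J⊆C   = λ u e → [ J⊆C u , (λ { refl → Cv }) ]′ (inv u e)
        ; added = λ u e Iu → ≤-trans ([ (λ Ju → added u Ju Iu) , (λ { refl → h< }) ]′ (inv u e)) (degreeInto-mono J⊆J⁺ u)
        }

    -- A set J between I and C that admits no improvement by moving a vertex of
    -- C \ I has at most h boundary edges per vertex of C \ I.
    no-small-separator : (∀ v → I v ≡ true → C v ≡ true) → (∀ u v → I u ≡ true → a u v ≡ true → C v ≡ true) →
      2 ≤ size I → 4 ≤ size (not ∘ C) → 3 ≤ size (λ v → C v ∧ not (I v))
    no-small-separator I⊆C N⊆C 2≤I 4≤C′ = ≰⇒> λ D≤2 → <⇒≱
      (2h<boundary J (≤-trans 2≤I (size-mono I⊆J)) (≤-trans 4≤C′ (size-mono λ v Cv → outside v (not-false Cv))))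
      (≤-trans upper (≤-trans (*-monoʳ-≤ h D≤2) (≤-reflexive (*-comm h 2))))
      where
      start : Closed I
      start = record { I⊆J = λ _ e → e ; J⊆C = I⊆C ; added = λ v e e′ → contradiction e (false≢true e′) }
      result = closure n I start (m≤m+n n _)
      J = proj₁ result
      open Closed (proj₁ (proj₂ result))
      stable = proj₂ (proj₂ result)
      D : Fin n → Bool
      D v = C v ∧ not (I v)
      outside : ∀ v → C v ≡ false → not (J v) ≡ true
      outside v Cv with J v in e
      ... | false = refl
      ... | true  = contradiction (J⊆C v e) (false≢true Cv)
      side₁ : Fin n → Fin n → ℕ
      side₁ u v = ⟦ D u ⟧ * (⟦ J u ⟧ * (⟦ not (J v) ⟧ * ⟦ a u v ⟧))
      side₂ : Fin n → Fin n → ℕ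
      side₂ u v = ⟦ D v ⟧ * (⟦ not (J v) ⟧ * (⟦ J u ⟧ * ⟦ a v u ⟧))
      -- Every edge uv leaving J has an end in D. If u lies in I, then v lies in C, and it is not in
      -- I because I is contained in J.
      cell : ∀ u v → cross J u v * ⟦ a u v ⟧ ≤ side₁ u v + side₂ u v
      cell u v with J u in Ju | J v in Jv | a u v in auv
      ... | false | _     | _     = z≤n
      ... | true  | true  | _     = z≤n
      ... | true  | false | false = z≤n
      ... | true  | false | true with I u in Iu
      ...   | false rewrite J⊆C u Ju = s≤s z≤n
      ...   | true  rewrite N⊆C u v Iu auv | symm v u | auv with I v in Iv
      ...     | false = m≤n+m 1 _
      ...     | true  = contradiction (I⊆J v Iv) (false≢true Jv)
      -- A vertex of D in J has more than h neighbours in J, hence at most d - h - 1 ≤ h outside;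
      -- one not in J has at most h in J because the process has stopped.
      per-vertex : ∀ v → ⟦ D v ⟧ * (⟦ J v ⟧ * degreeInto (not ∘ J) v) + ⟦ D v ⟧ * (⟦ not (J v) ⟧ * degreeInto J v) ≤ ⟦ D v ⟧ * h
      per-vertex v with C v in Cv | I v in Iv | J v in Jv
      ... | false | _     | _     = z≤n
      ... | true  | true  | _     = z≤n
      ... | true  | false | true  = linarith (1 * (1 * degreeInto (not ∘ J) v) + 1 * (0 * degreeInto J v)) (1 * h) 0
              (added v Jv Iv ⊕ ≤-reflexive (degreeInto-not J v) ⊕ d≤2h+1) (e (degreeInto J v) (degreeInto (not ∘ J) v) h d)
        where
        e : ∀ i o h d → 1 * (1 * o) + 1 * (0 * i) + (i + (d + suc (2 * h))) + 0 ≡ 1 * h + (suc h + (i + o + d))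
        e = solve-∀
      ... | true  | false | false = linarith (1 * (0 * degreeInto (not ∘ J) v) + 1 * (1 * degreeInto J v)) (1 * h) 0
              (stable v Cv Jv) (e (degreeInto J v) (degreeInto (not ∘ J) v) h)
        where
        e : ∀ i o h → 1 * (0 * o) + 1 * (1 * i) + h + 0 ≡ 1 * h + i
        e = solve-∀
      upper : boundary a J ≤ h * size D
      upper = begin
        boundary a J
          ≤⟨ ∑-mono (λ u → ∑-mono (cell u)) ⟩
        ∑ (λ u → ∑ (λ v → side₁ u v + side₂ u v))
          ≡⟨ trans (∑-cong λ u → ∑-+ (side₁ u) (side₂ u)) (trans (∑-+ _ _) (cong₂ _+_ (∑-cong λ u → pull ⟦ D u ⟧ ⟦ J u ⟧ _)
               (trans (∑-swap side₂) (∑-cong λ v → pull ⟦ D v ⟧ ⟦ not (J v) ⟧ _)))) ⟩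
        ∑ (λ v → ⟦ D v ⟧ * (⟦ J v ⟧ * degreeInto (not ∘ J) v)) + ∑ (λ v → ⟦ D v ⟧ * (⟦ not (J v) ⟧ * degreeInto J v))
          ≡⟨ ∑-+ _ _ ⟨
        ∑ (λ v → ⟦ D v ⟧ * (⟦ J v ⟧ * degreeInto (not ∘ J) v) + ⟦ D v ⟧ * (⟦ not (J v) ⟧ * degreeInto J v))
          ≤⟨ ∑-mono per-vertex ⟩
        ∑ (λ v → ⟦ D v ⟧ * h)
          ≡⟨ trans (∑-*ʳ h _) (*-comm (size D) h) ⟩
        h * size D ∎
        where
        open ≤-Reasoning
        pull : ∀ x y (f : Fin n → ℕ) → ∑ (λ v → x * (y * f v)) ≡ x * (y * ∑ f)
        pull x y f = trans (∑-*ˡ x _) (cong (x *_) (∑-*ˡ y f))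

  -- If two labels occurred, the class of one and its complement would be closed under adjacency.
  -- Each would contain a vertex with all its neighbours, hence at least four vertices, and the cut
  -- between them would be empty.
  expander-connected : {A : Set} (_≟ₐ_ : (x y : A) → Dec (x ≡ y)) (ℓ : Fin n → A) →
    (∀ u v → a u v ≡ true → ℓ u ≡ ℓ v) → ∀ u v → ℓ u ≡ ℓ v
  expander-connected _≟ₐ_ ℓ constant u v = case ℓ v ≟ₐ ℓ u of λ
    { (yes eq) → sym eq
    ; (no neq) → contradiction (2h<boundary S (≤-trans (s≤s (s≤s z≤n)) 4≤S) (4≤S′ neq)) (<⇒≱ (s≤s (≤-trans (≤-reflexive boundary≡0) z≤n))) }
    where
    S : Fin n → Bool
    S w = does (ℓ w ≟ₐ ℓ u)
    neighbour : ∀ {x y} → a x y ≡ true → S x ≡ S y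
    neighbour axy = cong (λ c → does (c ≟ₐ ℓ u)) (constant _ _ axy)
    4≤S : 4 ≤ size S
    4≤S = ≤-trans (s≤s 3≤d) (neighbourhood-size reg Su (λ w auw → trans (sym (neighbour auw)) Su))
      where
      Su : S u ≡ true
      Su = dec-true (ℓ u ≟ₐ ℓ u) refl
    4≤S′ : ℓ v ≢ ℓ u → 4 ≤ size (not ∘ S)
    4≤S′ neq = ≤-trans (s≤s 3≤d) (neighbourhood-size reg Sv (λ w avw → trans (cong not (sym (neighbour avw))) Sv))
      where
      Sv : not (S v) ≡ true
      Sv = not-true (dec-false (ℓ v ≟ₐ ℓ u) neq)
    boundary≡0 : boundary a S ≡ 0
    boundary≡0 = ∑-zero λ x → ∑-zero λ y → cell x y
      where
      cell : ∀ x y → cross S x y * ⟦ a x y ⟧ ≡ 0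
      cell x y with a x y in axy
      ... | false = *-zeroʳ (cross S x y)
      ... | true rewrite neighbour axy with S y
      ...   | true  = refl
      ...   | false = refl

-- Charging the classes of the partitions

charge : ℕ → Bool → ℕ
-- A default value: the class of a vertex contains that vertex.
charge 0 _ = 6
charge 1 _ = 6
charge (suc (suc _)) false = 0
charge 2 true = 3
charge (suc (suc (suc _))) true = 2

fibre : (Fin n → Fin n) → Fin n → Fin n → Bool
fibre ℓ c v = same c (ℓ v)

-- A partition is encoded by a labelling of the vertices by vertices, so its classes are the
-- nonempty fibres; labels that are not attained do not count.
#labels : (Fin n → Fin n) → ℕ
#labels ℓ = ∑ (λ c → ⟦ does (1 ≤? size (fibre ℓ c)) ⟧)

-- If 4 (1 + 384 r d) z < n, the vertices outside a set of z multicoloured ones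
-- are too many to be covered by r sets of at most 384 d z + 3 vertices.
gapConstant : ℕ → ℕ → ℕ
gapConstant r d = 24 * (1 + 384 * r * d)

-- Each class receives a charge of at least 6: from its only vertex, 3 from each
-- of its two vertices, or 2 from each of its multicoloured vertices, that is,
-- those whose class is nontrivial in at least two of the partitions.
module Partitions {d h r : ℕ} {a : Rel n} (reg : Regular d a) (3≤d : 3 ≤ d) (2h≤d : 2 * h ≤ d) (d≤2h+1 : d ≤ suc (2 * h))
         (good : GoodExpander h a) (ℓ : Fin r → Fin n → Fin n)
         (cover : ∀ u v → a u v ≡ true → ∃[ i ] ℓ i u ≡ ℓ i v) where
  open Regular reg

  classSize : Fin r → Fin n → ℕ
  classSize i v = size (fibre (ℓ i) (ℓ i v))

  nontrivial : Fin r → Fin n → Bool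
  nontrivial i v = does (2 ≤? classSize i v)

  multicoloured : Fin n → Bool
  multicoloured v = does (2 ≤? ∑ (λ i → ⟦ nontrivial i v ⟧))

  peers : Fin r → Fin n → ℕ
  peers i v = ∑ (λ u → ⟦ same (ℓ i v) (ℓ i u) ⟧ * ⟦ not (same u v) ⟧)

  classSize-peers : ∀ i v → classSize i v ≡ suc (peers i v)
  classSize-peers i v = trans (∑-cong split) (trans (∑-+ _ _) (trans (cong (peers i v +_)
    (trans (∑-δ v (λ u → ⟦ same (ℓ i v) (ℓ i u) ⟧)) (cong ⟦_⟧ (same-refl (ℓ i v))))) (+-comm _ 1)))
    where
    split : ∀ u → ⟦ same (ℓ i v) (ℓ i u) ⟧ ≡ ⟦ same (ℓ i v) (ℓ i u) ⟧ * ⟦ not (same u v) ⟧ + ⟦ same u v ⟧ * ⟦ same (ℓ i v) (ℓ i u) ⟧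
    split u with same (ℓ i v) (ℓ i u) | same u v
    ... | true  | true  = refl
    ... | true  | false = refl
    ... | false | true  = refl
    ... | false | false = refl

  degree≤peers : ∀ v → d ≤ ∑ (λ i → peers i v)
  degree≤peers v = begin
    d                                ≡⟨ degree v ⟨
    ∑ (λ u → ⟦ a v u ⟧)              ≤⟨ ∑-mono cell ⟩
    ∑ (λ u → ∑ (λ i → ⟦ same (ℓ i v) (ℓ i u) ⟧ * ⟦ not (same u v) ⟧)) ≡⟨ ∑-swap _ ⟩
    ∑ (λ i → peers i v)              ∎
    where
    open ≤-Reasoning
    cell : ∀ u → ⟦ a v u ⟧ ≤ ∑ (λ i → ⟦ same (ℓ i v) (ℓ i u) ⟧ * ⟦ not (same u v) ⟧)
    cell u with a v u in avu
    ... | false = z≤n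
    ... | true with i , eq ← cover v u avu = ≤-trans (≤-reflexive (sym one)) (≤∑ _ i)
      where
      one : ⟦ same (ℓ i v) (ℓ i u) ⟧ * ⟦ not (same u v) ⟧ ≡ 1
      one rewrite eq | same-refl (ℓ i u) | same-≢ {i = u} {v} (adjacent⇒≢ reg avu ∘ sym) = refl

  nontrivial-peers : ∀ i v → 1 ≤ peers i v → nontrivial i v ≡ true
  nontrivial-peers i v p = dec-true (2 ≤? classSize i v) (≤-trans (s≤s p) (≤-reflexive (sym (classSize-peers i v))))

  nontrivial-neighbour : ∀ i u v → a u v ≡ true → ℓ i u ≡ ℓ i v → nontrivial i u ≡ true
  nontrivial-neighbour i u v auv eq = nontrivial-peers i u (≤-trans (≤-reflexive (sym one)) (≤∑ _ v))
    where
    one : ⟦ same (ℓ i u) (ℓ i v) ⟧ * ⟦ not (same v u) ⟧ ≡ 1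
    one rewrite eq | same-refl (ℓ i v) | same-≢ {i = v} {u} (adjacent⇒≢ reg auv ∘ sym) = refl

  someNontrivial : ∀ v → ∃[ i ] nontrivial i v ≡ true
  someNontrivial v with i , p ← ∑-pos (λ i → peers i v) (≤-trans (≤-trans (s≤s z≤n) 3≤d) (degree≤peers v)) =
    i , nontrivial-peers i v p

  uniqueNontrivial : ∀ {v} → multicoloured v ≡ false → ∀ {i j} → nontrivial i v ≡ true → nontrivial j v ≡ true → i ≡ j
  uniqueNontrivial {v} Zv {i} {j} p q = case i Fin.≟ j of λ
    { (yes i≡j) → i≡j
    ; (no i≢j)  → contradiction (dec-true (2 ≤? ∑ (λ i → ⟦ nontrivial i v ⟧)) (two i≢j)) (false≢true Zv) }
    where
    two : i ≢ j → 2 ≤ ∑ (λ k → ⟦ nontrivial k v ⟧)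
    two i≢j = ≤-trans (≤-reflexive (sym (trans (∑-+ _ _) (cong₂ _+_ (∑-same i) (∑-same j))))) (∑-mono cell)
      where
      cell : ∀ k → ⟦ same k i ⟧ + ⟦ same k j ⟧ ≤ ⟦ nontrivial k v ⟧
      cell k with same k i in ki | same k j in kj
      ... | true  | true  = contradiction (trans (sym (same⇒≡ ki)) (same⇒≡ kj)) i≢j
      ... | true  | false rewrite same⇒≡ ki | p = ≤-refl
      ... | false | true  rewrite same⇒≡ kj | q = ≤-refl
      ... | false | false = z≤n

  -- For fixed i, the vertices whose only nontrivial partition is the i-th one.
  simple : Fin r → Fin n → Bool
  simple i v = nontrivial i v ∧ not (multicoloured v)

  module _ (i : Fin r) (5≤labels : 5 ≤ #labels (ℓ i)) where

    private
      C : Fin n → Fin n → Bool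
      C c = fibre (ℓ i) c

      Z I : Fin n → Fin n → Bool
      Z c v = C c v ∧ multicoloured v
      I c v = C c v ∧ not (multicoloured v)

    sum-fibres : ∀ (f : Fin n → Fin n → ℕ) → ∑ (λ c → ∑ (λ v → ⟦ C c v ⟧ * f c v)) ≡ ∑ (λ v → f (ℓ i v) v)
    sum-fibres f = trans (∑-swap _) (∑-cong λ v → ∑-δ (ℓ i v) (λ c → f c v))

    -- Each of the at least four other labels in use claims a vertex outside the class.
    fibre-complement : ∀ c → 4 ≤ size (not ∘ C c)
    fibre-complement c = linarith 4 (size (not ∘ C c)) 0 (5≤labels ⊕ counted ⊕ ≤-reflexive (sym (size+size-not (C c))))
      (e (#labels (ℓ i)) (size (C c)) (size (not ∘ C c)) n)
      where
      e : ∀ p s s′ n → 4 + (p + (n + 1 + (s + s′))) + 0 ≡ s′ + (5 + (p + s + n))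
      e = solve-∀
      counted : #labels (ℓ i) + size (C c) ≤ n + 1
      counted = begin
        #labels (ℓ i) + size (C c)
          ≡⟨ cong (#labels (ℓ i) +_) (∑-δ c (λ c′ → size (C c′))) ⟨
        #labels (ℓ i) + ∑ (λ c′ → ⟦ same c′ c ⟧ * size (C c′))
          ≡⟨ ∑-+ _ _ ⟨
        ∑ (λ c′ → ⟦ does (1 ≤? size (C c′)) ⟧ + ⟦ same c′ c ⟧ * size (C c′))
          ≤⟨ ∑-mono (λ c′ → cell c′) ⟩
        ∑ (λ c′ → size (C c′) + ⟦ same c′ c ⟧)
          ≡⟨ trans (∑-+ _ _) (cong₂ _+_ total (∑-same c)) ⟩
        n + 1 ∎
        where
        open ≤-Reasoning
        total : ∑ (λ c′ → size (C c′)) ≡ n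
        total = trans (∑-cong λ c′ → ∑-cong λ v → sym (*-identityʳ _)) (trans (sum-fibres (λ _ _ → 1))
          (trans (∑-const n 1) (*-identityʳ n)))
        indicator≤ : ∀ m → ⟦ does (1 ≤? m) ⟧ ≤ m
        indicator≤ zero    = z≤n
        indicator≤ (suc m) = s≤s z≤n
        cell : ∀ c′ → ⟦ does (1 ≤? size (C c′)) ⟧ + ⟦ same c′ c ⟧ * size (C c′) ≤ size (C c′) + ⟦ same c′ c ⟧
        cell c′ with same c′ c
        ... | true  = ≤-trans (≤-reflexive (+-comm _ (1 * size (C c′)))) (≤-reflexive (*-identityˡ (size (C c′))) ⊕ ⟦⟧≤1 (does (1 ≤? size (C c′))))
        ... | false = ≤-trans (≤-reflexive (+-identityʳ _)) (≤-trans (indicator≤ (size (C c′))) (m≤m+n _ 0))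

    Z+I : ∀ c → size (Z c) + size (I c) ≡ size (C c)
    Z+I c = trans (sym (∑-+ _ _)) (∑-cong λ v → table (C c v) (multicoloured v))
      where
      table : ∀ b z → ⟦ b ∧ z ⟧ + ⟦ b ∧ not z ⟧ ≡ ⟦ b ⟧
      table true  z = ⟦⟧+⟦not⟧ z
      table false z = refl

    fibre-nontrivial : ∀ c v → 2 ≤ size (C c) → C c v ≡ true → nontrivial i v ≡ true
    fibre-nontrivial c v 2≤ Cv = dec-true (2 ≤? classSize i v) (subst (λ c → 2 ≤ size (C c)) (same⇒≡ Cv) 2≤)

    -- The partition covering the edge uv is nontrivial at u. As u is not multicoloured, that
    -- partition is the i-th, so v lies in the same class.
    closed-neighbourhood : ∀ c → 2 ≤ size (C c) → ∀ u v → I c u ≡ true → a u v ≡ true → C c v ≡ true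
    closed-neighbourhood c 2≤ u v Iu auv with j , eq ← cover u v auv =
      trans (cong₂ same (same⇒≡ Cu) (sym (trans (cong (λ k → ℓ k u) (sym j≡i)) (trans eq (cong (λ k → ℓ k v) j≡i))))) (same-refl (ℓ i u))
      where
      Cu : C c u ≡ true
      Cu = proj₁ (∧-true _ _ Iu)
      j≡i : j ≡ i
      j≡i = uniqueNontrivial (not-false (proj₂ (∧-true (C c u) _ Iu))) (nontrivial-neighbour j u v auv eq) (fibre-nontrivial c u 2≤ Cu)

    -- The multicoloured vertices of the class separate its other vertices from the rest of the
    -- graph. An interior vertex brings in its whole neighbourhood, so if at most two vertices were
    -- multicoloured, at least two would be interior and `no-small-separator` would apply.
    interior⇒many : ∀ c → 2 ≤ size (C c) → 1 ≤ size (I c) → 3 ≤ size (Z c)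
    interior⇒many c 2≤ 1≤I with 3 ≤? size (Z c)
    ... | yes 3≤Z = 3≤Z
    ... | no  3≰Z = contradiction
      (≤-trans (no-small-separator {h = h} reg 3≤d 2h≤d d≤2h+1 good (I c) (C c) (λ v e → proj₁ (∧-true _ _ e)) (closed-neighbourhood c 2≤) 2≤I (fibre-complement c))
        (size-mono λ v e → D⊆Z v (∧-true (C c v) _ e)))
      3≰Z
      where
      D⊆Z : ∀ v → C c v ≡ true × not (I c v) ≡ true → Z c v ≡ true
      D⊆Z v (p , q) with C c v | multicoloured v
      ... | true | true = refl
      w = proj₁ (size-witness (I c) 1≤I)
      Iw = proj₂ (size-witness (I c) 1≤I)
      4≤C : 4 ≤ size (C c)
      4≤C = ≤-trans (s≤s 3≤d) (neighbourhood-size reg (proj₁ (∧-true _ _ Iw)) (λ v → closed-neighbourhood c 2≤ w v Iw))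
      2≤I : 2 ≤ size (I c)
      2≤I = linarith 2 (size (I c)) 0 (4≤C ⊕ ≤-pred (≰⇒> 3≰Z) ⊕ ≤-reflexive (sym (Z+I c))) (e (size (Z c)) (size (I c)) (size (C c)))
        where
        e : ∀ z i c → 2 + (c + (2 + (z + i))) + 0 ≡ i + (4 + (z + c))
        e = solve-∀

    many-multicoloured : ∀ c → 2 ≤ size (C c) → 3 ≤ size (Z c) ⊎ size (Z c) ≡ size (C c)
    many-multicoloured c 2≤ with size (I c) in eq
    ... | suc _ = inj₁ (interior⇒many c 2≤ (subst (1 ≤_) (sym eq) (s≤s z≤n)))
    ... | zero  = inj₂ (trans (sym (+-identityʳ _)) (trans (cong (size (Z c) +_) (sym eq)) (Z+I c)))

    label-charge : 6 * #labels (ℓ i) ≤ ∑ (λ v → charge (classSize i v) (multicoloured v))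
    label-charge = begin
      6 * #labels (ℓ i)                                              ≡⟨ ∑-*ˡ 6 _ ⟨
      ∑ (λ c → 6 * ⟦ does (1 ≤? size (C c)) ⟧)                       ≤⟨ ∑-mono each ⟩
      ∑ (λ c → ∑ (λ v → ⟦ C c v ⟧ * charge (size (C c)) (multicoloured v))) ≡⟨ sum-fibres _ ⟩
      ∑ (λ v → charge (classSize i v) (multicoloured v))             ∎
      where
      open ≤-Reasoning
      weighted : ∀ c w (f : Bool → ℕ) → f true ≡ w → f false ≡ 0 → ∑ (λ v → ⟦ C c v ⟧ * f (multicoloured v)) ≡ size (Z c) * w
      weighted c w f t₁ t₀ = trans (∑-cong λ v → table (C c v) (multicoloured v)) (∑-*ʳ w _)
        where
        table : ∀ b z → ⟦ b ⟧ * f z ≡ ⟦ b ∧ z ⟧ * w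
        table true  true  = cong (1 *_) t₁
        table true  false = trans (+-identityʳ _) t₀
        table false z     = refl
      each : ∀ c → 6 * ⟦ does (1 ≤? size (C c)) ⟧ ≤ ∑ (λ v → ⟦ C c v ⟧ * charge (size (C c)) (multicoloured v))
      each c with size (C c) in eq
      ... | 0 = z≤n
      ... | 1 = ≤-reflexive (trans (cong (_* 6) (sym eq)) (sym (∑-*ʳ 6 _)))
      ... | suc (suc m) with many-multicoloured c (subst (2 ≤_) (sym eq) (s≤s (s≤s z≤n)))
      ...   | inj₁ 3≤Z with m
      ...     | zero  = contradiction (≤-trans 3≤Z (≤-trans (m≤m+n _ _) (≤-reflexive (trans (Z+I c) eq)))) λ { (s≤s (s≤s ())) }
      ...     | suc _ = ≤-trans (*-monoˡ-≤ 2 3≤Z) (≤-reflexive (sym (weighted c 2 (charge (suc (suc (suc _)))) refl refl)))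
      each c | suc (suc m) | inj₂ Z≡ with m
      ...     | zero  = ≤-trans (≤-reflexive (cong (_* 3) (sym (trans Z≡ eq)))) (≤-reflexive (sym (weighted c 3 (charge 2) refl refl)))
      ...     | suc _ = ≤-trans (*-monoˡ-≤ 2 (≤-trans (s≤s (s≤s (s≤s z≤n))) (≤-reflexive (sym (trans Z≡ eq))))) (≤-reflexive (sym (weighted c 2 (charge (suc (suc (suc _)))) refl refl)))

    -- Every class contains a vertex that is not simple: its only vertex, or one of its
    -- multicoloured ones.
    labels≤non-simple : #labels (ℓ i) ≤ size (not ∘ simple i)
    labels≤non-simple = begin
      #labels (ℓ i)                                        ≤⟨ ∑-mono each ⟩
      ∑ (λ c → ∑ (λ v → ⟦ C c v ⟧ * ⟦ not (simple i v) ⟧))   ≡⟨ sum-fibres (λ _ v → ⟦ not (simple i v) ⟧) ⟩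
      size (not ∘ simple i)                                  ∎
      where
      open ≤-Reasoning
      witness : ∀ c v → C c v ≡ true → simple i v ≡ false → 1 ≤ ∑ (λ v → ⟦ C c v ⟧ * ⟦ not (simple i v) ⟧)
      witness c v Cv sv = ≤-trans (≤-reflexive (sym one)) (≤∑ _ v)
        where
        one : ⟦ C c v ⟧ * ⟦ not (simple i v) ⟧ ≡ 1
        one rewrite Cv | sv = refl
      each : ∀ c → ⟦ does (1 ≤? size (C c)) ⟧ ≤ ∑ (λ v → ⟦ C c v ⟧ * ⟦ not (simple i v) ⟧)
      each c with size (C c) in eq
      ... | 0 = z≤n
      ... | 1 with v , Cv ← size-witness (C c) (≤-reflexive (sym eq)) = witness c v Cv
              (cong (_∧ not (multicoloured v)) (dec-false (2 ≤? classSize i v)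
                (<⇒≱ (s≤s (≤-reflexive (trans (cong (size ∘ C) (sym (same⇒≡ Cv))) eq))))))
      ... | suc (suc m) with v , Zv ← size-witness (Z c) ([ ≤-trans (s≤s z≤n) , (λ Z≡ → ≤-trans (s≤s z≤n) (≤-reflexive (sym (trans Z≡ eq)))) ]′
                                (many-multicoloured c (subst (2 ≤_) (sym eq) (s≤s (s≤s z≤n))))) =
              witness c v (proj₁ (∧-true (C c v) _ Zv)) (trans (cong (λ b → nontrivial i v ∧ not b) (proj₂ (∧-true (C c v) _ Zv))) (Bool.∧-zeroʳ _))

    -- An edge leaving the simple vertices of the i-th partition is covered by that partition, which
    -- is therefore nontrivial at the outer end as well. Only multicolouredness can keep that end
    -- from being simple, and each multicoloured vertex absorbs at most d edges.
    simple-boundary : boundary a (simple i) ≤ d * size multicoloured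
    simple-boundary = begin
      boundary a (simple i)                                      ≤⟨ ∑-mono (λ u → ∑-mono (cell u)) ⟩
      ∑ (λ u → ∑ (λ v → ⟦ multicoloured v ⟧ * ⟦ a v u ⟧))    ≡⟨ ∑-swap _ ⟩
      ∑ (λ v → ∑ (λ u → ⟦ multicoloured v ⟧ * ⟦ a v u ⟧))    ≡⟨ ∑-cong (λ v → trans (∑-*ˡ ⟦ multicoloured v ⟧ _)
                                                                  (trans (cong (⟦ multicoloured v ⟧ *_) (degree v)) (*-comm ⟦ multicoloured v ⟧ d))) ⟩
      ∑ (λ v → d * ⟦ multicoloured v ⟧)                      ≡⟨ ∑-*ˡ d _ ⟩
      d * size multicoloured                                 ∎
      where
      open ≤-Reasoning
      leaves : ∀ u v → simple i u ≡ true → simple i v ≡ false → a u v ≡ true → multicoloured v ≡ true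
      leaves u v su sv auv with multicoloured v in Zv
      ... | true  = refl
      ... | false with j , eq ← cover u v auv = contradiction
            (trans (cong (λ b → nontrivial i v ∧ not b) Zv) (cong (_∧ true)
              (subst (λ k → nontrivial k v ≡ true) j≡i (nontrivial-neighbour j v u (trans (symm v u) auv) (sym eq)))))
            (false≢true (trans (cong (λ b → nontrivial i v ∧ not b) Zv) sv))
        where
        j≡i : j ≡ i
        j≡i = uniqueNontrivial (not-false (proj₂ (∧-true (nontrivial i u) _ su))) (nontrivial-neighbour j u v auv eq) (proj₁ (∧-true (nontrivial i u) _ su))
      cell : ∀ u v → cross (simple i) u v * ⟦ a u v ⟧ ≤ ⟦ multicoloured v ⟧ * ⟦ a v u ⟧
      cell u v with simple i u in su | simple i v in sv | a u v in auv
      ... | false | _     | _     = z≤n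
      ... | true  | true  | _     = z≤n
      ... | true  | false | false = z≤n
      ... | true  | false | true rewrite leaves u v su sv auv | trans (symm v u) auv = ≤-refl

  -- `excess` is what the charge of a class falls short of 6. A vertex outside Z has a nontrivial
  -- class, with excess 6. A multicoloured one has two classes of excess at least 3; one with three
  -- vertices or more raises the total to 7, and if all have at most two, then d ≥ 3 neighbours
  -- force three nontrivial classes.
  vertex-charge : ∀ v → ∑ (λ i → charge (classSize i v) (multicoloured v)) + (6 + ⟦ multicoloured v ⟧) ≤ 6 * r
  vertex-charge v = linarith (∑ (λ i → charge (classSize i v) z) + (6 + ⟦ z ⟧)) (6 * r) 0
    (≤-reflexive total ⊕ lower) (e (∑ (λ i → charge (classSize i v) z)) (∑ (λ i → excess (peers i v) z)) ⟦ z ⟧ r)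
    where
    z = multicoloured v
    e : ∀ c x z r → c + (6 + z) + (6 * r + x) + 0 ≡ 6 * r + (c + x + (6 + z))
    e = solve-∀
    excess : ℕ → Bool → ℕ
    excess zero          _     = 0
    excess (suc _)       false = 6
    excess 1             true  = 3
    excess (suc (suc _)) true  = 4
    charge+excess : ∀ t z → charge (suc t) z + excess t z ≡ 6
    charge+excess zero          true  = refl
    charge+excess zero          false = refl
    charge+excess (suc t)       false = refl
    charge+excess 1             true  = refl
    charge+excess (suc (suc t)) true  = refl
    total : ∑ (λ i → charge (classSize i v) z) + ∑ (λ i → excess (peers i v) z) ≡ 6 * r
    total = trans (sym (∑-+ _ _)) (trans (∑-cong λ i → trans (cong (λ s → charge s z + excess (peers i v) z) (classSize-peers i v)) (charge+excess (peers i v) z))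
      (trans (∑-const r 6) (*-comm r 6)))
    lower : 6 + ⟦ z ⟧ ≤ ∑ (λ i → excess (peers i v) z)
    lower with multicoloured v in Zv
    ... | false with i , p ← ∑-pos (λ i → peers i v) (≤-trans (≤-trans (s≤s z≤n) 3≤d) (degree≤peers v)) =
      ≤-trans (six p) (≤∑ (λ i → excess (peers i v) false) i)
      where
      six : ∀ {t} → 1 ≤ t → 6 ≤ excess t false
      six (s≤s _) = ≤-refl
    ... | true = conclude (1 ≤? ∑ big)
      where
      big : Fin r → ℕ
      big i = ⟦ does (2 ≤? peers i v) ⟧
      count : Fin r → ℕ
      count i = ⟦ nontrivial i v ⟧
      2≤count : 2 ≤ ∑ count
      2≤count = does-true (2 ≤? ∑ count) Zv
      excess≡ : ∀ i → excess (peers i v) true ≡ 3 * count i + big i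
      excess≡ i = trans (table (peers i v)) (cong (λ s → 3 * ⟦ does (2 ≤? s) ⟧ + big i) (sym (classSize-peers i v)))
        where
        table : ∀ t → excess t true ≡ 3 * ⟦ does (2 ≤? suc t) ⟧ + ⟦ does (2 ≤? t) ⟧
        table 0 = refl
        table 1 = refl
        table (suc (suc t)) = refl
      excess-sum : ∑ (λ i → excess (peers i v) true) ≡ 3 * ∑ count + ∑ big
      excess-sum = trans (∑-cong excess≡) (trans (∑-+ _ _) (cong (_+ ∑ big) (∑-*ˡ 3 count)))
      conclude : Dec (1 ≤ ∑ big) → 7 ≤ ∑ (λ i → excess (peers i v) true)
      conclude (yes 1≤big) = ≤-trans (3 ⊗ 2≤count ⊕ 1≤big) (≤-reflexive (sym excess-sum))
      conclude (no 1≰big)  = ≤-trans (≤-trans (m≤m+n 7 2) (3 ⊗ 3≤count)) (≤-trans (m≤m+n _ (∑ big)) (≤-reflexive (sym excess-sum)))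
        where
        few : ∀ i → peers i v ≤ count i
        few i = ≤-trans (table (peers i v) (∑≡0 (n≤0⇒n≡0 (≤-pred (≰⇒> 1≰big))) i))
          (≤-reflexive (cong (λ s → ⟦ does (2 ≤? s) ⟧) (sym (classSize-peers i v))))
          where
          table : ∀ t → ⟦ does (2 ≤? t) ⟧ ≡ 0 → t ≤ ⟦ does (2 ≤? suc t) ⟧
          table 0 _ = z≤n
          table 1 _ = ≤-refl
        3≤count : 3 ≤ ∑ count
        3≤count = ≤-trans 3≤d (≤-trans (degree≤peers v) (∑-mono few))
  simple-cover : n ≤ ∑ (λ i → size (simple i)) + size multicoloured
  simple-cover = begin
    n                                                              ≡⟨ trans (∑-const n 1) (*-identityʳ n) ⟨
    ∑ {n} (λ v → 1)                                                ≤⟨ ∑-mono each ⟩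
    ∑ (λ v → ∑ (λ i → ⟦ simple i v ⟧) + ⟦ multicoloured v ⟧)       ≡⟨ trans (∑-+ _ _) (cong (_+ size multicoloured) (∑-swap _)) ⟩
    ∑ (λ i → size (simple i)) + size multicoloured                 ∎
    where
    open ≤-Reasoning
    each : ∀ v → 1 ≤ ∑ (λ i → ⟦ simple i v ⟧) + ⟦ multicoloured v ⟧
    each v with multicoloured v in Zv
    ... | true  = m≤n+m 1 _
    ... | false with i , nt ← someNontrivial v = ≤-trans (≤-trans (≤-reflexive (sym (cong (λ b → ⟦ b ∧ true ⟧) nt)))
            (≤∑ (λ i → ⟦ nontrivial i v ∧ true ⟧) i)) (m≤m+n _ 0)

  total-charge : (∀ i → 5 ≤ #labels (ℓ i)) → 6 * ∑ (λ i → #labels (ℓ i)) + (6 * n + size multicoloured) ≤ n * (6 * r)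
  total-charge 5≤p = begin
    6 * ∑ (λ i → #labels (ℓ i)) + (6 * n + size multicoloured)
      ≡⟨ cong₂ _+_ (∑-*ˡ 6 _) (trans (∑-+ _ _) (cong (_+ size multicoloured) (trans (∑-const n 6) (*-comm n 6)))) ⟨
    ∑ (λ i → 6 * #labels (ℓ i)) + ∑ (λ v → 6 + ⟦ multicoloured v ⟧)
      ≤⟨ +-monoˡ-≤ _ (∑-mono λ i → label-charge i (5≤p i)) ⟩
    ∑ (λ i → ∑ (λ v → charge (classSize i v) (multicoloured v))) + ∑ (λ v → 6 + ⟦ multicoloured v ⟧)
      ≡⟨ trans (∑-+ _ _) (cong (_+ ∑ (λ v → 6 + ⟦ multicoloured v ⟧)) (∑-swap _)) ⟨
    ∑ (λ v → ∑ (λ i → charge (classSize i v) (multicoloured v)) + (6 + ⟦ multicoloured v ⟧))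
      ≤⟨ ∑-≤const vertex-charge ⟩
    n * (6 * r) ∎
    where open ≤-Reasoning

  private
    K M q z : ℕ
    K = 1 + 384 * r * d
    M = gapConstant r d
    q = 4 * K
    z = size multicoloured

    p : Fin r → ℕ
    p i = #labels (ℓ i)

  -- With denominators cleared, the claim is r (n - p) ≥ (1 + 1 / M) n for some number p of classes:
  -- a forest in one colour with a linear surplus over n / r edges.
  few-labels : 2 ≤ r → 32 + 4 * r ≤ n → ∃[ i ] gapConstant r d * (r * #labels (ℓ i)) + suc (gapConstant r d) * n ≤ gapConstant r d * (r * n)
  few-labels 2≤r n≥ with Fin.any? (λ i → M * (r * p i) + suc M * n ≤? M * (r * n))
  ... | yes found = found
  ... | no none = ⊥-elim (case z * q <? n of λ { (yes few) → few-multicoloured few ; (no many) → many-multicoloured′ (≮⇒≥ many) })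
    where
    -- Such a partition would itself prove the claim: n ≥ 32 gives p i ≤ 3n / 8, and r ≥ 2 and M ≥
    -- 24 suffice for the rest.
    excluded : ∀ i → ¬ (4 * p i ≤ n + 16)
    excluded i 4p≤ = none (i , *-cancelˡ-≤ 8 (linarith (8 * (M * (r * p i) + suc M * n)) (8 * (M * (r * n))) (20 * (r * n))
      (2 ⊗ ((M * r) ⊗ 4p≤) ⊕ (4 * M) ⊗ *-monoˡ-≤ n 2≤r ⊕ (M * r) ⊗ ≤-trans (m≤m+n 32 _) n≥ ⊕ *-monoˡ-≤ (r * n) 24≤M ⊕ 4 ⊗ *-monoˡ-≤ n 2≤r)
      (e M r (p i) n)))
      where
      24≤M : 24 ≤ M
      24≤M = ≤-trans (≤-reflexive (sym (*-identityʳ 24))) (*-monoʳ-≤ 24 (m≤m+n 1 (384 * r * d)))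
      e : ∀ M r p n → 8 * (M * (r * p) + suc M * n)
            + (2 * (M * r * (n + 16)) + (4 * M * (r * n) + (M * r * n + (M * (r * n) + 4 * (r * n))))) + 20 * (r * n)
          ≡ 8 * (M * (r * n)) + (2 * (M * r * (4 * p)) + (4 * M * (2 * n) + (M * r * 32 + (24 * (r * n) + 4 * (2 * n)))))
      e = solve-∀

    5≤p : ∀ i → 5 ≤ p i
    5≤p i = ≰⇒> λ p≤4 → excluded i (≤-trans (4 ⊗ p≤4) (m≤n+m 16 n))

    size≤ : ∀ S → 2 * size S ≤ n → boundary a S ≤ d * z → size S ≤ 384 * (d * z) + 3
    size≤ S 2s≤n b≤ with 4 ≤? size S
    ... | no 4≰s = ≤-trans (≤-pred (≰⇒> 4≰s)) (m≤n+m 3 _)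
    ... | yes 4≤s = linarith (size S) (384 * (d * z) + 3) 4 (s≤ ⊕ 384 ⊗ t<) (e (size S) (size S / 384) (d * z))
      where
      t< : suc (size S / 384) ≤ d * z
      t< = ≤-trans (s≤s (m≤n⊔m (2 * h) (size S / 384))) (≤-trans (good S 4≤s 2s≤n) b≤)
      s≤ : size S ≤ 383 + size S / 384 * 384
      s≤ = ≤-trans (≤-reflexive (m≡m%n+[m/n]*n (size S) 384)) (+-monoˡ-≤ (size S / 384 * 384) (≤-pred (m%n<n (size S) 384)))
      e : ∀ s t x → s + (383 + t * 384 + 384 * x) + 4 ≡ 384 * x + 3 + (s + 384 * suc t)
      e = solve-∀

    -- By expansion each set of simple vertices or its complement is small. A small complement would
    -- leave too few classes, against `excluded`; so all these sets are small, and together with Z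
    -- they cannot cover the graph.
    few-multicoloured : z * q < n → ⊥
    few-multicoloured few = 1+n≰n (linarith (suc n) n 96
      (4 ⊗ ≤-trans simple-cover (+-monoˡ-≤ z (∑-≤const simple≤)) ⊕ few ⊕ 3 ⊗ n≥) (e n r d z))
      where
      e : ∀ n r d z → suc n + (4 * (r * (384 * (d * z) + 3) + z) + (n + 3 * n)) + 96
          ≡ n + (4 * n + (suc (z * (4 * (1 + 384 * r * d))) + 3 * (32 + 4 * r)))
      e = solve-∀
      complement≰ : ∀ i → ¬ (size (not ∘ simple i) ≤ 384 * (d * z) + 3)
      complement≰ i s′≤ = excluded i (linarith (4 * p i) (n + 16) (4 * z + 5)
        (4 ⊗ ≤-trans (labels≤non-simple i (5≤p i)) s′≤ ⊕ few ⊕ 1536 ⊗ *-monoˡ-≤ (d * z) (≤-trans (s≤s z≤n) 2≤r)) (e′ (p i) n r d z))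
        where
        e′ : ∀ p n r d z → 4 * p + (4 * (384 * (d * z) + 3) + (n + 1536 * (r * (d * z)))) + (4 * z + 5)
           ≡ n + 16 + (4 * p + (suc (z * (4 * (1 + 384 * r * d))) + 1536 * (1 * (d * z))))
        e′ = solve-∀
      simple≤ : ∀ i → size (simple i) ≤ 384 * (d * z) + 3
      simple≤ i with 2 * size (simple i) ≤? n
      ... | yes 2s≤n = size≤ (simple i) 2s≤n (simple-boundary i (5≤p i))
      ... | no 2s≰n = contradiction (size≤ (not ∘ simple i) 2s′≤n (≤-trans (≤-reflexive (boundary-not reg (simple i))) (simple-boundary i (5≤p i)))) (complement≰ i)
        where
        2s′≤n : 2 * size (not ∘ simple i) ≤ n
        2s′≤n = linarith (2 * size (not ∘ simple i)) n 1 (≰⇒> 2s≰n ⊕ ≤-reflexive (cong (2 *_) (size+size-not (simple i))))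
          (e″ (size (simple i)) (size (not ∘ simple i)) n)
          where
          e″ : ∀ j j′ n → 2 * j′ + (2 * j + 2 * n) + 1 ≡ n + (suc n + 2 * (j + j′))
          e″ = solve-∀

    -- The negated claims, summed over i, contradict `total-charge` multiplied by q, since M = 6q
    -- and the surplus q z is at least n.
    many-multicoloured′ : n ≤ z * q → ⊥
    many-multicoloured′ n≤zq = <⇒≱ (≤-trans (s≤s z≤n) 2≤r) (linarith r 0 0
      (averaged ⊕ (r * q) ⊗ total-charge 5≤p ⊕ r ⊗ n≤zq) (e (∑ p) n r z K))
      where
      averaged : r * suc (M * (r * n)) ≤ M * (r * ∑ p) + r * (suc M * n)
      averaged = begin
        r * suc (M * (r * n))                              ≤⟨ ∑-≥const (λ i → ≰⇒> λ p≤ → none (i , p≤)) ⟩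
        ∑ (λ i → M * (r * p i) + suc M * n)                ≡⟨ trans (∑-+ _ _) (cong₂ _+_ (trans (∑-*ˡ M _) (cong (M *_) (∑-*ˡ r p))) (∑-const r (suc M * n))) ⟩
        M * (r * ∑ p) + r * (suc M * n)                    ∎
        where open ≤-Reasoning
      e : ∀ x n r z K → r + (24 * K * (r * x) + r * (suc (24 * K) * n) + (r * (4 * K) * (n * (6 * r)) + r * (z * (4 * K)))) + 0
        ≡ 0 + (r * suc (24 * K * (r * n)) + (r * (4 * K) * (6 * x + (6 * n + z)) + r * n))
      e = solve-∀

-- The list of regular graphs as an enumeration

module _ {A : Set} where

  unique⇒lookup-injective : {xs : List A} → Unique xs → ∀ {i j} → List.lookup xs i ≡ List.lookup xs j → i ≡ j
  unique⇒lookup-injective (_ ∷ _)   {zero}  {zero}  _  = refl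
  unique⇒lookup-injective (x∉ ∷ _)  {zero}  {suc j} eq = contradiction eq (All.lookup x∉ (∈-lookup j))
  unique⇒lookup-injective (x∉ ∷ _)  {suc i} {zero}  eq = contradiction (sym eq) (All.lookup x∉ (∈-lookup i))
  unique⇒lookup-injective (_ ∷ uxs) {suc i} {suc j} eq = cong suc (unique⇒lookup-injective uxs eq)

  ∈-vectors : {xs : List A} → (∀ x → x ∈ₗ xs) → (v : Vec A n) → v ∈ₗ vectors xs n
  ∈-vectors all []      = here refl
  ∈-vectors all (x ∷ v) = ∈-cartesianProductWith⁺ _∷_ (all x) (∈-vectors all v)

  vectors-unique : {xs : List A} → Unique xs → ∀ n → Unique (vectors xs n)
  vectors-unique u zero    = [] ∷ []
  vectors-unique u (suc n) = Unique.cartesianProductWith⁺ _∷_ Vec.∷-injective u (vectors-unique u n)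

  filter-length : {P : A → Set} (P? : Decidable₁ P) (xs : List A) →
    length (filter P? xs) ≡ ∑ {length xs} (λ i → ⟦ does (P? (List.lookup xs i)) ⟧)
  filter-length P? []       = sym (∑-empty _)
  filter-length P? (x ∷ xs) with does (P? x) in eq
  ... | true  = trans (cong suc (filter-length P? xs)) (sym (trans (∑-suc _) (cong (λ b → ⟦ b ⟧ + ∑ (λ i → ⟦ does (P? (List.lookup xs i)) ⟧)) eq)))
  ... | false = trans (filter-length P? xs) (sym (trans (∑-suc _) (cong (λ b → ⟦ b ⟧ + ∑ (λ i → ⟦ does (P? (List.lookup xs i)) ⟧)) eq)))

∈-subsets : (S : Subset n) → S ∈ₗ subsets n
∈-subsets = ∈-vectors λ { true → here refl ; false → there (here refl) }

subsets-unique : ∀ n → Unique (subsets n)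
subsets-unique = vectors-unique (((λ ()) ∷ []) ∷ [] ∷ [])

lookup-ext : {A : Set} {v w : Vec A n} → (∀ i → lookup v i ≡ lookup w i) → v ≡ w
lookup-ext {v = v} {w} eq = trans (sym (Vec.tabulate∘lookup v)) (trans (Vec.tabulate-cong eq) (Vec.tabulate∘lookup w))

adjacency : Adjacency n → Rel n
adjacency G u v = lookup (neighbours G u) v

matrix : Rel n → Adjacency n
matrix a = tabulate λ u → tabulate (a u)

adjacency-matrix : (a : Rel n) → ∀ u v → adjacency (matrix a) u v ≡ a u v
adjacency-matrix a u v = trans (cong (λ row → lookup row v) (Vec.lookup∘tabulate _ u)) (Vec.lookup∘tabulate (a u) v)

isRegular⇒ : ∀ {d} (G : Adjacency n) → IsRegular d G → Regular d (adjacency G)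
isRegular⇒ G ((loopless , symmetric) , degree) = record
  { symm   = λ u v → ≡-from-⇔ (edge-symm u v) (edge-symm v u)
  ; irrefl = λ u → no-loop u (adjacency G u u) refl
  ; degree = λ u → trans (sym (card-∑ (neighbours G u))) (degree u)
  }
  where
  edge-symm : ∀ u v → adjacency G u v ≡ true → adjacency G v u ≡ true
  edge-symm u v e = Vec.[]=⇒lookup (symmetric v u (Vec.lookup⇒[]= v (neighbours G u) e))
  ≡-from-⇔ : ∀ {b c} → (b ≡ true → c ≡ true) → (c ≡ true → b ≡ true) → b ≡ c
  ≡-from-⇔ {true}  {c}     f g = sym (f refl)
  ≡-from-⇔ {false} {false} f g = refl
  ≡-from-⇔ {false} {true}  f g = g refl
  no-loop : ∀ u b → adjacency G u u ≡ b → b ≡ false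
  no-loop u false _ = refl
  no-loop u true  e = contradiction (Vec.lookup⇒[]= u (neighbours G u) e) (loopless u)

⇒isRegular : ∀ {d} (G : Adjacency n) → Regular d (adjacency G) → IsRegular d G
⇒isRegular G reg =
  ((λ u u∈ → false≢true (irrefl u) (Vec.[]=⇒lookup u∈)) ,
   (λ u v u∈ → Vec.lookup⇒[]= v (neighbours G u) (trans (symm u v) (Vec.[]=⇒lookup u∈)))) ,
  (λ u → trans (card-∑ (neighbours G u)) (degree u))
  where open Regular reg

regular-cong : ∀ {d} {a b : Rel n} → (∀ u v → a u v ≡ b u v) → Regular d a → Regular d b
regular-cong eq reg = record
  { symm   = λ u v → trans (sym (eq u v)) (trans (symm u v) (eq v u))
  ; irrefl = λ u → trans (sym (eq u u)) (irrefl u)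
  ; degree = λ u → trans (∑-cong λ v → cong ⟦_⟧ (sym (eq u v))) (degree u)
  }
  where open Regular reg

∈-regularGraphs : ∀ {d} {a : Rel n} → Regular d a → matrix a ∈ₗ regularGraphs n d
∈-regularGraphs {n} {d} {a} reg = ∈-filter⁺ (isRegular? d) (∈-vectors ∈-subsets (matrix a))
  (⇒isRegular (matrix a) (regular-cong (λ u v → sym (adjacency-matrix a u v)) reg))

enumeration : ∀ n d → Enumeration d (λ i → adjacency (List.lookup (regularGraphs n d) i))
enumeration n d = record
  { regular  = λ i → isRegular⇒ (List.lookup (regularGraphs n d) i) (proj₂ (∈-filter⁻ (isRegular? d) {xs = vectors (subsets n) n} (∈-lookup i)))
  ; complete = λ {a} reg → Any.index (∈-regularGraphs reg) ,
      λ u v → trans (cong (λ G → adjacency G u v) (sym (Any.lookup-index (∈-regularGraphs reg)))) (adjacency-matrix a u v)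
  ; distinct = λ eq → unique⇒lookup-injective (Unique.filter⁺ (isRegular? d) (vectors-unique (subsets-unique n) n))
      (lookup-ext λ u → lookup-ext λ v → eq u v)
  }

-- Spanning trees

module _ {_~_ : Fin n → Fin n → Set} where

  path-suffix : ∀ {u w v p} → IsPath _~_ w v p → u ∈ₗ p → ∃ (IsPath _~_ u v)
  path-suffix {p = x ∷ p} path (here refl) = x ∷ p , proj₁ path , proj₁ (proj₂ path) , refl , proj₂ (proj₂ (proj₂ path))
  path-suffix {p = x ∷ []} path (there ())
  path-suffix {p = x ∷ y ∷ p} (_ ∷ unique , _ ∷ linked , _ , end) (there u∈) = path-suffix (unique , linked , refl , end) u∈

  -- Built from the end of the walk: if the new first vertex already lies on the path, the path is
  -- cut back to start there.
  walk⇒path : ∀ {u v} → Star _~_ u v → ∃ (IsPath _~_ u v)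
  walk⇒path {u} Star.ε = u ∷ [] , [] ∷ [] , [-] , refl , refl
  walk⇒path {u} (u~w ◅ walk) with walk⇒path walk
  ... | x ∷ p , path@(unique , linked , start , end) with u ∈? x ∷ p
    where open DecMembership Fin._≟_ using (_∈?_)
  ...   | yes u∈ = path-suffix path u∈
  ...   | no u∉ with refl ← just-injective start =
          u ∷ x ∷ p , All.¬Any⇒All¬ (x ∷ p) u∉ ∷ unique , u~w ∷ linked , refl , end

module Kruskal (G : Adjacency n) where

  private
    E = ∣E G ∣

  src tgt : Fin E → Fin n
  src e = proj₁ (List.lookup (edges G) e)
  tgt e = proj₂ (List.lookup (edges G) e)

  edge-of : ∀ {u v} → (∀ w → adjacency G w w ≡ false) → (∀ u v → adjacency G u v ≡ adjacency G v u) →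
    adjacency G u v ≡ true → ∃[ e ] Joins G e u v
  edge-of {u} {v} irrefl symm uv = case Fin.<-cmp u v of λ
    { (tri< u<v _ _) → ordered u<v uv (λ eq → inj₁ eq)
    ; (tri≈ _ refl _) → contradiction uv (false≢true (irrefl u))
    ; (tri> _ _ v<u) → ordered v<u (trans (symm v u) uv) (λ eq → inj₂ eq) }
    where
    ordered : ∀ {x y} → x Fin.< y → adjacency G x y ≡ true →
      (∀ {e} → List.lookup (edges G) e ≡ (x , y) → Joins G e u v) → ∃[ e ] Joins G e u v
    ordered {x} {y} x<y xy joins = Any.index xy∈ , joins (sym (Any.lookup-index xy∈))
      where
      xy∈ : (x , y) ∈ₗ edges G
      xy∈ = ∈-filter⁺ (λ (u , v) → (u Fin.<? v) ×-dec (v Subset.∈? neighbours G u))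
        (∈-cartesianProduct⁺ (∈-allFin x) (∈-allFin y)) (x<y , Vec.lookup⇒[]= y (neighbours G x) xy)

  joins-ends : ∀ e → Joins G e (src e) (tgt e)
  joins-ends e = inj₁ refl

  adjacent-sym : ∀ {T u v} → Adjacent G T u v → Adjacent G T v u
  adjacent-sym (e , e∈ , inj₁ eq) = e , e∈ , inj₂ eq
  adjacent-sym (e , e∈ , inj₂ eq) = e , e∈ , inj₁ eq

  joins⇒ : ∀ {A : Set} (β : Fin n → A) {e u v} → Joins G e u v → β (src e) ≡ β (tgt e) → β u ≡ β v
  joins⇒ β (inj₁ eq) same rewrite eq = same
  joins⇒ β (inj₂ eq) same rewrite eq = sym same

  -- Every edge of a forest is a bridge, certified by a 2-colouring of the
  -- vertices that is constant across all other edges.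
  record Forest (T : EdgeSet G) (ℓ : Fin n → Fin n) : Set where
    field
      respects : ∀ e → lookup T e ≡ true → ℓ (src e) ≡ ℓ (tgt e)
      joined   : ∀ u v → ℓ u ≡ ℓ v → Star (Adjacent G T) u v
      bridge   : ∀ e → lookup T e ≡ true → Σ[ β ∈ (Fin n → Bool) ] (β (src e) ≢ β (tgt e) ×
                 (∀ e′ → lookup T e′ ≡ true → e′ ≢ e → β (src e′) ≡ β (tgt e′)))
      counted  : n ≤ #labels ℓ + card T

  joins⇐ : ∀ {A : Set} (β : Fin n → A) {e u v} → Joins G e u v → β u ≡ β v → β (src e) ≡ β (tgt e)
  joins⇐ β (inj₁ eq) same rewrite eq = same
  joins⇐ β (inj₂ eq) same rewrite eq = sym same

  joins-unique : ∀ {e x y u v} → Joins G e x y → Joins G e u v → (u ≡ x × v ≡ y) ⊎ (u ≡ y × v ≡ x)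
  joins-unique (inj₁ p) (inj₁ q) with refl ← trans (sym p) q = inj₁ (refl , refl)
  joins-unique (inj₁ p) (inj₂ q) with refl ← trans (sym p) q = inj₂ (refl , refl)
  joins-unique (inj₂ p) (inj₁ q) with refl ← trans (sym p) q = inj₂ (refl , refl)
  joins-unique (inj₂ p) (inj₂ q) with refl ← trans (sym p) q = inj₁ (refl , refl)

  -- The 2-colouring certifying the edge xy as a bridge is constant along the rest of the cycle,
  -- from y through z back to x, because each of those edges has an end other than x and y. So it
  -- would be constant across xy too.
  forest-acyclic : ∀ {T ℓ} → Forest T ℓ → Acyclic (Adjacent G T)
  forest-acyclic _ ([] , _ , _ , ())
  forest-acyclic _ (_ ∷ [] , _ , _ , s≤s ())
  forest-acyclic _ (_ ∷ _ ∷ [] , _ , _ , s≤s (s≤s ()))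
  forest-acyclic {T} forest (x ∷ y ∷ z ∷ c , ((x≢y ∷ x≢z ∷ x∉c) ∷ (y≢z ∷ y∉c) ∷ _) , (e , e∈ , xy) ∷ yz ∷ linked , _) =
    proj₁ (proj₂ e-bridge) (joins⇐ β xy (sym (trans
      (step yz [ (λ (y≡x , _) → x≢y (sym y≡x)) , (λ (_ , z≡x) → x≢z (sym z≡x)) ]′) (along c x≢z x∉c y≢z y∉c linked))))
    where
    open Forest forest
    e-bridge = bridge e (Vec.[]=⇒lookup e∈)
    β = proj₁ e-bridge
    step : ∀ {u v} → Adjacent G T u v → ¬ ((u ≡ x × v ≡ y) ⊎ (u ≡ y × v ≡ x)) → β u ≡ β v
    step (e′ , e′∈ , uv) other = case e′ Fin.≟ e of λ
      { (yes refl) → contradiction (joins-unique {e = e} xy uv) other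
      ; (no e′≢e)  → joins⇒ β uv (proj₂ (proj₂ e-bridge) e′ (Vec.[]=⇒lookup e′∈) e′≢e) }
    along : ∀ c {w} → x ≢ w → All (x ≢_) c → y ≢ w → All (y ≢_) c → Linked (Adjacent G T) (w ∷ c ++ x ∷ []) → β w ≡ β x
    along [] x≢w _ y≢w _ (wx ∷ _) =
      step wx [ (λ (w≡x , _) → x≢w (sym w≡x)) , (λ (w≡y , _) → y≢w (sym w≡y)) ]′
    along (v ∷ c) x≢w (x≢v ∷ x∉c) y≢w (y≢v ∷ y∉c) (wv ∷ linked) = trans
      (step wv [ (λ (w≡x , _) → x≢w (sym w≡x)) , (λ (w≡y , _) → y≢w (sym w≡y)) ]′) (along c x≢v x∉c y≢v y∉c linked)

  emptyForest : Forest (Vec.replicate E false) id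
  emptyForest = record
    { respects = λ e e∈ → contradiction e∈ (false≢true (Vec.lookup-replicate e false))
    ; joined   = λ { u v refl → Star.ε }
    ; bridge   = λ e e∈ → contradiction e∈ (false≢true (Vec.lookup-replicate e false))
    ; counted  = ≤-trans (≤-reflexive (sym (trans (∑-cong singleton) (trans (∑-const n 1) (*-identityʳ n))))) (m≤m+n _ _)
    }
    where
    singleton : ∀ c → ⟦ does (1 ≤? size (fibre id c)) ⟧ ≡ 1
    singleton c = cong ⟦_⟧ (dec-true (1 ≤? size (fibre id c)) (size-positive (fibre id c) c (same-refl c)))

  insert : Fin E → EdgeSet G → EdgeSet G
  insert e T = tabulate λ f → lookup T f ∨ same f e

  lookup-insert : ∀ e T f → lookup (insert e T) f ≡ lookup T f ∨ same f e
  lookup-insert e T f = Vec.lookup∘tabulate _ f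

  insert-⊇ : ∀ e T f → lookup T f ≡ true → lookup (insert e T) f ≡ true
  insert-⊇ e T f f∈ = trans (lookup-insert e T f) (cong (_∨ same f e) f∈)

  insert-self : ∀ e T → lookup (insert e T) e ≡ true
  insert-self e T = trans (lookup-insert e T e) (trans (cong (lookup T e ∨_) (same-refl e)) (Bool.∨-zeroʳ _))

  insert-cases : ∀ e T f → lookup (insert e T) f ≡ true → lookup T f ≡ true ⊎ f ≡ e
  insert-cases e T f f∈ with lookup T f | trans (sym (lookup-insert e T f)) f∈
  ... | true  | _ = inj₁ refl
  ... | false | p = inj₂ (same⇒≡ p)

  module Merge {T : EdgeSet G} {ℓ : Fin n → Fin n} (forest : Forest T ℓ) (e : Fin E) (e-new : ℓ (src e) ≢ ℓ (tgt e)) where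
    open Forest forest

    private
      T′ = insert e T

    moved : Fin n → Bool
    moved w = same (ℓ w) (ℓ (src e))

    ℓ′ : Fin n → Fin n
    ℓ′ w = if moved w then ℓ (tgt e) else ℓ w

    moved-src : moved (src e) ≡ true
    moved-src = same-refl (ℓ (src e))

    moved-tgt : moved (tgt e) ≡ false
    moved-tgt = same-≢ (e-new ∘ sym)

    ℓ′-coarser : ∀ u v → ℓ u ≡ ℓ v → ℓ′ u ≡ ℓ′ v
    ℓ′-coarser u v eq = cong (λ c → if same c (ℓ (src e)) then ℓ (tgt e) else c) eq

    ℓ′-e : ℓ′ (src e) ≡ ℓ′ (tgt e)
    ℓ′-e rewrite moved-src | moved-tgt = refl

    e∉T : lookup T e ≡ false
    e∉T with lookup T e in eq
    ... | false = refl
    ... | true  = contradiction (respects e eq) e-new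

    lift : ∀ {u v} → Star (Adjacent G T) u v → Star (Adjacent G T′) u v
    lift = Star.map λ (f , f∈ , uv) → f , Vec.lookup⇒[]= f T′ (insert-⊇ e T f (Vec.[]=⇒lookup f∈)) , uv

    crossing : Star (Adjacent G T′) (src e) (tgt e)
    crossing = (e , Vec.lookup⇒[]= e T′ (insert-self e T) , joins-ends e) ◅ Star.ε

    joined′ : ∀ u v → ℓ′ u ≡ ℓ′ v → Star (Adjacent G T′) u v
    joined′ u v eq with moved u in mu | moved v in mv
    ... | true  | true  = lift (joined u v (trans (same⇒≡ mu) (sym (same⇒≡ mv))))
    ... | false | false = lift (joined u v eq)
    ... | true  | false = lift (joined u (src e) (same⇒≡ mu)) ◅◅ crossing ◅◅ lift (joined (tgt e) v eq)
    ... | false | true  = lift (joined u (tgt e) eq) ◅◅ Star.reverse adjacent-sym crossing ◅◅ lift (joined (src e) v (sym (same⇒≡ mv)))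

    moved-respects : ∀ f → lookup T f ≡ true → moved (src f) ≡ moved (tgt f)
    moved-respects f f∈ = cong (λ c → same c (ℓ (src e))) (respects f f∈)

    -- The new edge is certified by the class of its source. An old certificate may fail to be
    -- constant across the new edge; adding that class to it modulo 2 repairs this and changes
    -- nothing on old edges, which do not leave the class.
    bridge′ : ∀ f → lookup T′ f ≡ true → Σ[ β ∈ (Fin n → Bool) ] (β (src f) ≢ β (tgt f) ×
                 (∀ f′ → lookup T′ f′ ≡ true → f′ ≢ f → β (src f′) ≡ β (tgt f′)))
    bridge′ f f∈ with insert-cases e T f f∈
    ... | inj₂ refl = moved , (λ eq → false≢true moved-tgt (trans (sym eq) moved-src)) ,
          λ f′ f′∈ f′≢e → [ moved-respects f′ , (λ f′≡e → contradiction f′≡e f′≢e) ]′ (insert-cases e T f′ f′∈)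
    ... | inj₁ f∈T with bridge f f∈T
    ...   | β , separates , preserved with β (src e) Bool.≟ β (tgt e)
    ...     | yes level = β , separates ,
              λ f′ f′∈ f′≢f → [ (λ f′∈T → preserved f′ f′∈T f′≢f) , (λ { refl → level }) ]′ (insert-cases e T f′ f′∈)
    ...     | no uneven = (λ w → β w xor moved w) ,
              (λ eq → separates (xor-cancel (moved-respects f f∈T) eq)) ,
              λ f′ f′∈ f′≢f → [ (λ f′∈T → cong₂ _xor_ (preserved f′ f′∈T f′≢f) (moved-respects f′ f′∈T)) , (λ { refl → flipped }) ]′ (insert-cases e T f′ f′∈)
      where
      xor-cancel : ∀ {b c x y} → x ≡ y → b xor x ≡ c xor y → b ≡ c
      xor-cancel {true}  {true}  _ _ = refl
      xor-cancel {false} {false} _ _ = refl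
      xor-cancel {true}  {false} {true}  refl ()
      xor-cancel {true}  {false} {false} refl ()
      xor-cancel {false} {true}  {true}  refl ()
      xor-cancel {false} {true}  {false} refl ()
      flipped : β (src e) xor moved (src e) ≡ β (tgt e) xor moved (tgt e)
      flipped rewrite moved-src | moved-tgt = flip (β (src e)) (β (tgt e)) uneven
        where
        flip : ∀ b c → b ≢ c → b xor true ≡ c xor false
        flip true  true  b≢c = contradiction refl b≢c
        flip true  false b≢c = refl
        flip false true  b≢c = refl
        flip false false b≢c = contradiction refl b≢c

    -- Only the label of the source of e can disappear.
    labels′ : #labels ℓ ≤ #labels ℓ′ + 1
    labels′ = begin
      #labels ℓ                                                                    ≤⟨ ∑-mono each ⟩
      ∑ (λ c → ⟦ does (1 ≤? size (fibre ℓ′ c)) ⟧ + ⟦ same c (ℓ (src e)) ⟧)         ≡⟨ ∑-+ _ _ ⟩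
      #labels ℓ′ + ∑ (λ c → ⟦ same c (ℓ (src e)) ⟧)                                ≡⟨ cong (#labels ℓ′ +_) (∑-same (ℓ (src e))) ⟩
      #labels ℓ′ + 1                                                               ∎
      where
      open ≤-Reasoning
      each : ∀ c → ⟦ does (1 ≤? size (fibre ℓ c)) ⟧ ≤ ⟦ does (1 ≤? size (fibre ℓ′ c)) ⟧ + ⟦ same c (ℓ (src e)) ⟧
      each c with same c (ℓ (src e)) in eq
      ... | true  = ≤-trans (⟦⟧≤1 (does (1 ≤? size (fibre ℓ c)))) (m≤n+m 1 _)
      ... | false = ≤-trans (⟦⟧-mono λ nonempty → dec-true (1 ≤? size (fibre ℓ′ c)) (persists (does-true (1 ≤? size (fibre ℓ c)) nonempty))) (m≤m+n _ 0)
        where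
        persists : 1 ≤ size (fibre ℓ c) → 1 ≤ size (fibre ℓ′ c)
        persists 1≤ with w , cw ← size-witness (fibre ℓ c) 1≤ = size-positive (fibre ℓ′ c) w
          (trans (cong (λ b → same c (if b then ℓ (tgt e) else ℓ w)) unmoved) cw)
          where
          unmoved : moved w ≡ false
          unmoved = trans (cong (λ x → same x (ℓ (src e))) (sym (same⇒≡ cw))) eq

    card′ : card T′ ≡ suc (card T)
    card′ = trans (card-∑ T′) (trans (∑-cong λ f → cong ⟦_⟧ (lookup-insert e T f))
      (trans (size-insert (lookup T) e∉T) (cong suc (sym (card-∑ T)))))

    merged : Forest T′ ℓ′
    merged = record
      { respects = λ f f∈ → [ (λ f∈T → ℓ′-coarser _ _ (respects f f∈T)) , (λ { refl → ℓ′-e }) ]′ (insert-cases e T f f∈)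
      ; joined   = joined′
      ; bridge   = bridge′
      ; counted  = linarith n (#labels ℓ′ + card T′) 0 (counted ⊕ labels′ ⊕ ≤-reflexive (sym card′)) (arith n (#labels ℓ) (#labels ℓ′) (card T) (card T′))
      }
      where
      arith : ∀ n l l′ t t′ → n + (l + t + (l′ + 1 + t′)) + 0 ≡ l′ + t′ + (n + (l + suc t))
      arith = solve-∀

  -- The outcome of one pass over a list of edges. In the pass over one colour `onlyNew` shows that
  -- the forest has that colour only; in the pass over all edges `extends` shows that this forest
  -- survives and `processed` that the result is spanning.
  record Extension (T : EdgeSet G) (ℓ : Fin n → Fin n) (L : List (Fin E)) : Set where
    field
      {T⁺}      : EdgeSet G
      {ℓ⁺}      : Fin n → Fin n
      forest    : Forest T⁺ ℓ⁺
      extends   : ∀ e → lookup T e ≡ true → lookup T⁺ e ≡ true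
      coarser   : ∀ u v → ℓ u ≡ ℓ v → ℓ⁺ u ≡ ℓ⁺ v
      processed : ∀ e → e ∈ₗ L → ℓ⁺ (src e) ≡ ℓ⁺ (tgt e)
      onlyNew   : ∀ e → lookup T⁺ e ≡ true → lookup T e ≡ true ⊎ e ∈ₗ L

  extend : ∀ {T ℓ} → Forest T ℓ → ∀ L → Extension T ℓ L
  extend forest [] = record
    { forest = forest ; extends = λ _ p → p ; coarser = λ _ _ p → p ; processed = λ _ () ; onlyNew = λ _ p → inj₁ p }
  extend {T} {ℓ} forest (e ∷ L) with ℓ (src e) Fin.≟ ℓ (tgt e)
  ... | yes level = record
    { forest    = X.forest
    ; extends   = X.extends
    ; coarser   = X.coarser
    ; processed = λ { f (here refl) → X.coarser _ _ level ; f (there f∈) → X.processed f f∈ }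
    ; onlyNew   = λ f f∈ → [ inj₁ , inj₂ ∘ there ]′ (X.onlyNew f f∈)
    }
    where module X = Extension (extend forest L)
  ... | no e-new = record
    { forest    = X.forest
    ; extends   = λ f f∈ → X.extends f (insert-⊇ e T f f∈)
    ; coarser   = λ u v eq → X.coarser u v (ℓ′-coarser u v eq)
    ; processed = λ { f (here refl) → X.coarser _ _ ℓ′-e ; f (there f∈) → X.processed f f∈ }
    ; onlyNew   = λ f f∈ → [ (λ f∈′ → [ inj₁ , inj₂ ∘ here ]′ (insert-cases e T f f∈′)) , inj₂ ∘ there ]′ (X.onlyNew f f∈)
    }
    where
    open Merge forest e e-new
    module X = Extension (extend merged L)

  forest-spanning : ∀ {T ℓ} → Forest T ℓ → (∀ u v → ℓ u ≡ ℓ v) → IsSpanningTree G T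
  forest-spanning forest const = (λ u v → walk⇒path (Forest.joined forest u v (const u v))) , forest-acyclic forest

  record MonochromaticTree {r} (f : Colouring r G) (i : Fin r) : Set where
    field
      tree         : EdgeSet G
      label        : Fin n → Fin n
      spanning     : IsSpanningTree G tree
      monochrome   : ∀ e → lookup f e ≡ i → label (src e) ≡ label (tgt e)
      enough       : n ≤ #labels label + card (colourClass G f i ∩ tree)

  -- Kruskal's algorithm, run on the edges of colour i first.
  monochromaticTree : (∀ (ℓ : Fin n → Fin n) → (∀ e → ℓ (src e) ≡ ℓ (tgt e)) → ∀ u v → ℓ u ≡ ℓ v) →
    ∀ {r} (f : Colouring r G) i → MonochromaticTree f i
  monochromaticTree connected {r} f i = record
    { tree       = X₂.T⁺
    ; label      = X₁.ℓ⁺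
    ; spanning   = forest-spanning X₂.forest (connected X₂.ℓ⁺ λ e → X₂.processed e (∈-allFin e))
    ; monochrome = λ e e≡i → X₁.processed e (∈-filter⁺ coloured? (∈-allFin e) e≡i)
    -- The forest of the first pass has n minus its number of labels edges, all of colour i and all
    -- kept in the tree.
    ; enough     = ≤-trans (Forest.counted X₁.forest) (+-monoʳ-≤ _ (≤-trans (≤-reflexive (card-∑ X₁.T⁺))
        (≤-trans (∑-mono λ e → ⟦⟧-mono (both e)) (≤-reflexive (sym (card-∑ (colourClass G f i ∩ X₂.T⁺)))))))
    }
    where
    coloured? : Decidable₁ (λ e → lookup f e ≡ i)
    coloured? e = lookup f e Fin.≟ i
    module X₁ = Extension (extend emptyForest (filter coloured? (List.allFin E)))
    module X₂ = Extension (extend X₁.forest (List.allFin E))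
    both : ∀ e → lookup X₁.T⁺ e ≡ true → lookup (colourClass G f i ∩ X₂.T⁺) e ≡ true
    both e e∈ = trans (Vec.lookup-zipWith _∧_ e (colourClass G f i) X₂.T⁺) (cong₂ _∧_
      (trans (Vec.lookup-map e _ f) (dec-true (lookup f e Fin.≟ i) coloured)) (X₂.extends e e∈))
      where
      coloured : lookup f e ≡ i
      coloured = [ (λ e∈∅ → contradiction e∈∅ (false≢true (Vec.lookup-replicate e false)))
                 , (λ e∈L → proj₂ (∈-filter⁻ coloured? {xs = List.allFin E} e∈L)) ]′ (X₁.onlyNew e e∈)

-- From edge counts to the rational discrepancy

toℚᵘ-/ : ∀ i n .{{_ : NonZero n}} → ℚ.toℚᵘ (i ℚ./ n) ℚᵘ.≃ (i ℚᵘ./ n)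
toℚᵘ-/ i (suc n) = ℚ.toℚᵘ-fromℚᵘ (mkℚᵘ i n)

-- The factor r cancels the denominator, so the discrepancy is the integer rL - (n - 1) and can be
-- bounded by integer arithmetic.
discrepancy-formula : ∀ r .{{_ : NonZero r}} L X →
  (ℤ.+ r ℚ./ 1) ℚ.* ((ℤ.+ L ℚ./ 1) ℚ.- (X ℚ./ r)) ≡ (ℤ.+ (r * L) ℤ.- X) ℚ./ 1
discrepancy-formula r@(suc r′) L X = ℚ.toℚᵘ-injective (begin
  ℚ.toℚᵘ ((ℤ.+ r ℚ./ 1) ℚ.* ((ℤ.+ L ℚ./ 1) ℚ.- (X ℚ./ r)))
    ≈⟨ ℚ.toℚᵘ-homo-* (ℤ.+ r ℚ./ 1) _ ⟩
  ℚ.toℚᵘ (ℤ.+ r ℚ./ 1) ℚᵘ.* ℚ.toℚᵘ ((ℤ.+ L ℚ./ 1) ℚ.- (X ℚ./ r))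
    ≈⟨ ℚᵘ.*-cong (toℚᵘ-/ (ℤ.+ r) 1) (ℚᵘ.≃-trans (ℚ.toℚᵘ-homo-+ (ℤ.+ L ℚ./ 1) _)
         (ℚᵘ.+-cong (toℚᵘ-/ (ℤ.+ L) 1) (ℚᵘ.≃-trans (ℚ.toℚᵘ-homo‿- (X ℚ./ r)) (ℚᵘ.-‿cong (toℚᵘ-/ X r))))) ⟩
  mkℚᵘ (ℤ.+ r) 0 ℚᵘ.* (mkℚᵘ (ℤ.+ L) 0 ℚᵘ.- mkℚᵘ X r′)
    ≈⟨ *≡* (trans (identity (ℤ.+ r) (ℤ.+ L) X) (cong₂ (λ a b → (a ℤ.- X) ℤ.* b) (sym (ℤ.pos-* r L)) (cong ℤ.+_ (sym (trans (*-identityˡ _) (*-identityˡ r)))))) ⟩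
  mkℚᵘ (ℤ.+ (r * L) ℤ.- X) 0
    ≈⟨ toℚᵘ-/ (ℤ.+ (r * L) ℤ.- X) 1 ⟨
  ℚ.toℚᵘ ((ℤ.+ (r * L) ℤ.- X) ℚ./ 1) ∎)
  where
  open ℚᵘ.≃-Reasoning
  identity : ∀ r L X → r ℤ.* (L ℤ.* r ℤ.+ (ℤ.- X) ℤ.* ℤ.+ 1) ℤ.* ℤ.+ 1 ≡ (r ℤ.* L ℤ.- X) ℤ.* r
  identity = ℤ-Solver.solve-∀

product-/ : ∀ i j m n .{{_ : NonZero m}} .{{_ : NonZero n}} →
  ℚ.toℚᵘ ((i ℚ./ m) ℚ.* (j ℚ./ n)) ℚᵘ.≃ (i ℚᵘ./ m) ℚᵘ.* (j ℚᵘ./ n)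
product-/ i j m n = ℚᵘ.≃-trans (ℚ.toℚᵘ-homo-* (i ℚ./ m) (j ℚ./ n)) (ℚᵘ.*-cong (toℚᵘ-/ i m) (toℚᵘ-/ j n))

fraction-≤ : ∀ n M .{{_ : NonZero M}} D → n ≤ M * D → (ℤ.+ 1 ℚ./ M) ℚ.* (ℤ.+ n ℚ./ 1) ℚ.≤ ℤ.+ D ℚ./ 1
fraction-≤ n M@(suc M′) D n≤MD = ℚ.toℚᵘ-cancel-≤ (ℚᵘ.≤-respˡ-≃ (ℚᵘ.≃-sym (product-/ (ℤ.+ 1) (ℤ.+ n) M 1))
  (ℚᵘ.≤-respʳ-≃ (ℚᵘ.≃-sym (toℚᵘ-/ (ℤ.+ D) 1)) (*≤* (subst₂ ℤ._≤_ lhs rhs (ℤ.+≤+ n≤MD)))))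
  where
  lhs : ℤ.+ n ≡ ℤ.+ 1 ℤ.* ℤ.+ n ℤ.* ℤ.+ 1
  lhs = sym (trans (ℤ.*-identityʳ _) (ℤ.*-identityˡ _))
  rhs : ℤ.+ (M * D) ≡ ℤ.+ D ℤ.* ℤ.+ (M * 1)
  rhs = trans (cong ℤ.+_ (trans (*-comm M D) (cong (D *_) (sym (*-identityʳ M))))) (ℤ.pos-* D (M * 1))

≤-multiple : ∀ n c Z → Z ℤ.≤ ℤ.+ (c * n) → Z ℚ./ 1 ℚ.≤ (ℤ.+ c ℚ./ 1) ℚ.* (ℤ.+ n ℚ./ 1)
≤-multiple n c Z Z≤ = ℚ.toℚᵘ-cancel-≤ (ℚᵘ.≤-respˡ-≃ (ℚᵘ.≃-sym (toℚᵘ-/ Z 1))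
  (ℚᵘ.≤-respʳ-≃ (ℚᵘ.≃-sym (product-/ (ℤ.+ c) (ℤ.+ n) 1 1)) (*≤* (subst₂ ℤ._≤_ (sym (ℤ.*-identityʳ Z)) (sym (trans (ℤ.*-identityʳ _) (sym (ℤ.pos-* c n)))) Z≤))))

-- For ε > 0 in lowest terms e / D, it suffices that m / N < 1 / D.
nearOne : ∀ {ε} → 0ℚ ℚ.< ε → ∀ c m N .{{_ : NonZero N}} → c + m ≡ N → m * ℚ.↧ₙ ε < N →
  ℚ.∣ ℤ.+ c ℚ./ N ℚ.- 1ℚ ∣ ℚ.< ε
nearOne {ℚ.mkℚ (ℤ.+ zero) D c≤} (ℚ.*<* (ℤ.+<+ ())) c m N eq m<
nearOne {ℚ.mkℚ (ℤ.-[1+ e ]) D c≤} (ℚ.*<* ()) c m N eq m<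
nearOne {ℚ.mkℚ (ℤ.+ suc e) D _} 0<ε c m N@(suc N′) eq m< = ℚ.toℚᵘ-cancel-< (ℚᵘ.<-respˡ-≃ (ℚᵘ.≃-sym distance)
  (*<* (subst₂ ℤ._<_ (ℤ.pos-* m (suc D)) (ℤ.pos-* (suc e) N) (ℤ.+<+ (≤-trans m< (m≤m+n N (e * N)))))))
  where
  numerator : ℤ.+ c ℤ.* ℤ.+ 1 ℤ.+ ℤ.-[1+ 0 ] ℤ.* ℤ.+ N ≡ ℤ.- ℤ.+ m
  numerator = trans (cong (λ t → ℤ.+ c ℤ.* ℤ.+ 1 ℤ.+ ℤ.-[1+ 0 ] ℤ.* t) (trans (cong ℤ.+_ (sym eq)) (ℤ.pos-+ c m)))
    (cancel (ℤ.+ c) (ℤ.+ m))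
    where
    cancel : ∀ c m → c ℤ.* ℤ.+ 1 ℤ.+ ℤ.-[1+ 0 ] ℤ.* (c ℤ.+ m) ≡ ℤ.- m
    cancel = ℤ-Solver.solve-∀
  distance : ℚ.toℚᵘ ℚ.∣ ℤ.+ c ℚ./ N ℚ.- 1ℚ ∣ ℚᵘ.≃ mkℚᵘ (ℤ.+ m) N′
  distance = ℚᵘ.≃-trans (ℚ.toℚᵘ-homo-∣-∣ (ℤ.+ c ℚ./ N ℚ.- 1ℚ))
    (ℚᵘ.≃-trans (ℚᵘ.∣-∣-cong (ℚᵘ.≃-trans (ℚ.toℚᵘ-homo-+ (ℤ.+ c ℚ./ N) (ℚ.- 1ℚ)) (ℚᵘ.+-cong (toℚᵘ-/ (ℤ.+ c) N) (ℚᵘ.≃-refl {mkℚᵘ (ℤ.-[1+ 0 ]) 0}))))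
      (ℚᵘ.≃-reflexive (trans (cong₂ (λ i d → ℚᵘ.∣ mkℚᵘ i d ∣) numerator (*-identityʳ N′)) absolute)))
    where
    absolute : ℚᵘ.∣ mkℚᵘ (ℤ.- ℤ.+ m) N′ ∣ ≡ mkℚᵘ (ℤ.+ m) N′
    absolute = cong (λ t → mkℚᵘ (ℤ.+ t) N′) (ℤ.∣-i∣≡∣i∣ (ℤ.+ m))

private
  module ℚ-Extrema = Data.List.Extrema (DecTotalOrder.totalOrder ℚ.≤-decTotalOrder)

maximum-between : ∀ {A : Set} (g : A → ℚ) (xs : List A) {a b y} → y ∈ₗ xs → a ℚ.≤ g y → (∀ x → g x ℚ.≤ b) →
  ∃[ D ] (maximum (List.map g xs) ≡ just D × (a ℚ.≤ D × D ℚ.≤ b))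
maximum-between g (x ∷ xs) {a} y∈ a≤y ≤b = _ , refl ,
  ℚ-Extrema.v≤max⁺ (g x) (List.map g xs) (reach y∈) ,
  ℚ-Extrema.max≤v⁺ (≤b x) (All.map⁺ (All.universal ≤b xs))
  where
  reach : _ ∈ₗ x ∷ xs → a ℚ.≤ g x ⊎ Any (a ℚ.≤_) (List.map g xs)
  reach (here refl) = inj₁ a≤y
  reach (there y∈)  = inj₂ (Any.map (λ { refl → a≤y }) (∈-map⁺ g y∈))

-- The minimum is one of the values. The element x in front makes the list nonempty, so there is a
-- minimum.
minimum-satisfies : ∀ {A : Set} {P : ℚ → Set} (g : A → Maybe ℚ) x xs →
  (∀ x → ∃[ D ] (g x ≡ just D × P D)) → AnyMaybe P (minimum (List.mapMaybe g (x ∷ xs)))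
minimum-satisfies {A} {P} g x xs all with g x | all x
... | .(just D) | D , refl , PD = just (ℚ-Extrema.argmin-all id PD (rest xs))
  where
  rest : ∀ xs → All P (List.mapMaybe g xs)
  rest [] = []
  rest (x ∷ xs) with g x | all x
  ... | .(just D) | D , refl , PD = PD ∷ rest xs

module _ {d : ℕ} (G : Adjacency n) (regular : Regular d (adjacency G)) where
  open Kruskal G
  open Regular regular

  edges-unique : Unique (edges G)
  edges-unique = Unique.filter⁺ (λ (u , v) → (u Fin.<? v) ×-dec (v Subset.∈? neighbours G u))
    (Unique.cartesianProduct⁺ (Unique.allFin⁺ n) (Unique.allFin⁺ n))

  edge-adjacent : ∀ e → adjacency G (src e) (tgt e) ≡ true
  edge-adjacent e = Vec.[]=⇒lookup (proj₂ (proj₂ (∈-filter⁻ (λ (u , v) → (u Fin.<? v) ×-dec (v Subset.∈? neighbours G u))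
    {xs = List.cartesianProduct (List.allFin n) (List.allFin n)} (∈-lookup e))))

  ∣E∣≤ : ∣E G ∣ ≤ d * n
  ∣E∣≤ = begin
    ∣E G ∣
      ≡⟨ trans (∑-const ∣E G ∣ 1) (*-identityʳ ∣E G ∣) ⟨
    ∑ {∣E G ∣} (λ e → 1)
      ≡⟨ ∑-cong (λ e → trans (sym (∑-same (src e))) (∑-cong λ u → trans (sym (*-identityʳ _))
           (trans (cong (⟦ same u (src e) ⟧ *_) (sym (∑-same (tgt e)))) (sym (∑-*ˡ ⟦ same u (src e) ⟧ _))))) ⟩
    ∑ (λ e → ∑ (λ u → ∑ (λ v → ⟦ same u (src e) ⟧ * ⟦ same v (tgt e) ⟧)))
      ≡⟨ trans (∑-swap _) (∑-cong λ u → ∑-swap _) ⟩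
    ∑ (λ u → ∑ (λ v → ∑ (λ e → ⟦ same u (src e) ⟧ * ⟦ same v (tgt e) ⟧)))
      ≤⟨ ∑-mono (λ u → ∑-mono λ v → at u v) ⟩
    ∑ (λ u → ∑ (λ v → ⟦ adjacency G u v ⟧))
      ≡⟨ trans (∑-cong degree) (trans (∑-const n d) (*-comm n d)) ⟩
    d * n ∎
    where
    open ≤-Reasoning
    at : ∀ u v → ∑ (λ e → ⟦ same u (src e) ⟧ * ⟦ same v (tgt e) ⟧) ≤ ⟦ adjacency G u v ⟧
    at u v with adjacency G u v in uv
    ... | true  = ≤-trans (≤-reflexive (∑-cong λ e → sym (⟦∧⟧ (same u (src e)) (same v (tgt e)))))
        (∑-atMostOne _ λ e e′ p p′ → unique⇒lookup-injective edges-unique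
          (cong₂ _,_ (trans (sym (same⇒≡ (proj₁ (∧-true _ _ p)))) (same⇒≡ (proj₁ (∧-true _ _ p′))))
                     (trans (sym (same⇒≡ (proj₂ (∧-true (same u (src e)) _ p)))) (same⇒≡ (proj₂ (∧-true (same u (src e′)) _ p′))))))
    ... | false = ≤-reflexive (∑-zero λ e → trans (sym (⟦∧⟧ (same u (src e)) (same v (tgt e)))) (none e))
      where
      none : ∀ e → ⟦ same u (src e) ∧ same v (tgt e) ⟧ ≡ 0
      none e with same u (src e) in p | same v (tgt e) in q
      ... | true  | true  = contradiction (trans (cong₂ (adjacency G) (same⇒≡ p) (same⇒≡ q)) (edge-adjacent e)) (false≢true uv)
      ... | true  | false = refl
      ... | false | _     = refl

  module _ {r} (f : Colouring r G) (T : EdgeSet G) where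

    class≤largest : ∀ i → card (colourClass G f i ∩ T) ≤ largestClass G f T
    class≤largest i = All.lookup (ℕ-Extrema.xs≤max 0 (List.map (λ i → card (colourClass G f i ∩ T)) (List.allFin r))) (∈-map⁺ _ (∈-allFin i))

    largest≤ : largestClass G f T ≤ d * n
    largest≤ = ≤-trans (ℕ-Extrema.max≤v⁺ z≤n (All.map⁺ (All.universal (λ i → Subset.∣p∣≤n (colourClass G f i ∩ T)) (List.allFin r)))) ∣E∣≤

    treeDiscrepancy-upper : .{{_ : NonZero r}} → 1 ≤ n → treeDiscrepancy G f T ℚ.≤ (ℤ.+ (r * d) ℚ./ 1) ℚ.* (ℤ.+ n ℚ./ 1)
    treeDiscrepancy-upper 1≤n = subst (ℚ._≤ (ℤ.+ (r * d) ℚ./ 1) ℚ.* (ℤ.+ n ℚ./ 1)) (sym (discrepancy-formula r (largestClass G f T) (ℤ.+ n ℤ.- ℤ.+ 1)))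
      (≤-multiple n (r * d) (ℤ.+ (r * largestClass G f T) ℤ.- (ℤ.+ n ℤ.- ℤ.+ 1))
        (ℤ.≤-trans (ℤ.i≤j⇒i-k≤j {i = ℤ.+ (r * largestClass G f T)} (ℤ.+ n ℤ.- ℤ.+ 1) {{nonNeg 1≤n}} ℤ.≤-refl)
          (ℤ.+≤+ (≤-trans (*-monoʳ-≤ r largest≤) (≤-reflexive (sym (*-assoc r d n)))))))
      where
      nonNeg : ∀ {m} → 1 ≤ m → ℤ.NonNegative (ℤ.+ m ℤ.- ℤ.+ 1)
      nonNeg (s≤s _) = _

    -- Here p is the number of classes left by the edges of colour i, so L ≥ n - p, and the gap
    -- turns into M r L ≥ (M + 1) n.
    treeDiscrepancy-lower : .{{_ : NonZero r}} → ∀ i M .{{_ : NonZero M}} p → n ≤ p + card (colourClass G f i ∩ T) →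
      M * (r * p) + suc M * n ≤ M * (r * n) →
      (ℤ.+ 1 ℚ./ M) ℚ.* (ℤ.+ n ℚ./ 1) ℚ.≤ treeDiscrepancy G f T
    treeDiscrepancy-lower i M p n≤ gap = subst ((ℤ.+ 1 ℚ./ M) ℚ.* (ℤ.+ n ℚ./ 1) ℚ.≤_)
      (trans (cong (ℚ._/ 1) D≡) (sym (discrepancy-formula r L (ℤ.+ n ℤ.- ℤ.+ 1))))
      (fraction-≤ n M D n≤MD)
      where
      L D : ℕ
      L = largestClass G f T
      gain : suc M * n ≤ M * (r * L)
      gain = linarith (suc M * n) (M * (r * L)) 0 (gap ⊕ (M * r) ⊗ ≤-trans n≤ (+-monoʳ-≤ p (class≤largest i))) (e M r n p L)
        where
        e : ∀ M r n p L → suc M * n + (M * (r * n) + M * r * (p + L)) + 0 ≡ M * (r * L) + (M * (r * p) + suc M * n + M * r * n)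
        e = solve-∀
      n≤rL : n ≤ r * L
      n≤rL = *-cancelˡ-≤ M (≤-trans (m≤n+m (M * n) n) gain)
      D = r * L ∸ n + 1
      n≤MD : n ≤ M * D
      n≤MD = linarith n (M * D) M (gain ⊕ M ⊗ ≤-reflexive (sym (m+[n∸m]≡n n≤rL))) (e M n (r * L) (r * L ∸ n))
        where
        e : ∀ M n x y → n + (M * x + M * (n + y)) + M ≡ M * (y + 1) + (suc M * n + M * x)
        e = solve-∀
      D≡ : ℤ.+ D ≡ ℤ.+ (r * L) ℤ.- (ℤ.+ n ℤ.- ℤ.+ 1)
      D≡ = trans (ℤ.pos-+ (r * L ∸ n) 1) (trans (e (ℤ.+ (r * L ∸ n)) (ℤ.+ n))
        (cong (λ t → t ℤ.- (ℤ.+ n ℤ.- ℤ.+ 1)) (trans (sym (ℤ.pos-+ n (r * L ∸ n))) (cong ℤ.+_ (m+[n∸m]≡n n≤rL)))))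
        where
        e : ∀ x n → x ℤ.+ ℤ.+ 1 ≡ n ℤ.+ x ℤ.- (n ℤ.- ℤ.+ 1)
        e = ℤ-Solver.solve-∀

  discrepancyBetween : ∀ {h} r .{{_ : NonZero r}} → 3 ≤ d → 2 * h ≤ d → d ≤ suc (2 * h) → GoodExpander h (adjacency G) →
    2 ≤ r → 32 + 4 * r ≤ n → .{{_ : NonZero (gapConstant r d)}} →
    DiscrepancyBetween r (ℤ.+ 1 ℚ./ gapConstant r d) (ℤ.+ (r * d) ℚ./ 1) G
  discrepancyBetween {h} r@(suc r′) 3≤d 2h≤d d≤2h+1 good 2≤r n≥ = result (colourings r G) (∈-vectors ∈-allFin (Vec.replicate ∣E G ∣ zero))
    where
    c₁ c₂ : ℚ
    c₁ = ℤ.+ 1 ℚ./ gapConstant r d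
    c₂ = ℤ.+ (r * d) ℚ./ 1
    best : Colouring r G → Maybe ℚ
    best f = maximum (List.map (treeDiscrepancy G f) (spanningTrees G))
    between : ∀ f → ∃[ D ] (best f ≡ just D × (c₁ ℚ.* (ℤ.+ n ℚ./ 1) ℚ.≤ D × D ℚ.≤ c₂ ℚ.* (ℤ.+ n ℚ./ 1)))
    between f = maximum-between (treeDiscrepancy G f) (spanningTrees G)
      (∈-filter⁺ (λ T → isTree? (adjacent? G T)) (∈-subsets tree) spanning)
      (treeDiscrepancy-lower f tree i (gapConstant r d) (#labels label) enough (proj₂ few))
      (λ T → treeDiscrepancy-upper f T (≤-trans (s≤s z≤n) n≥))
      where
      trees : ∀ i → MonochromaticTree f i
      trees = monochromaticTree (λ ℓ constant → expander-connected {h = h} regular 3≤d 2h≤d d≤2h+1 good Fin._≟_ ℓ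
        λ u v uv → let e , j = edge-of irrefl symm uv in joins⇒ ℓ j (constant e)) f
      few = Partitions.few-labels {h = h} regular 3≤d 2h≤d d≤2h+1 good (λ i → MonochromaticTree.label (trees i))
        (λ u v uv → let e , j = edge-of irrefl symm uv in
          lookup f e , joins⇒ (MonochromaticTree.label (trees (lookup f e))) j (MonochromaticTree.monochrome (trees (lookup f e)) e refl))
        2≤r n≥
      i = proj₁ few
      open MonochromaticTree (trees i)
    result : ∀ fs {f} → f ∈ₗ fs → AnyMaybe (λ D → c₁ ℚ.* (ℤ.+ n ℚ./ 1) ℚ.≤ D × D ℚ.≤ c₂ ℚ.* (ℤ.+ n ℚ./ 1)) (minimum (List.mapMaybe best fs))
    result (f ∷ fs) _ = minimum-satisfies best f fs between

-- Existence of regular graphs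

module Circulant (χ : ℕ → Bool) where

  circulant : Rel n
  circulant u v = χ ∣ toℕ u - toℕ v ∣

  countUpTo : ℕ → ℕ
  countUpTo zero    = 0
  countUpTo (suc k) = countUpTo k + ⟦ χ (suc k) ⟧

  ∑-last : ∀ (f : ℕ → ℕ) k → ∑ {suc k} (λ i → f (toℕ i)) ≡ ∑ {k} (λ i → f (toℕ i)) + f k
  ∑-last f zero    = trans (∑-suc _) (trans (+-comm (f 0) _) (cong (_+ f 0) (trans (∑-empty _) (sym (∑-empty _)))))
  ∑-last f (suc k) = trans (∑-suc _) (trans (cong (f 0 +_) (∑-last (f ∘ suc) k))
    (trans (sym (+-assoc (f 0) _ _)) (cong (_+ f (suc k)) (sym (∑-suc _)))))

  countUpTo-∑ : ∀ k → ∑ {k} (λ i → ⟦ χ (suc (toℕ i)) ⟧) ≡ countUpTo k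
  countUpTo-∑ zero    = ∑-empty _
  countUpTo-∑ (suc k) = trans (∑-last (λ i → ⟦ χ (suc i) ⟧) k) (cong (_+ ⟦ χ (suc k) ⟧) (countUpTo-∑ k))

  -- Row k has k entries left of the diagonal, at distances k down to 1, then the diagonal, then l
  -- entries at distances 1 to l.
  row-count : ∀ k l → ∑ {k + suc l} (λ v → ⟦ χ ∣ k - toℕ v ∣ ⟧) ≡ countUpTo k + (⟦ χ 0 ⟧ + countUpTo l)
  row-count zero    l = trans (∑-suc _) (cong (⟦ χ 0 ⟧ +_) (countUpTo-∑ l))
  row-count (suc k) l = trans (∑-suc _) (trans (cong (⟦ χ (suc k) ⟧ +_) (row-count k l))
    (trans (sym (+-assoc ⟦ χ (suc k) ⟧ _ _)) (cong (_+ (⟦ χ 0 ⟧ + countUpTo l)) (+-comm ⟦ χ (suc k) ⟧ (countUpTo k)))))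

  module _ {m} (symmetric : ∀ i j → suc i + suc j ≡ suc m → χ (suc i) ≡ χ (suc j)) where

    countUpTo-const : ∀ k l → k + l ≡ m → countUpTo k + countUpTo l ≡ countUpTo m
    countUpTo-const zero    l refl = refl
    countUpTo-const (suc k) l eq = trans (trans (+-assoc (countUpTo k) _ _) (cong (countUpTo k +_)
        (trans (+-comm ⟦ χ (suc k) ⟧ (countUpTo l)) (cong (λ b → countUpTo l + ⟦ b ⟧) (symmetric k l (trans (cong suc (+-suc k l)) (cong suc eq)))))))
      (countUpTo-const k (suc l) (trans (+-suc k l) eq))

    -- By symmetry of the distance set all rows have the same sum, so the degree may be computed at
    -- whichever splitting k + l = m is most convenient.
    circulant-regular : ∀ {d} k l → k + l ≡ m → countUpTo k + countUpTo l ≡ d → χ 0 ≡ false → Regular d (circulant {suc m})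
    circulant-regular {d} k l k+l≡m count≡d χ0 = record
      { symm   = λ u v → cong χ (∣-∣-comm (toℕ u) (toℕ v))
      ; irrefl = λ u → trans (cong χ (∣n-n∣≡0 (toℕ u))) χ0
      ; degree = degree
      }
      where
      degree : ∀ u → ∑ (λ v → ⟦ circulant {suc m} u v ⟧) ≡ d
      degree u = begin
        ∑ {suc m} (λ v → ⟦ χ ∣ toℕ u - toℕ v ∣ ⟧)
          ≡⟨ cong (λ m → ∑ {m} (λ v → ⟦ χ ∣ toℕ u - toℕ v ∣ ⟧)) (trans (+-suc (toℕ u) l′) (cong suc u+l′)) ⟨
        ∑ {toℕ u + suc l′} (λ v → ⟦ χ ∣ toℕ u - toℕ v ∣ ⟧)
          ≡⟨ row-count (toℕ u) l′ ⟩
        countUpTo (toℕ u) + (⟦ χ 0 ⟧ + countUpTo l′)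
          ≡⟨ cong (λ b → countUpTo (toℕ u) + (⟦ b ⟧ + countUpTo l′)) χ0 ⟩
        countUpTo (toℕ u) + countUpTo l′
          ≡⟨ trans (countUpTo-const (toℕ u) l′ u+l′) (sym (countUpTo-const k l k+l≡m)) ⟩
        countUpTo k + countUpTo l
          ≡⟨ count≡d ⟩
        d ∎
        where
        open ≡-Reasoning
        l′ = m ∸ toℕ u
        u+l′ : toℕ u + l′ ≡ m
        u+l′ = m+[n∸m]≡n (≤-pred (Fin.toℕ<n u))

  countUpTo-initial : ∀ {h} k → (∀ j → suc j ≤ h → χ (suc j) ≡ true) →
    (∀ j → h < suc j → suc j ≤ k → χ (suc j) ≡ false) → countUpTo k ≡ k ⊓ h
  countUpTo-initial zero    ones zeros = refl
  countUpTo-initial {h} (suc k) ones zeros with suc k ≤? h | countUpTo-initial k ones (λ j h< j≤k → zeros j h< (m≤n⇒m≤1+n j≤k))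
  ... | yes k<h | ih = trans (cong₂ _+_ (trans ih (m≤n⇒m⊓n≡m (<⇒≤ k<h))) (cong ⟦_⟧ (ones k k<h))) (trans (+-comm k 1) (sym (m≤n⇒m⊓n≡m k<h)))
  ... | no  k≮h | ih = trans (cong₂ _+_ (trans ih (m≥n⇒m⊓n≡n (≤-pred (≰⇒> k≮h)))) (cong ⟦_⟧ (zeros k (≰⇒> k≮h) ≤-refl)))
          (trans (+-identityʳ h) (sym (m≥n⇒m⊓n≡n (<⇒≤ (≰⇒> k≮h)))))

-- Cyclic distances at most h, and n / 2 if the degree is to be odd.
distances : (h n : ℕ) → Bool → ℕ → Bool
distances h n antipodal j = does (1 ≤? j) ∧ (does (j ≤? h) ∨ (does (n ≤? j + h) ∨ (antipodal ∧ does (j + j ≟ n))))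

module _ (h n : ℕ) (antipodal : Bool) where

  open Circulant (distances h n antipodal)

  -- Replacing j by n - j exchanges the distances j ≤ h with those n ≤ j + h and fixes the antipodal
  -- one.
  distances-symmetric : ∀ i j → suc i + suc j ≡ n → distances h n antipodal (suc i) ≡ distances h n antipodal (suc j)
  distances-symmetric i j refl = trans
    (cong₂ _∨_ (trans (near i j) (cong (λ m → does (m ≤? suc j + h)) (+-comm (suc j) (suc i)))) (cong₂ _∨_ (sym (near j i))
      (cong (antipodal ∧_) (does-⇔ (mk⇔ to from) (suc i + suc i ≟ suc i + suc j) (suc j + suc j ≟ suc i + suc j)))))
    (exchange (does (suc i + suc j ≤? suc j + h)) (does (suc j ≤? h)) (antipodal ∧ does (suc j + suc j ≟ suc i + suc j)))
    where
    near : ∀ i j → does (suc i ≤? h) ≡ does (suc j + suc i ≤? suc j + h)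
    near i j = does-⇔ (mk⇔ (+-monoʳ-≤ (suc j)) (+-cancelˡ-≤ (suc j) _ _)) (suc i ≤? h) (suc j + suc i ≤? suc j + h)
    to : suc i + suc i ≡ suc i + suc j → suc j + suc j ≡ suc i + suc j
    to eq = cong (_+ suc j) (sym (+-cancelˡ-≡ (suc i) (suc i) (suc j) eq))
    from : suc j + suc j ≡ suc i + suc j → suc i + suc i ≡ suc i + suc j
    from eq = cong (suc i +_) (sym (+-cancelʳ-≡ (suc j) (suc j) (suc i) eq))
    exchange : ∀ a b c → a ∨ (b ∨ c) ≡ b ∨ (a ∨ c)
    exchange true  true  c = refl
    exchange true  false c = refl
    exchange false b     c = refl

  distances-near : ∀ j → suc j ≤ h → distances h n antipodal (suc j) ≡ true
  distances-near j j<h = cong (_∨ (does (n ≤? suc j + h) ∨ (antipodal ∧ does (suc j + suc j ≟ n)))) (dec-true (suc j ≤? h) j<h)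

  distances-far : ∀ j → h < suc j → suc j + h < n → (antipodal ∧ does (suc j + suc j ≟ n)) ≡ false → distances h n antipodal (suc j) ≡ false
  distances-far j h< <n no-antipode = cong₂ _∨_ (dec-false (suc j ≤? h) (<⇒≱ h<)) (cong₂ _∨_ (dec-false (n ≤? suc j + h) (<⇒≱ <n)) no-antipode)

half : ∀ d → ∃[ h ] (d ≡ 2 * h ⊎ d ≡ suc (2 * h))
half zero = 0 , inj₁ refl
half (suc d) with half d
... | h , inj₁ eq = h , inj₂ (cong suc eq)
... | h , inj₂ eq = suc h , inj₁ (trans (cong suc eq) (arith h))
  where
  arith : ∀ h → suc (suc (2 * h)) ≡ 2 * suc h
  arith = solve-∀

-- Needed because `probability` is 0 on the empty list. The graph is a circulant joining each vertex
-- to its h nearest ones on either side and, for odd d, to its antipode.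
regular-exists : ∀ d n → d < n → 2 divides (d * n) → ∃[ a ] Regular {n} d a
regular-exists d n@(suc m) d<n even with half d
... | h , inj₁ refl = _ , circulant-regular (distances-symmetric h n false) h (m ∸ h) h+ counts refl
  where
  open Circulant (distances h n false)
  2h≤m : 2 * h ≤ m
  2h≤m = ≤-pred d<n
  h≤m : h ≤ m
  h≤m = ≤-trans (m≤m+n h _) 2h≤m
  h+ : h + (m ∸ h) ≡ m
  h+ = m+[n∸m]≡n h≤m
  h≤m∸h : h ≤ m ∸ h
  h≤m∸h = +-cancelˡ-≤ h _ _ (≤-trans (≤-reflexive (cong (h +_) (sym (+-identityʳ h)))) (≤-trans 2h≤m (≤-reflexive (sym h+))))
  count : ∀ k → h ≤ k → k ≤ m ∸ h → countUpTo k ≡ h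
  count k h≤k k≤ = trans (countUpTo-initial k (distances-near h n false) (λ j h<j j≤k → distances-far h n false j h<j
      (s≤s (≤-trans (+-monoˡ-≤ h (≤-trans j≤k k≤)) (≤-reflexive (m∸n+n≡m h≤m)))) refl)) (m≥n⇒m⊓n≡n h≤k)
  counts : countUpTo h + countUpTo (m ∸ h) ≡ 2 * h
  counts = trans (cong₂ _+_ (count h ≤-refl h≤m∸h) (count (m ∸ h) h≤m∸h ≤-refl)) (cong (h +_) (sym (+-identityʳ h)))
-- As (2h + 1) n is even, so is n, and every vertex has an antipode.
... | h , inj₂ refl with ∣.divides t n≡ ← ∣m+n∣m⇒∣n {2} {2 * h * n} {n} (subst (2 divides_) (+-comm n (2 * h * n)) even) (∣.divides (h * n) (trans (*-assoc 2 h n) (*-comm 2 (h * n)))) = antipodal t n≡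
  where
  antipodal : ∀ t → n ≡ t * 2 → ∃[ a ] Regular {n} (suc (2 * h)) a
  antipodal (suc t) n≡ = _ , circulant-regular (distances-symmetric h n true) t (suc t) t+ counts refl
    where
    open Circulant (distances h n true)
    m≡ : m ≡ suc (t + t)
    m≡ = suc-injective (trans n≡ (arith′ t))
      where
      arith′ : ∀ t → suc t * 2 ≡ suc (suc (t + t))
      arith′ = solve-∀
    t+ : t + suc t ≡ m
    t+ = trans (+-suc t t) (sym m≡)
    h≤t : h ≤ t
    h≤t = *-cancelˡ-≤ 2 (linarith (2 * h) (2 * t) 0 (≤-pred d<n ⊕ ≤-reflexive m≡) (arith″ h t m))
      where
      arith″ : ∀ h t m → 2 * h + (m + suc (t + t)) + 0 ≡ 2 * t + (suc (2 * h) + m)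
      arith″ = solve-∀
    count : countUpTo t ≡ h
    count = trans (countUpTo-initial t (distances-near h n true) (λ j h<j j≤t → distances-far h n true j h<j
        (s≤s (≤-trans (≤-trans (+-mono-≤ j≤t h≤t) (n≤1+n (t + t))) (≤-reflexive (sym m≡))))
        (dec-false (suc j + suc j ≟ n) λ eq → <⇒≢ (≤-trans (s≤s (≤-trans (+-mono-≤ j≤t j≤t) (n≤1+n (t + t)))) (≤-reflexive (cong suc (sym m≡)))) eq)))
      (m≥n⇒m⊓n≡n h≤t)
    antipode : distances h n true (suc t) ≡ true
    antipode = trans (cong (λ b → does (suc t ≤? h) ∨ (does (n ≤? suc t + h) ∨ b)) (dec-true (suc t + suc t ≟ n) (trans (cong suc (+-suc t t)) (cong suc (sym m≡)))))
      (trans (cong (does (suc t ≤? h) ∨_) (Bool.∨-zeroʳ (does (n ≤? suc t + h)))) (Bool.∨-zeroʳ (does (suc t ≤? h))))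
    counts : countUpTo t + countUpTo (suc t) ≡ suc (2 * h)
    counts = trans (cong₂ _+_ count (cong₂ _+_ count (cong ⟦_⟧ antipode))) (arith‴ h)
      where
      arith‴ : ∀ h → h + (h + 1) ≡ suc (2 * h)
      arith‴ = solve-∀

-- From expansion to high probability

size-cong : {S T : Fin n → Bool} → (∀ u → S u ≡ T u) → size S ≡ size T
size-cong eq = ∑-cong λ u → cong ⟦_⟧ (eq u)

noSparseCuts⇒good : ∀ h (a : Rel n) → sparseCuts h a ≡ 0 → GoodExpander h a
noSparseCuts⇒good {n} h a none S 4≤s 2s≤n = subst₂ (λ s b → threshold h s < b) (size-cong σ≡) boundary≡
  (sparseCut⇒ h a σ (subst (4 ≤_) (sym (size-cong σ≡)) 4≤s) (subst (λ s → 2 * s ≤ n) (sym (size-cong σ≡)) 2s≤n) not-sparse)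
  where
  σ : Fin n → Bool
  σ = lookup (tabulate S)
  σ≡ : ∀ u → σ u ≡ S u
  σ≡ = Vec.lookup∘tabulate S
  boundary≡ : boundary a σ ≡ boundary a S
  boundary≡ = ∑-cong λ u → ∑-cong λ v → cong₂ (λ b c → ⟦ b ⟧ * ⟦ not c ⟧ * ⟦ a u v ⟧) (σ≡ u) (σ≡ v)
  not-sparse : sparseCut h a σ ≡ false
  not-sparse with sparseCut h a σ in eq
  ... | false = refl
  ... | true  = contradiction (≤-trans (≤-reflexive (sym (cong ⟦_⟧ eq))) (≤-trans (≤∑ₛ (λ S → ⟦ sparseCut h a (lookup S) ⟧) (tabulate S)) (≤-reflexive none))) λ ()

probability-nearOne : ∀ {A : Set} {P : A → Set} (P? : Decidable₁ P) {ε} → 0ℚ ℚ.< ε → ∀ xs k → 1 ≤ length xs →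
  length (filter P? xs) + k ≡ length xs → k * ℚ.↧ₙ ε < length xs → ℚ.∣ probability P? xs ℚ.- 1ℚ ∣ ℚ.< ε
probability-nearOne P? 0<ε xs@(_ ∷ _) k _ eq k< = nearOne 0<ε (length (filter P? xs)) k (length xs) eq k<

module _ (r d : ℕ) .{{r≢0 : NonZero r}} (2≤r : 2 ≤ r) (3≤d : 3 ≤ d) where

  private
    instance
      gap≢0 : NonZero (gapConstant r d)
      gap≢0 = _

    h : ℕ
    h = proj₁ (half d)

    2h≤d : 2 * h ≤ d
    2h≤d = [ (λ eq → ≤-reflexive (sym eq)) , (λ eq → ≤-trans (n≤1+n _) (≤-reflexive (sym eq))) ]′ (proj₂ (half d))

    d≤2h+1 : d ≤ suc (2 * h)
    d≤2h+1 = [ (λ eq → ≤-trans (≤-reflexive eq) (n≤1+n _)) , ≤-reflexive ]′ (proj₂ (half d))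

    1≤h : 1 ≤ h
    1≤h = *-cancelˡ-≤ 2 (≤-pred (≤-trans 3≤d d≤2h+1))

    c₁ c₂ : ℚ
    c₁ = ℤ.+ 1 ℚ./ gapConstant r d
    c₂ = ℤ.+ (r * d) ℚ./ 1

    s₀ c : ℕ
    s₀ = 2 * h * 384
    c = s₀ * (suc (2 * h) * (2 ^ (h + s₀) * 2 ^ (h + s₀))) + 6 * (31 * 32)

  -- A graph without sparse cuts has the required discrepancy, so the exceptional graphs number at
  -- most the total of all sparse cuts.
  few-exceptions : ∀ n x → 8 * x + 8 * (d * d) + 4 * d ≤ n → n ≤ 31 * x → 1 ≤ x → 32 + 4 * r ≤ n →
    ∃[ k ] (length (filter (discrepancyBetween? r c₁ c₂) (regularGraphs n d)) + k ≡ length (regularGraphs n d)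
      × k * x ≤ length (regularGraphs n d) * c)
  few-exceptions n x large n≤ 1≤x n≥ = k ,
    trans (cong (_+ k) (filter-length P? gs)) (trans (sym (∑-+ _ _)) (trans (∑-cong λ i → ⟦⟧+⟦not⟧ (holds i)) (trans (∑-const N 1) (*-identityʳ N)))) ,
    ≤-trans (*-monoˡ-≤ x (∑-mono exceptional)) (sparseCuts-total (enumeration n d) {h} {x} 3≤d 1≤h 2h≤d large n≤ 1≤x)
    where
    gs = regularGraphs n d
    N = length gs
    P? = discrepancyBetween? {n} r c₁ c₂
    holds : Fin N → Bool
    holds i = does (P? (List.lookup gs i))
    k : ℕ
    k = ∑ (λ i → ⟦ not (holds i) ⟧)
    exceptional′ : ∀ i t → sparseCuts h (adjacency (List.lookup gs i)) ≡ t → ⟦ not (holds i) ⟧ ≤ t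
    exceptional′ i (suc t) _    = ≤-trans (⟦⟧≤1 (not (holds i))) (s≤s z≤n)
    exceptional′ i zero    none = ≤-reflexive (cong (λ b → ⟦ not b ⟧) (dec-true (P? (List.lookup gs i))
      (discrepancyBetween (List.lookup gs i) (Enumeration.regular (enumeration n d) i) {h} r 3≤d 2h≤d d≤2h+1
        (noSparseCuts⇒good h (adjacency (List.lookup gs i)) none) 2≤r n≥)))
    exceptional : ∀ i → ⟦ not (holds i) ⟧ ≤ sparseCuts h (adjacency (List.lookup gs i))
    exceptional i = exceptional′ i (sparseCuts h (adjacency (List.lookup gs i))) refl

  withHighProbability : WithHighProbability d (λ {n} → discrepancyBetween? {n} r c₁ c₂)
  withHighProbability ε 0<ε = N₀ , λ n N₀≤n even →
    -- Then 8x takes at most half of n, leaving the other half for the terms in d, and n ≤ 16x + 15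
    -- ≤ 31x.
    let x = n / 16
        16x≤n = m/n*n≤m n 16
        n≤16x+15 = ≤-trans (≤-reflexive (m≡m%n+[m/n]*n n 16)) (+-monoˡ-≤ (x * 16) (≤-pred (m%n<n n 16)))
        x> = suc-bound n x n≤16x+15 N₀≤n
        1≤x = ≤-trans (s≤s z≤n) x>
        k , total , few = few-exceptions n x
          (*-cancelˡ-≤ 2 (linarith (2 * (8 * x + 8 * (d * d) + 4 * d)) (2 * n) (16 * (c * D) + 32 + 32 + 4 * r + d) (16x≤n ⊕ N₀≤n) (e₁ x (d * d) d (c * D) r n)))
          (linarith n (31 * x) 0 (n≤16x+15 ⊕ 15 ⊗ 1≤x) (e₂ n x)) 1≤x
          (≤-trans (linarith (32 + 4 * r) N₀ (16 * (c * D) + 32 + 16 * (d * d) + 9 * d) z≤n (e₃ (c * D) (d * d) d r)) N₀≤n)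
        1≤N = nonempty n (≤-trans (linarith (suc d) N₀ (16 * (c * D) + 63 + 4 * r + 16 * (d * d) + 8 * d) z≤n (e₄ (c * D) (d * d) d r)) N₀≤n) even
    in probability-nearOne (discrepancyBetween? {n} r c₁ c₂) 0<ε (regularGraphs n d) k 1≤N total (density k x (length (regularGraphs n d)) 1≤N few x>)
    where
    D N₀ : ℕ
    D = ℚ.↧ₙ ε
    -- The terms 16 c D + 32 give c D < x, so the exceptional fraction, at most c / x, is below 1 /
    -- D ≤ ε. The others ensure n ≥ 32 + 4r, the hypothesis on x, and d < n.
    N₀ = 16 * (c * D) + 32 + (32 + 4 * r) + (16 * (d * d) + 9 * d)
    suc-bound : ∀ n x → n ≤ 15 + x * 16 → N₀ ≤ n → c * D < x
    suc-bound n x n≤ N₀≤n = *-cancelˡ-≤ 16 (linarith (16 * suc (c * D)) (16 * x) (33 + 4 * r + 16 * (d * d) + 9 * d) (n≤ ⊕ N₀≤n) (e (c * D) n x (d * d) d r))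
      where
      e : ∀ y n x dd d r → 16 * suc y + (15 + x * 16 + n) + (33 + 4 * r + 16 * dd + 9 * d) ≡ 16 * x + (n + (16 * y + 32 + (32 + 4 * r) + (16 * dd + 9 * d)))
      e = solve-∀
    e₁ : ∀ x dd d y r n → 2 * (8 * x + 8 * dd + 4 * d) + (n + n) + (16 * y + 32 + 32 + 4 * r + d)
       ≡ 2 * n + (x * 16 + (16 * y + 32 + (32 + 4 * r) + (16 * dd + 9 * d)))
    e₁ = solve-∀
    e₂ : ∀ n x → n + (15 + x * 16 + 15 * x) + 0 ≡ 31 * x + (n + 15 * 1)
    e₂ = solve-∀
    e₃ : ∀ y dd d r → 32 + 4 * r + 0 + (16 * y + 32 + 16 * dd + 9 * d) ≡ 16 * y + 32 + (32 + 4 * r) + (16 * dd + 9 * d) + 0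
    e₃ = solve-∀
    e₄ : ∀ y dd d r → suc d + 0 + (16 * y + 63 + 4 * r + 16 * dd + 8 * d) ≡ 16 * y + 32 + (32 + 4 * r) + (16 * dd + 9 * d) + 0
    e₄ = solve-∀
    nonempty : ∀ n → d < n → 2 divides (d * n) → 1 ≤ length (regularGraphs n d)
    nonempty n d<n even with regularGraphs n d | ∈-regularGraphs (proj₂ (regular-exists d n d<n even))
    ... | _ ∷ _ | _ = s≤s z≤n
    density : ∀ k x N → 1 ≤ N → k * x ≤ N * c → c * D < x → k * D < N
    density k x N 1≤N kx≤ cD<x = *-cancelʳ-< x (k * D) N (begin-strict
      k * D * x       ≡⟨ swap k D x ⟩
      k * x * D       ≤⟨ *-monoˡ-≤ D kx≤ ⟩
      N * c * D       ≡⟨ *-assoc N c D ⟩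
      N * (c * D)     <⟨ *-monoʳ-< N {{>-nonZero 1≤N}} cD<x ⟩
      N * x           ∎)
      where
      open ≤-Reasoning
      swap : ∀ a b c → a * b * c ≡ a * c * b
      swap = solve-∀

  0<c₁ : 0ℚ ℚ.< c₁
  0<c₁ = ℚ.positive⁻¹ c₁ {{ℚ.normalize-pos 1 (gapConstant r d)}}

  0<c₂ : 0ℚ ℚ.< c₂
  0<c₂ = ℚ.positive⁻¹ c₂ {{ℚ.normalize-pos (r * d) 1 {{_}} {{m*n≢0 r d {{r≢0}} {{>-nonZero (≤-trans (s≤s z≤n) 3≤d)}}}}}}

corollary1p5 : ∀ (r d : ℕ) .{{_ : NonZero r}} → 2 ≤ r → 3 ≤ d →
    ∃[ c₁ ] ∃[ c₂ ] (0ℚ ℚ.< c₁ × 0ℚ ℚ.< c₂ ×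
    WithHighProbability d (λ {n} → discrepancyBetween? {n} r c₁ c₂))
corollary1p5 r d 2≤r 3≤d = _ , _ , 0<c₁ r d 2≤r 3≤d , 0<c₂ r d 2≤r 3≤d , withHighProbability r d 2≤r 3≤d
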